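{- For every prime power $q$ there exists a set $\mathcal X$ of $\frac{q^6-1}{q-1}$ points of $\mathrm{PG}(13,q)$ which is a $(3,2)$-set and which is transitive, i.e. the group of projectivities of $\mathrm{PG}(13,q)$ stabilizing $\mathcal X$ acts transitively on the points of $\mathcal X$.
   Context: For integers $r,s$, an $(r,s)$-set of $\mathrm{PG}(n,q)$ is a set $\mathcal X$ of points such that: (i) every $s$-dimensional projective subspace contains at most $r$ points of $\mathcal X$; (ii) $\mathcal X$ spans $\mathrm{PG}(n,q)$; (iii) some $(s+1)$-dimensional projective subspace contains $r+2$ points of $\mathcal X$. -}

module Defs where

open import Algebra.Bundles using (CommutativeRing)
import Algebra.Construct.Pointwise as Pointwise
open import Algebra.Definitions.RawMonoid using (sum)
open import Algebra.Module.Bundles using (LeftModule)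
open import Algebra.Module.Morphism.Structures using (module LeftModuleMorphisms)
open import Data.Fin.Base using (Fin)
open import Data.Nat.Base
  using (ℕ; suc; _+_; _∸_; _^_; _≤_; _<_; NonZero; >-nonZero; nonTrivial⇒n>1)
open import Data.Nat.Primality using (Prime; prime)
open import Data.Nat.Properties using (m<n⇒0<n∸m; ^-monoʳ-≤; ≤-trans; ≤-reflexive; ^-identityʳ)
open import Data.Product.Base using (∃; ∃₂; _×_; _,_)
open import Data.Vec.Functional using (Vector)
open import Function.Bundles using (Inverse; _⇔_)
open import Function.Definitions using (Injective)
open import Level using (Level; _⊔_) renaming (suc to lsuc)
open import Relation.Binary.PropositionalEquality using (_≡_; refl; setoid; sym)
open import Relation.Nullary using (¬_)
open import Relation.Unary using (Pred)

private
  variable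
    c ℓ : Level

IsPrimePower : ℕ → Set
IsPrimePower q = ∃₂ λ p k → Prime p × 0 < k × q ≡ p ^ k

-- Makes the division by q ∸ 1 legitimate.
q∸1-nonZero : ∀ {q} → IsPrimePower q → NonZero (q ∸ 1)
q∸1-nonZero (p@(suc _) , k , prime _ , 0<k , refl) =
  >-nonZero (m<n⇒0<n∸m (≤-trans (nonTrivial⇒n>1 p)
    (≤-trans (≤-reflexive (sym (^-identityʳ p))) (^-monoʳ-≤ p 0<k))))

-- The standard library's HeytingField carries an apartness relation that is in
-- general stronger than inequality.  For the (finite, hence discrete) fields
-- used here the apartness of interest is inequality itself.
record Field c ℓ : Set (lsuc (c ⊔ ℓ)) where
  field
    commutativeRing : CommutativeRing c ℓ

  open CommutativeRing commutativeRing public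

  field
    0≉1     : ¬ (0# ≈ 1#)
    inverse : ∀ x → ¬ (x ≈ 0#) → ∃ λ y → x * y ≈ 1#

HasOrder : Field c ℓ → ℕ → Set (c ⊔ ℓ)
HasOrder F q = Inverse (setoid (Fin q)) (Field.setoid F)

coordinateSpace : (F : Field c ℓ) → ℕ → LeftModule (Field.ring F) c ℓ
coordinateSpace F d = record
  { Carrierᴹ = Vector F.Carrier d
  ; _≈ᴹ_     = λ u v → ∀ i → u i F.≈ v i
  ; _+ᴹ_     = λ u v i → u i F.+ v i
  ; _*ₗ_     = λ a v i → a F.* v i
  ; 0ᴹ       = λ _ → F.0#
  ; -ᴹ_      = λ v i → F.- v i
  ; isLeftModule = record
    { isLeftSemimodule = record
      { +ᴹ-isCommutativeMonoid =
          Pointwise.isCommutativeMonoid (Fin d) F.+-isCommutativeMonoid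
      ; isPreleftSemimodule = record
        { *ₗ-cong      = λ a≈b u≈v i → F.*-cong a≈b (u≈v i)
        ; *ₗ-zeroˡ     = λ v i → F.zeroˡ (v i)
        ; *ₗ-distribʳ  = λ v a b i → F.distribʳ (v i) a b
        ; *ₗ-identityˡ = λ v i → F.*-identityˡ (v i)
        ; *ₗ-assoc     = λ a b v i → F.*-assoc a b (v i)
        ; *ₗ-zeroʳ     = λ a i → F.zeroʳ a
        ; *ₗ-distribˡ  = λ a u v i → F.distribˡ a (u i) (v i)
        }
      }
    ; -ᴹ‿cong    = λ u≈v i → F.-‿cong (u≈v i)
    ; -ᴹ‿inverse = (λ v i → F.-‿inverseˡ (v i)) , (λ v i → F.-‿inverseʳ (v i))
    }
  }
  where module F = Field F

module PG (F : Field c ℓ) (n : ℕ) where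

  private
    module F = Field F
  open LeftModule (coordinateSpace F (suc n))
  open LeftModuleMorphisms rawLeftModule rawLeftModule using (IsLeftModuleIsomorphism)

  record Point : Set (c ⊔ ℓ) where
    field
      vec     : Carrierᴹ
      nonzero : ¬ (vec ≈ᴹ 0ᴹ)
  open Point public

  infix 4 _∼_

  _∼_ : Point → Point → Set (c ⊔ ℓ)
  P ∼ Q = ∃ λ a → ¬ (a F.≈ F.0#) × vec P ≈ᴹ a *ₗ vec Q

  record PointSet : Set (lsuc (c ⊔ ℓ)) where
    field
      Contains : Pred Point (c ⊔ ℓ)
      respects : ∀ {P Q} → P ∼ Q → Contains P → Contains Q
  open PointSet public

  HasCardinality : PointSet → ℕ → Set (c ⊔ ℓ)
  HasCardinality X N = ∃ λ (f : Fin N → Point) →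
    Injective _≡_ _∼_ f × (∀ P → Contains X P ⇔ ∃ λ i → f i ∼ P)

  record Subspace : Set (lsuc (c ⊔ ℓ)) where
    field
      Member    : Pred Carrierᴹ (c ⊔ ℓ)
      ≈-closed  : ∀ {u v} → u ≈ᴹ v → Member u → Member v
      0-closed  : Member 0ᴹ
      +-closed  : ∀ {u v} → Member u → Member v → Member (u +ᴹ v)
      *ₗ-closed : ∀ a {v} → Member v → Member (a *ₗ v)
  open Subspace public

  infix 4 _liesOn_

  _liesOn_ : Point → Subspace → Set (c ⊔ ℓ)
  P liesOn W = Member W (vec P)

  linearCombination : ∀ {k} → Vector F.Carrier k → Vector Carrierᴹ k → Carrierᴹ
  linearCombination a b = sum +ᴹ-rawMonoid (λ i → a i *ₗ b i)

  record IsBasis (W : Subspace) {k} (b : Vector Carrierᴹ k) : Set (c ⊔ ℓ) where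
    field
      members     : ∀ i → Member W (b i)
      independent : ∀ a → linearCombination a b ≈ᴹ 0ᴹ → ∀ i → a i F.≈ F.0#
      spanning    : ∀ v → Member W v → ∃ λ a → v ≈ᴹ linearCombination a b

  -- Projective dimension: one less than the vector space dimension.
  HasDimension : Subspace → ℕ → Set (c ⊔ ℓ)
  HasDimension W s = ∃ λ (b : Vector Carrierᴹ (suc s)) → IsBasis W b

  -- m pairwise distinct points of X lying on W.
  DistinctPoints : PointSet → Subspace → ℕ → Set (c ⊔ ℓ)
  DistinctPoints X W m = ∃ λ (f : Fin m → Point) →
    Injective _≡_ _∼_ f × (∀ i → Contains X (f i) × f i liesOn W)

  record IsRSSet (r s : ℕ) (X : PointSet) : Set (lsuc (c ⊔ ℓ)) where
    field
      atMost   : ∀ W → HasDimension W s → ∀ m → DistinctPoints X W m → m ≤ r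
      -- No proper subspace contains X.
      spans    : ∀ W → (∀ P → Contains X P → P liesOn W) → ∀ P → P liesOn W
      attained : ∃ λ W → HasDimension W (suc s) × DistinctPoints X W (2 + r)

  record Projectivity : Set (c ⊔ ℓ) where
    field
      map           : Carrierᴹ → Carrierᴹ
      isIsomorphism : IsLeftModuleIsomorphism map

    open IsLeftModuleIsomorphism isIsomorphism

    apply : Point → Point
    apply P .vec       = map (vec P)
    apply P .nonzero e = nonzero P (injective (≈ᴹ-trans e (≈ᴹ-sym 0ᴹ-homo)))
  open Projectivity public using (apply)

  -- As g is bijective on points, this says that g maps X onto X.
  Stabilizes : Projectivity → PointSet → Set (c ⊔ ℓ)
  Stabilizes g X = ∀ P → Contains X P ⇔ Contains X (apply g P)

  IsTransitive : PointSet → Set (c ⊔ ℓ)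
  IsTransitive X = ∀ P Q → Contains X P → Contains X Q →
    ∃ λ g → Stabilizes g X × apply g P ∼ Q

{-# OPTIONS --safe #-}

-- Let E be the field with q⁶ elements, regarded as F_q⁶, and write xᵢ for the power of x
-- with exponent qⁱ.  The set X consists of the points Φ(x) = (x₁x₂x₄ , x₀x₃x₅ , x₀x₂x₄) for
-- nonzero x; the third component lies in the subfield of order q², so these are points of a
-- projective space of dimension 6 + 6 + 2 − 1.  Multiplication by a unit of E acts
-- linearly on the three components, so X is transitive.  The conjugates of the components
-- include the eight products of one factor from each of {x₀, x₁}, {x₂, x₃}, {x₄, x₅}; hence a
-- product of three conjugated determinants z₁y₀ − z₀y₁ is a linear form in Φ(y), and it
-- separates any point of X from three others, so any four points of X are independent.
-- The conjugates of the components are distinct characters of the unit group of E, and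
-- orthogonality of characters recovers every vector as a combination of points of X.  On a line
-- of PG(5,q) the components are binary cubic forms, so five points of a line lie in a
-- solid; for q = 2 and q = 3 a line has fewer than five points, and X has an explicit
-- linear relation between five points instead.

module Submission where

open import Defs
open import Algebra.Bundles using (CommutativeRing; RawRing)
import Algebra.Construct.Pointwise as Pointwise
open import Algebra.Module.Bundles using (LeftModule)
import Algebra.Properties.AbelianGroup as AbelianGroupProperties
import Algebra.Properties.CommutativeMonoid.Sum as CommutativeMonoidSum
import Algebra.Properties.CommutativeSemiring.Exp as Exp
import Algebra.Properties.Group as GroupProperties
import Algebra.Properties.Monoid.Mult as MonoidMult
import Algebra.Properties.Ring as RingProperties
import Algebra.Properties.Semiring.Mult as SemiringMult
import Algebra.Properties.Semiring.Mult.TCOptimised as OptimisedMult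
import Algebra.Properties.Semiring.Sum as SemiringSum
import Algebra.Solver.CommutativeMonoid as MonoidSolver
import Algebra.Solver.Ring as RingSolver
open import Algebra.Solver.Ring.AlmostCommutativeRing
  using (fromCommutativeRing; _-Raw-AlmostCommutative⟶_; Induced-equivalence)
open import Data.Bool.Base using (Bool; true; false)
import Data.Bool.Properties as Bool
open import Data.Empty using (⊥; ⊥-elim)
open import Data.Fin.Base as Fin
  using (Fin; zero; suc; _↑ˡ_; _↑ʳ_; punchIn; splitAt; inject≤; toℕ; combine; remQuot; finToFun; funToFin)
open import Data.Fin.Patterns using (0F; 1F; 2F; 3F; 4F; 5F; 6F; 7F; 8F; 9F)
open import Data.Fin.Permutation using (Permutation; permutation)
import Data.Fin.Properties as Fin
open import Data.Maybe.Base using (just; nothing)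
open import Data.Nat.Base as ℕ using (ℕ; zero; suc; NonZero)
open import Data.Nat.DivMod using (m*n/n≡m; m≡m%n+[m/n]*n)
open import Data.Nat.Divisibility using (_∣_; ∣m+n∣m⇒∣n; m∣m*n; ∣1⇒≡1)
import Data.Nat.Properties as ℕ
open import Data.Nat.Solver using (module +-*-Solver)
open import Data.Product.Base using (_×_; _,_; ∃; ∃₂; proj₁; proj₂; swap)
open import Data.Product.Properties using (≡-dec)
open import Data.Sum.Base using (_⊎_; inj₁; inj₂)
open import Data.Vec.Base as Vec using (Vec)
open import Data.Vec.Functional using (Vector; []; _∷_; _++_; insertAt; removeAt; replicate)
import Data.Vec.Functional.Properties as Vector
import Data.Vec.Properties as Vec
open import Function.Base using (_∘_)
open import Function.Bundles using (Inverse; mk⇔)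
open import Level using (_⊔_; 0ℓ) renaming (suc to lsuc)
open import Relation.Binary.Definitions using (WeaklyDecidable; Tri; tri<; tri≈; tri>)
open import Relation.Binary.PropositionalEquality as ≡ using (_≡_; _≢_)
import Relation.Binary.Reasoning.Setoid as SetoidReasoning
open import Relation.Nullary.Decidable
  using (Dec; yes; no; map′; ¬?; decidable-stable; from-yes; _→-dec_)
open import Relation.Nullary.Negation using (¬_; contradiction)

-- The dimension 14 is a count of orbits. The eight subsets of Z/6 that meet each of {0,1}, {2,3},
-- {4,5} once all lie in the rotation orbits of {1,2,4}, {0,3,5} and {0,2,4}, of lengths 6, 6 and 2;
-- these lengths are the degrees over F_q of the fields in which the three components live. A
-- determinant z₁y₀ - z₀y₁ vanishes only if y/z lies in F_q, and conjugating three of them by 0, 2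
-- and 4 places puts them on disjoint pairs of conjugates, so that their product uses only these
-- eight monomials.
--
-- F is given by an enumeration of its q elements, and the field theory is obtained by counting. The
-- maps x² - x and x³ - x agree at 0 and 1, so they miss a value c, and t² - t - c or t³ - t - c has
-- no root; the degree 2 step lies below the degree 3 step because the third component needs the
-- subfield of order q². Additivity of the q-th power and the description of its fixed elements come
-- from the bound on the number of roots of a polynomial function. For q = 2 and q = 3 the value c =
-- 1 is missed, which makes the tower explicit enough to check a relation by arithmetic modulo q.

-- A ring solver with integer coefficients

-- A solver with integer coefficients, given as formal differences m − n.
module IntegerSolver {c ℓ} (R : CommutativeRing c ℓ) where

  open CommutativeRing R
  open OptimisedMult semiring using (×-homo-+; ×1-homo-*) renaming (_×_ to _·_)
  open AbelianGroupProperties +-abelianGroup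
    using (⁻¹-∙-comm; ⁻¹-anti-homo-∙; ⁻¹-involutive; ε⁻¹≈ε)
  open RingProperties ring using (-‿distribˡ-*; -‿distribʳ-*)
  open SetoidReasoning setoid

  private
    _⊞_ _⊠_ : ℕ × ℕ → ℕ × ℕ → ℕ × ℕ
    (a , b) ⊞ (a′ , b′) = a ℕ.+ a′ , b ℕ.+ b′
    (a , b) ⊠ (a′ , b′) = a ℕ.* a′ ℕ.+ b ℕ.* b′ , a ℕ.* b′ ℕ.+ b ℕ.* a′

    -- Makes the representation of each coefficient unique, so that the solver
    -- recognises equal coefficients.
    reduce : ℕ × ℕ → ℕ × ℕ
    reduce (ℕ.suc a , ℕ.suc b) = reduce (a , b)
    reduce x                   = x

    differences : RawRing 0ℓ 0ℓ
    differences = record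
      { Carrier = ℕ × ℕ
      ; _≈_     = _≡_
      ; _+_     = λ x y → reduce (x ⊞ y)
      ; _*_     = λ x y → reduce (x ⊠ y)
      ; -_      = swap
      ; 0#      = 0 , 0
      ; 1#      = 1 , 0
      }

    open MonoidSolver +-commutativeMonoid using (_⊕_; _⊜_) renaming (solve to solveMonoid)

    difference : ℕ × ℕ → Carrier
    difference (a , b) = a · 1# + - (b · 1#)

    -- Interprets (0 , 0) and (1 , 0) as 0# and 1# definitionally.
    value : ℕ × ℕ → Carrier
    value (a , ℕ.zero)    = a · 1#
    value (a , ℕ.suc b) = difference (a , ℕ.suc b)

    value≈difference : ∀ x → value x ≈ difference x
    value≈difference (a , ℕ.zero)  = sym (trans (+-congˡ ε⁻¹≈ε) (+-identityʳ _))
    value≈difference (a , ℕ.suc b) = refl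

    difference-+ : ∀ x y → difference (x ⊞ y) ≈ difference x + difference y
    difference-+ (a , b) (a′ , b′) = begin
      (a ℕ.+ a′) · 1# + - ((b ℕ.+ b′) · 1#)
        ≈⟨ +-cong (×-homo-+ 1# a a′) (trans (-‿cong (×-homo-+ 1# b b′)) (sym (⁻¹-∙-comm _ _))) ⟩
      a · 1# + a′ · 1# + (- (b · 1#) + - (b′ · 1#))
        ≈⟨ solveMonoid 4 (λ x y z w → (x ⊕ y) ⊕ (z ⊕ w) ⊜ (x ⊕ z) ⊕ (y ⊕ w)) refl _ _ _ _ ⟩
      difference (a , b) + difference (a′ , b′) ∎

    difference-* : ∀ x y → difference (x ⊠ y) ≈ difference x * difference y
    difference-* (a , b) (a′ , b′) = begin
      (a ℕ.* a′ ℕ.+ b ℕ.* b′) · 1# + - ((a ℕ.* b′ ℕ.+ b ℕ.* a′) · 1#)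
        ≈⟨ difference-+ (a ℕ.* a′ , a ℕ.* b′) (b ℕ.* b′ , b ℕ.* a′) ⟩
      (a ℕ.* a′) · 1# + - ((a ℕ.* b′) · 1#) + ((b ℕ.* b′) · 1# + - ((b ℕ.* a′) · 1#))
        ≈⟨ +-cong
             (+-cong (×1-homo-* a a′) (trans (-‿cong (×1-homo-* a b′)) (-‿distribʳ-* _ _)))
             (+-cong
               (trans (×1-homo-* b b′) (trans (sym (⁻¹-involutive _))
                 (trans (-‿cong (-‿distribˡ-* _ _)) (-‿distribʳ-* _ _))))
               (trans (-‿cong (×1-homo-* b a′)) (-‿distribˡ-* _ _))) ⟩
      A * A′ + A * - B′ + (- B * - B′ + - B * A′)
        ≈⟨ +-cong (sym (distribˡ _ _ _)) (trans (+-comm _ _) (sym (distribˡ _ _ _))) ⟩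
      A * (A′ + - B′) + - B * (A′ + - B′)
        ≈⟨ sym (distribʳ _ _ _) ⟩
      difference (a , b) * difference (a′ , b′) ∎
      where
      A = a · 1# ; B = b · 1# ; A′ = a′ · 1# ; B′ = b′ · 1#

    difference-- : ∀ x → difference (swap x) ≈ - difference x
    difference-- (a , b) = trans (+-comm _ _)
      (trans (+-congˡ (sym (⁻¹-involutive _))) (⁻¹-∙-comm _ _))

    difference-≈ : ∀ a b a′ b′ → a ℕ.+ b′ ≡ a′ ℕ.+ b → difference (a , b) ≈ difference (a′ , b′)
    difference-≈ a b a′ b′ eq = begin
      A + - B                ≈⟨ +-congˡ (sym (+-identityʳ _)) ⟩
      A + (- B + 0#)         ≈⟨ +-congˡ (+-congˡ (sym (-‿inverseʳ B′))) ⟩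
      A + (- B + (B′ + - B′)) ≈⟨ solveMonoid 4 (λ x y z w → x ⊕ (y ⊕ (z ⊕ w)) ⊜ (x ⊕ z) ⊕
        (w ⊕ y)) refl _ _ _ _ ⟩
      A + B′ + (- B′ + - B)
        ≈⟨ +-congʳ (trans (sym (×-homo-+ 1# a b′))
             (trans (reflexive (≡.cong (_· 1#) eq)) (×-homo-+ 1# a′ b))) ⟩
      A′ + B + (- B′ + - B)
        ≈⟨ solveMonoid 4 (λ x y z w → (x ⊕ y) ⊕ (z ⊕ w) ⊜ x ⊕ (z ⊕ (y ⊕ w))) refl _ _ _ _ ⟩
      A′ + (- B′ + (B + - B)) ≈⟨ +-congˡ (+-congˡ (-‿inverseʳ B)) ⟩
      A′ + (- B′ + 0#)        ≈⟨ +-congˡ (+-identityʳ _) ⟩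
      A′ + - B′               ∎
      where
      A = a · 1# ; B = b · 1# ; A′ = a′ · 1# ; B′ = b′ · 1#

    difference-reduce : ∀ x → difference (reduce x) ≈ difference x
    difference-reduce (ℕ.zero , b)        = refl
    difference-reduce (ℕ.suc a , ℕ.zero)  = refl
    difference-reduce (ℕ.suc a , ℕ.suc b) = trans (difference-reduce (a , b))
      (difference-≈ a b (ℕ.suc a) (ℕ.suc b) (ℕ.+-suc a b))

    via : ∀ x {y z} → difference x ≈ y → z ≈ y → value x ≈ z
    via x p q = trans (value≈difference x) (trans p (sym q))

    morphism : differences -Raw-AlmostCommutative⟶ fromCommutativeRing R
    morphism = record
      { ⟦_⟧    = value
      ; +-homo = λ x y → via (reduce (x ⊞ y)) (trans (difference-reduce (x ⊞ y)) (difference-+ x y))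
          (+-cong (value≈difference x) (value≈difference y))
      ; *-homo = λ x y → via (reduce (x ⊠ y)) (trans (difference-reduce (x ⊠ y)) (difference-* x y))
          (*-cong (value≈difference x) (value≈difference y))
      ; -‿homo = λ x → via (swap x) (difference-- x) (-‿cong (value≈difference x))
      ; 0-homo = refl
      ; 1-homo = refl
      }

    -- Equal integers have equal images. Unequal integers may still have equal images in positive
    -- characteristic, hence only weak decidability.
    decide : WeaklyDecidable (Induced-equivalence morphism)
    decide (a , b) (a′ , b′) with a ℕ.+ b′ ℕ.≟ a′ ℕ.+ b
    ... | yes eq = just (trans (value≈difference (a , b)) (trans (difference-≈ a b a′ b′ eq) (sym
      (value≈difference (a′ , b′)))))
    ... | no  _  = nothing

  open RingSolver differences (fromCommutativeRing R) morphism decide public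

  :1 : ∀ {n} → Polynomial n
  :1 = con (1 , 0)

  :0 : ∀ {n} → Polynomial n
  :0 = con (0 , 0)

-- Quotient rings of degree two and three

-- The common skeleton of both quotient rings: addition is coordinatewise, so only the laws of the
-- product remain to be supplied.
pointwiseRing : ∀ {a ℓ} (R : CommutativeRing a ℓ) (d : ℕ) → let open CommutativeRing R in
  (_∙_ : Vector Carrier d → Vector Carrier d → Vector Carrier d) (one : Vector Carrier d) →
  (∀ {x y u v} → (∀ i → x i ≈ y i) → (∀ i → u i ≈ v i) → ∀ i → (x ∙ u) i ≈ (y ∙ v) i) →
  (∀ x y i → (x ∙ y) i ≈ (y ∙ x) i) →
  (∀ x y z i → ((x ∙ y) ∙ z) i ≈ (x ∙ (y ∙ z)) i) →
  (∀ x i → (one ∙ x) i ≈ x i) →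
  (∀ x y z i → (x ∙ (λ j → y j + z j)) i ≈ (x ∙ y) i + (x ∙ z) i) →
  CommutativeRing a ℓ
pointwiseRing R d _∙_ one ∙-cong ∙-comm ∙-assoc ∙-identityˡ ∙-distribˡ = record
  { Carrier = Vector Carrier d
  ; _≈_     = λ x y → ∀ i → x i ≈ y i
  ; _+_     = λ x y i → x i + y i
  ; _*_     = _∙_
  ; -_      = λ x i → - x i
  ; 0#      = λ _ → 0#
  ; 1#      = one
  ; isCommutativeRing = record
    { isRing = record
      { +-isAbelianGroup = Pointwise.isAbelianGroup (Fin d) +-isAbelianGroup
      ; *-cong     = ∙-cong
      ; *-assoc    = ∙-assoc
      ; *-identity = ∙-identityˡ
                   , λ x i → trans (∙-comm x one i) (∙-identityˡ x i)
      ; distrib    = ∙-distribˡ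
                   , λ x y z i → trans (∙-comm (λ j → y j + z j) x i)
                       (trans (∙-distribˡ x y z i) (+-cong (∙-comm x y i) (∙-comm x z i)))
      }
    ; *-comm = ∙-comm
    }
  }
  where open CommutativeRing R

-- R[t]/(t² − t − c)
module Quadratic {a ℓ} (R : CommutativeRing a ℓ) (c : CommutativeRing.Carrier R) where
  open CommutativeRing R
  open IntegerSolver R

  private
    -- Used for ring elements and for solver polynomials.
    multiply : ∀ {b} {A : Set b} (_⊕_ _⊗_ : A → A → A) → A →
      Vector A 2 → Vector A 2 → Vector A 2
    multiply _⊕_ _⊗_ c x y 0F = (x 0F ⊗ y 0F) ⊕ (c ⊗ (x 1F ⊗ y 1F))
    multiply _⊕_ _⊗_ c x y 1F = ((x 0F ⊗ y 1F) ⊕ (x 1F ⊗ y 0F)) ⊕ (x 1F ⊗ y 1F)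

    _∙_ : Vector Carrier 2 → Vector Carrier 2 → Vector Carrier 2
    _∙_ = multiply _+_ _*_ c

    one : Vector Carrier 2
    one 0F      = 1#
    one (suc _) = 0#

    _⊙_ : Vector (Polynomial 7) 2 → Vector (Polynomial 7) 2 → Vector (Polynomial 7) 2
    _⊙_ = multiply _:+_ _:*_ (var 0F)

    X Y Z : Vector (Polynomial 7) 2
    X = var 1F ∷ var 2F ∷ []
    Y = var 3F ∷ var 4F ∷ []
    Z = var 5F ∷ var 6F ∷ []

    environment : (x y z : Vector Carrier 2) → Vec Carrier 7
    environment x y z = c Vec.∷ x 0F Vec.∷ x 1F Vec.∷ y 0F Vec.∷ y 1F Vec.∷ z 0F Vec.∷ z 1F Vec.∷ Vec.[]

    ∙-cong : ∀ {x y u v} → (∀ i → x i ≈ y i) → (∀ i → u i ≈ v i) → ∀ i → (x ∙ u) i ≈ (y ∙ v) i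
    ∙-cong p q 0F = +-cong (*-cong (p 0F) (q 0F)) (*-congˡ (*-cong (p 1F) (q 1F)))
    ∙-cong p q 1F = +-cong (+-cong (*-cong (p 0F) (q 1F)) (*-cong (p 1F) (q 0F)))
      (*-cong (p 1F) (q 1F))

    ∙-comm : ∀ x y i → (x ∙ y) i ≈ (y ∙ x) i
    ∙-comm x y = λ { 0F → at 0F refl ; 1F → at 1F refl }
      -- Normal forms compute only at a concrete index, so the `refl` of the solver is supplied
      -- after the case split.
      where at = λ i → prove (environment x y x) ((X ⊙ Y) i) ((Y ⊙ X) i)

    ∙-assoc : ∀ x y z i → ((x ∙ y) ∙ z) i ≈ (x ∙ (y ∙ z)) i
    ∙-assoc x y z = λ { 0F → at 0F refl ; 1F → at 1F refl }
      where at = λ i → prove (environment x y z) (((X ⊙ Y) ⊙ Z) i) ((X ⊙ (Y ⊙ Z)) i)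

    ∙-identityˡ : ∀ x i → (one ∙ x) i ≈ x i
    ∙-identityˡ x = λ { 0F → at 0F refl ; 1F → at 1F refl }
      where at = λ i → prove (environment x x x) (((:1 ∷ :0 ∷ []) ⊙ X) i) (X i)

    ∙-distribˡ : ∀ x y z i → (x ∙ (λ j → y j + z j)) i ≈ (x ∙ y) i + (x ∙ z) i
    ∙-distribˡ x y z = λ { 0F → at 0F refl ; 1F → at 1F refl }
      where at = λ i → prove (environment x y z) ((X ⊙ (λ j → Y j :+ Z j)) i) ((X ⊙ Y) i :+ (X ⊙ Z) i)

  commutativeRing : CommutativeRing a ℓ
  commutativeRing = pointwiseRing R 2 _∙_ one ∙-cong ∙-comm ∙-assoc ∙-identityˡ ∙-distribˡ

-- R[t]/(t³ − t − c)
module Cubic {a ℓ} (R : CommutativeRing a ℓ) (c : CommutativeRing.Carrier R) where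
  open CommutativeRing R
  open IntegerSolver R

  private
    -- Used for ring elements and for solver polynomials.
    multiply : ∀ {b} {A : Set b} (_⊕_ _⊗_ : A → A → A) → A →
      Vector A 3 → Vector A 3 → Vector A 3
    multiply _⊕_ _⊗_ c x y 0F =
      (x 0F ⊗ y 0F) ⊕ (c ⊗ ((x 1F ⊗ y 2F) ⊕ (x 2F ⊗ y 1F)))
    multiply _⊕_ _⊗_ c x y 1F =
      (((x 0F ⊗ y 1F) ⊕ (x 1F ⊗ y 0F)) ⊕ ((x 1F ⊗ y 2F) ⊕ (x 2F ⊗ y 1F))) ⊕ (c ⊗ (x 2F ⊗ y 2F))
    multiply _⊕_ _⊗_ c x y 2F =
      (((x 0F ⊗ y 2F) ⊕ (x 1F ⊗ y 1F)) ⊕ (x 2F ⊗ y 0F)) ⊕ (x 2F ⊗ y 2F)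

    _∙_ : Vector Carrier 3 → Vector Carrier 3 → Vector Carrier 3
    _∙_ = multiply _+_ _*_ c

    one : Vector Carrier 3
    one 0F      = 1#
    one (suc _) = 0#

    _⊙_ : Vector (Polynomial 10) 3 → Vector (Polynomial 10) 3 → Vector (Polynomial 10) 3
    _⊙_ = multiply _:+_ _:*_ (var 0F)

    X Y Z : Vector (Polynomial 10) 3
    X = var 1F ∷ var 2F ∷ var 3F ∷ []
    Y = var 4F ∷ var 5F ∷ var 6F ∷ []
    Z = var 7F ∷ var 8F ∷ var 9F ∷ []

    environment : (x y z : Vector Carrier 3) → Vec Carrier 10
    environment x y z = c Vec.∷ x 0F Vec.∷ x 1F Vec.∷ x 2F Vec.∷ y 0F Vec.∷ y 1F Vec.∷ y 2F Vec.∷ z 0F Vec.∷ z 1F Vec.∷ z 2F Vec.∷ Vec.[]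

    ∙-cong : ∀ {x y u v} → (∀ i → x i ≈ y i) → (∀ i → u i ≈ v i) → ∀ i → (x ∙ u) i ≈ (y ∙ v) i
    ∙-cong p q 0F = +-cong (*-cong (p 0F) (q 0F))
      (*-congˡ (+-cong (*-cong (p 1F) (q 2F)) (*-cong (p 2F) (q 1F))))
    ∙-cong p q 1F = +-cong
      (+-cong (+-cong (*-cong (p 0F) (q 1F)) (*-cong (p 1F) (q 0F)))
        (+-cong (*-cong (p 1F) (q 2F)) (*-cong (p 2F) (q 1F))))
      (*-congˡ (*-cong (p 2F) (q 2F)))
    ∙-cong p q 2F = +-cong
      (+-cong (+-cong (*-cong (p 0F) (q 2F)) (*-cong (p 1F) (q 1F))) (*-cong (p 2F) (q 0F)))
      (*-cong (p 2F) (q 2F))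

    ∙-comm : ∀ x y i → (x ∙ y) i ≈ (y ∙ x) i
    ∙-comm x y = λ { 0F → at 0F refl ; 1F → at 1F refl ; 2F → at 2F refl }
      where at = λ i → prove (environment x y x) ((X ⊙ Y) i) ((Y ⊙ X) i)

    ∙-assoc : ∀ x y z i → ((x ∙ y) ∙ z) i ≈ (x ∙ (y ∙ z)) i
    ∙-assoc x y z = λ { 0F → at 0F refl ; 1F → at 1F refl ; 2F → at 2F refl }
      where at = λ i → prove (environment x y z) (((X ⊙ Y) ⊙ Z) i) ((X ⊙ (Y ⊙ Z)) i)

    ∙-identityˡ : ∀ x i → (one ∙ x) i ≈ x i
    ∙-identityˡ x = λ { 0F → at 0F refl ; 1F → at 1F refl ; 2F → at 2F refl }
      where at = λ i → prove (environment x x x) (((:1 ∷ :0 ∷ :0 ∷ []) ⊙ X) i) (X i)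

    ∙-distribˡ : ∀ x y z i → (x ∙ (λ j → y j + z j)) i ≈ (x ∙ y) i + (x ∙ z) i
    ∙-distribˡ x y z = λ { 0F → at 0F refl ; 1F → at 1F refl ; 2F → at 2F refl }
      where at = λ i → prove (environment x y z) ((X ⊙ (λ j → Y j :+ Z j)) i) ((X ⊙ Y) i :+ (X ⊙ Z) i)

  commutativeRing : CommutativeRing a ℓ
  commutativeRing = pointwiseRing R 3 _∙_ one ∙-cong ∙-comm ∙-assoc ∙-identityˡ ∙-distribˡ

-- Fields, polynomial functions and the bound on roots

DecidableZero : ∀ {c ℓ} → Field c ℓ → Set (c ⊔ ℓ)
DecidableZero F = ∀ x → Dec (x ≈ 0#)
  where open Field F

module FieldProperties {c ℓ} (F : Field c ℓ) where
  open Field F hiding (zero)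
  open SetoidReasoning setoid

  1≉0 : ¬ 1# ≈ 0#
  1≉0 = 0≉1 ∘ sym

  *-cancelˡ-nonzero : ∀ a {x y} → ¬ a ≈ 0# → a * x ≈ a * y → x ≈ y
  *-cancelˡ-nonzero a {x} {y} a≉0 ax≈ay with b , ab≈1 ← inverse a a≉0 = begin
    x           ≈⟨ *-identityˡ x ⟨
    1# * x      ≈⟨ *-congʳ ab≈1 ⟨
    a * b * x   ≈⟨ rearrange x ⟩
    b * (a * x) ≈⟨ *-congˡ ax≈ay ⟩
    b * (a * y) ≈⟨ rearrange y ⟨
    a * b * y   ≈⟨ *-congʳ ab≈1 ⟩
    1# * y      ≈⟨ *-identityˡ y ⟩
    y           ∎
    where
    rearrange : ∀ z → a * b * z ≈ b * (a * z)
    rearrange z = trans (*-congʳ (*-comm a b)) (*-assoc b a z)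

  *-zero-cancelˡ : ∀ {a x} → ¬ a ≈ 0# → a * x ≈ 0# → x ≈ 0#
  *-zero-cancelˡ {a} a≉0 ax≈0 = *-cancelˡ-nonzero a a≉0 (trans ax≈0 (sym (zeroʳ a)))

  *-nonzero : ∀ {a x} → ¬ a ≈ 0# → ¬ x ≈ 0# → ¬ a * x ≈ 0#
  *-nonzero a≉0 x≉0 = x≉0 ∘ *-zero-cancelˡ a≉0

  unit-nonzero : ∀ {a b} → a * b ≈ 1# → ¬ a ≈ 0#
  unit-nonzero ab≈1 a≈0 = 0≉1 (trans (sym (zeroˡ _)) (trans (*-congʳ (sym a≈0)) ab≈1))

  x-y≈0⇒x≈y : ∀ {x y} → x - y ≈ 0# → x ≈ y
  x-y≈0⇒x≈y {x} {y} eq = begin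
    x             ≈⟨ solve 2 (λ x y → x := (x :- y) :+ y) refl x y ⟩
    (x - y) + y   ≈⟨ +-congʳ eq ⟩
    0# + y        ≈⟨ +-identityˡ y ⟩
    y             ∎
    where open IntegerSolver commutativeRing

-- PolynomialOfDegree n a f says that f is a polynomial function of degree at most n
-- whose coefficient of degree n is a; a may vanish.
module PolynomialFunctions {c ℓ} (F : Field c ℓ) where
  open Field F hiding (zero)
  open FieldProperties F
  open IntegerSolver commutativeRing using (solve; _:=_; _:+_; _:*_; _:-_; :0)
  open Exp commutativeSemiring using (_^_)

  PolynomialOfDegree : ℕ → Carrier → (Carrier → Carrier) → Set (c ⊔ ℓ)
  PolynomialOfDegree zero    a f = ∀ x → f x ≈ a
  PolynomialOfDegree (suc n) a f = ∃ λ b → ∃ λ g →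
    PolynomialOfDegree n a g × ∀ x → f x ≈ b + x * g x

  add : ∀ n {a b f g} → PolynomialOfDegree n a f → PolynomialOfDegree n b g →
    PolynomialOfDegree n (a + b) (λ x → f x + g x)
  add zero    p q x = +-cong (p x) (q x)
  add (suc n) (b , g , p , f≈) (b′ , g′ , p′ , f′≈) =
    b + b′ , (λ x → g x + g′ x) , add n p p′ , λ x → trans (+-cong (f≈ x) (f′≈ x))
      (solve 5 (λ b b′ x g g′ → b :+ x :* g :+ (b′ :+ x :* g′) := b :+ b′ :+ x :* (g :+ g′))
        refl b b′ x (g x) (g′ x))

  shift : ∀ n {a f} → PolynomialOfDegree n a f → PolynomialOfDegree (suc n) a (λ x → x * f x)
  shift n p = 0# , _ , p , λ x → sym (+-identityˡ _)

  raise : ∀ n {a f} → PolynomialOfDegree n a f → PolynomialOfDegree (suc n) 0# f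
  raise zero    {a} p = a , (λ _ → 0#) , (λ _ → refl) ,
    λ x → trans (p x) (sym (trans (+-congˡ (zeroʳ x)) (+-identityʳ a)))
  raise (suc n) (b , g , p , f≈) = b , g , raise n p , f≈

  constant : ∀ n b → ∃ λ a → PolynomialOfDegree n a (λ _ → b)
  constant zero    b = b , λ _ → refl
  constant (suc n) b = 0# , raise n (proj₂ (constant n b))

  scaleBy : ∀ n b {a f} → PolynomialOfDegree n a f → PolynomialOfDegree n (b * a) (λ x → b * f x)
  scaleBy zero    b p x = *-congˡ (p x)
  scaleBy (suc n) b (b′ , g , p , f≈) = b * b′ , (λ x → b * g x) , scaleBy n b p , λ x →
    trans (*-congˡ (f≈ x))
      (solve 4 (λ b b′ x y → b :* (b′ :+ x :* y) := b :* b′ :+ x :* (b :* y)) refl b b′ x (g x))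

  power : ∀ n → PolynomialOfDegree n 1# (_^ n)
  power zero    x = refl
  power (suc n)   = shift n (power n)

  -- A summand of lower degree leaves the leading coefficient literally unchanged, so that a root
  -- count can end in `1# ≈ 0#`.
  addLower : ∀ {m n} {a b f g} → m ℕ.< n → PolynomialOfDegree n a f → PolynomialOfDegree m b g →
    PolynomialOfDegree n a (λ x → f x + g x)
  addLower {zero} {suc n} {b = b} {g = g} _ (b′ , h , p , f≈) q = b′ + b , h , p , λ x →
    trans (+-cong (f≈ x) (q x))
      (solve 3 (λ b b′ y → b′ :+ y :+ b := b′ :+ b :+ y) refl b b′ (x * h x))
  addLower {suc m} {suc n} (ℕ.s≤s m<n) (b , h , p , f≈) (b′ , h′ , p′ , g≈) =
    b + b′ , (λ x → h x + h′ x) , addLower m<n p p′ , λ x → trans (+-cong (f≈ x) (g≈ x))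
      (solve 5 (λ b b′ x g g′ → b :+ x :* g :+ (b′ :+ x :* g′) := b :+ b′ :+ x :* (g :+ g′))
        refl b b′ x (h x) (h′ x))

  -- Horner's scheme: the quotient for b + x g is assembled from the value g r and the quotient for
  -- g.
  factor : ∀ n {a f} → PolynomialOfDegree (suc n) a f → ∀ r →
    ∃ λ h → PolynomialOfDegree n a h × ∀ x → f x ≈ f r + (x - r) * h x
  factor zero {a} (b , g , p , f≈) r = (λ _ → a) , (λ _ → refl) , λ x →
    trans (f≈ x) (trans (+-congˡ (*-congˡ (p x)))
      (trans (solve 4 (λ a b x r → b :+ x :* a := b :+ r :* a :+ (x :- r) :* a) refl a b x r)
        (+-congʳ (sym (trans (f≈ r) (+-congˡ (*-congˡ (p r))))))))
  factor (suc n) {f = f} (b , g , p , f≈) r with h , ph , g≈ ← factor n p r =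
    (λ x → g r + x * h x) , (g r , h , ph , λ x → refl) , λ x →
    trans (f≈ x) (trans (+-congˡ (*-congˡ (g≈ x)))
      (trans (solve 5 (λ b x r gr hx → b :+ x :* (gr :+ (x :- r) :* hx)
                        := b :+ r :* gr :+ (x :- r) :* (gr :+ x :* hx))
               refl b x r (g r) (h x))
        (+-congʳ (sym (f≈ r)))))

  -- The linear factor split off at the first root is nonzero at the other roots, which are
  -- therefore roots of the quotient. The vanishing leading coefficient serves for contradictions,
  -- the vanishing function for identities beyond the listed roots.
  manyRoots⇒zero : ∀ n {a f} → PolynomialOfDegree n a f → (r : Vector Carrier (suc n)) →
    (∀ {i j} → r i ≈ r j → i ≡ j) → (∀ i → f (r i) ≈ 0#) → a ≈ 0# × ∀ x → f x ≈ 0#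
  manyRoots⇒zero zero p r distinct root =
    trans (sym (p _)) (root zero) , λ x → trans (p x) (trans (sym (p _)) (root zero))
  manyRoots⇒zero (suc n) {f = f} p r distinct root
    with h , ph , f≈ ← factor n p (r zero) =
    proj₁ rest , λ x → trans (f≈′ x) (trans (*-congˡ (proj₂ rest x)) (zeroʳ _))
    where
    f≈′ : ∀ x → f x ≈ (x - r zero) * h x
    f≈′ x = trans (f≈ x) (trans (+-congʳ (root zero)) (+-identityˡ _))
    rest = manyRoots⇒zero n ph (r ∘ suc) (Fin.suc-injective ∘ distinct) λ i →
      *-zero-cancelˡ
        (λ eq → Fin.0≢1+n (≡.sym (distinct (x-y≈0⇒x≈y eq))))
        (trans (sym (f≈′ (r (suc i)))) (root (suc i)))

-- Sums and products over a finite field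

module FiniteField {c ℓ} (F : Field c ℓ) {N} (order : HasOrder F N) where
  open Field F hiding (zero)
  open FieldProperties F
  open Exp commutativeSemiring
  open SemiringSum semiring using (sum; sum-permute; ∑-distrib-+; sum-cong-≋; sum-replicate)
  open MonoidMult +-monoid using () renaming (_×_ to _·_)
  open SetoidReasoning setoid

  element : Fin N → Carrier
  element = Inverse.to order

  index : Carrier → Fin N
  index = Inverse.from order

  element-index : ∀ x → element (index x) ≈ x
  element-index = Inverse.strictlyInverseˡ order

  index-element : ∀ i → index (element i) ≡ i
  index-element = Inverse.strictlyInverseʳ order

  index-cong : ∀ {x y} → x ≈ y → index x ≡ index y
  index-cong = Inverse.from-cong order

  element-injective : ∀ {i j} → element i ≈ element j → i ≡ j
  element-injective {i} {j} eq =
    ≡.trans (≡.sym (index-element i)) (≡.trans (index-cong eq) (index-element j))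

  infix 4 _≟_
  _≟_ : ∀ x y → Dec (x ≈ y)
  x ≟ y = map′
    (λ eq → trans (sym (element-index x)) (trans (reflexive (≡.cong element eq)) (element-index y)))
    index-cong (index x Fin.≟ index y)

  multiplication : ∀ {a b} → a * b ≈ 1# → Permutation N N
  multiplication {a} {b} ab≈1 = permutation (λ i → index (a * element i)) (λ i → index (b * element i))
    (λ i → cancel ab≈1 i) (λ i → cancel (trans (*-comm b a) ab≈1) i)
    where
    cancel : ∀ {a b} → a * b ≈ 1# → ∀ i → index (a * element (index (b * element i))) ≡ i
    cancel {a} {b} ab≈1 i = ≡.trans (index-cong (trans (*-congˡ (element-index _))
      (trans (sym (*-assoc a b _)) (trans (*-congʳ ab≈1) (*-identityˡ _))))) (index-element i)

  ∑ : (Carrier → Carrier) → Carrier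
  ∑ f = sum (f ∘ element)

  ∑-scale : ∀ f → (∀ {x y} → x ≈ y → f x ≈ f y) → ∀ {a} → ¬ a ≈ 0# → ∑ f ≈ ∑ (λ x → f (a * x))
  ∑-scale f f-cong {a} a≉0 with b , ab≈1 ← inverse a a≉0 = begin
    sum (f ∘ element) ≈⟨ sum-permute (f ∘ element) (multiplication ab≈1) ⟩
    sum (λ i → f (element (index (a * element i)))) ≈⟨ sum-cong-≋ {N} (λ i → f-cong (element-index
      (a * element i))) ⟩
    sum (λ i → f (a * element i)) ∎

  -- Translation by 1 permutes the elements, so adding 1 to every summand leaves the sum of all
  -- elements unchanged.
  order·1≈0 : N · 1# ≈ 0#
  order·1≈0 = begin
    N · 1#                               ≈⟨ solve 2 (λ x y → y := x :+ y :- x) refl (sum element)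
      (N · 1#) ⟩
    sum element + N · 1# - sum element   ≈⟨ +-congʳ (+-congˡ (sum-replicate N)) ⟨
    sum element + sum {N} (λ _ → 1#) - sum element ≈⟨ +-congʳ (∑-distrib-+ element (λ _ → 1#)) ⟨
    sum (λ i → element i + 1#) - sum element ≈⟨ +-congʳ (sum-cong-≋ {N} (λ i → element-index
      (element i + 1#))) ⟨
    sum (λ i → element (index (element i + 1#))) - sum element
      ≈⟨ +-congʳ (sum-permute element translation) ⟨
    sum element - sum element ≈⟨ -‿inverseʳ _ ⟩
    0# ∎
    where
    open IntegerSolver commutativeRing using (solve; _:=_; _:+_; _:-_)
    cancel : ∀ {a b} → a + b ≈ 0# → ∀ i → index (element (index (element i + b)) + a) ≡ i
    cancel {a} {b} eq i = ≡.trans (index-cong (trans (+-congʳ (element-index _))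
      (trans (+-assoc _ b a) (trans (+-congˡ (trans (+-comm b a) eq)) (+-identityʳ _)))))
        (index-element i)
    translation : Permutation N N
    translation = permutation (λ i → index (element i + 1#)) (λ i → index (element i + - 1#))
      (λ i → cancel (-‿inverseʳ 1#) i) (λ i → cancel (-‿inverseˡ 1#) i)

module _ {c ℓ} (F : Field c ℓ) where
  open Field F hiding (zero)
  open FieldProperties F
  open Exp commutativeSemiring
  open SetoidReasoning setoid
  private module ∏ = CommutativeMonoidSum *-commutativeMonoid

  -- Multiplication by a permutes the units, so their product P satisfies P aⁿ = P, and P is
  -- nonzero. The permutation acts on all indices, including that of zero; `orOne` turns the factor
  -- at zero into 1.
  unit-power : ∀ {n} → HasOrder F (suc n) → ∀ {a} → ¬ a ≈ 0# → a ^ n ≈ 1#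
  unit-power {n} order {a} a≉0 = *-cancelˡ-nonzero P P≉0 (begin
    P * a ^ n ≈⟨ *-comm P (a ^ n) ⟩
    a ^ n * P ≈⟨ *-congʳ (∏.sum-replicate n) ⟨
    ∏.sum {n} (replicate n a) * P ≈⟨ ∏.∑-distrib-+ {n} (λ _ → a) unit ⟨
    ∏.sum (λ j → a * unit j)
      ≈⟨ ∏.sum-cong-≋ (λ j → sym (orOne-nonzero (*-nonzero a≉0 (unit-nonzero′ j)))) ⟩
    ∏.sum (λ j → orOne (a * unit j)) ≈⟨ *-identityˡ _ ⟨
    1# * ∏.sum (λ j → orOne (a * unit j))
      ≈⟨ *-congʳ (orOne-zero (trans (*-congˡ (element-index 0#)) (zeroʳ a))) ⟨
    orOne (a * element i₀) * ∏.sum (λ j → orOne (a * unit j))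
      ≈⟨ ∏.sum-remove {i = i₀} (λ i → orOne (a * element i)) ⟨
    ∏.sum (λ i → orOne (a * element i)) ≈⟨ ∏.sum-cong-≋ {suc n} (λ i → orOne-cong (element-index
      (a * element i))) ⟨
    ∏.sum (λ i → orOne (element (index (a * element i))))
      ≈⟨ ∏.sum-permute (orOne ∘ element) (multiplication (proj₂ (inverse a a≉0))) ⟨
    ∏.sum (orOne ∘ element) ≈⟨ ∏.sum-remove {i = i₀} (orOne ∘ element) ⟩
    orOne (element i₀) * ∏.sum (orOne ∘ unit) ≈⟨ *-cong (orOne-zero (element-index 0#))
        (∏.sum-cong-≋ (λ j → orOne-nonzero (unit-nonzero′ j))) ⟩
    1# * P ≈⟨ *-comm 1# P ⟩
    P * 1# ∎)
    where
    open FiniteField F order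
    i₀ = index 0#
    unit : Fin n → Carrier
    unit j = element (punchIn i₀ j)
    unit-nonzero′ : ∀ j → ¬ unit j ≈ 0#
    unit-nonzero′ j eq = Fin.punchInᵢ≢i i₀ j
      (element-injective (trans eq (sym (element-index 0#))))
    P = ∏.sum unit
    ∏-nonzero : ∀ {m} (x : Vector Carrier m) → (∀ j → ¬ x j ≈ 0#) → ¬ ∏.sum x ≈ 0#
    ∏-nonzero {zero}  x _   = 1≉0
    ∏-nonzero {suc m} x x≉0 = *-nonzero (x≉0 zero) (∏-nonzero (x ∘ suc) (x≉0 ∘ suc))
    P≉0 = ∏-nonzero unit unit-nonzero′
    orOne : Carrier → Carrier
    orOne x with x ≟ 0#
    ... | yes _ = 1#
    ... | no  _ = x
    orOne-zero : ∀ {x} → x ≈ 0# → orOne x ≈ 1#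
    orOne-zero {x} x≈0 with x ≟ 0#
    ... | yes _ = refl
    ... | no x≉0 = contradiction x≈0 x≉0
    orOne-nonzero : ∀ {x} → ¬ x ≈ 0# → orOne x ≈ x
    orOne-nonzero {x} x≉0 with x ≟ 0#
    ... | yes x≈0 = contradiction x≈0 x≉0
    ... | no _ = refl
    orOne-cong : ∀ {x y} → x ≈ y → orOne x ≈ orOne y
    orOne-cong {x} {y} x≈y with x ≟ 0#
    ... | yes x≈0 = sym (orOne-zero (trans (sym x≈y) x≈0))
    ... | no x≉0  = trans x≈y (sym (orOne-nonzero (x≉0 ∘ trans x≈y)))

  fermat : ∀ {N} → HasOrder F N → ∀ x → x ^ N ≈ x
  fermat {zero}  order x with () ← Inverse.from order x
  fermat {suc n} order x with FiniteField._≟_ F order x 0#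
  ... | yes x≈0 = trans (*-congʳ x≈0) (trans (zeroˡ _) (sym x≈0))
  ... | no  x≉0 = trans (*-congˡ (unit-power order x≉0)) (*-identityʳ x)

-- Field extensions with coordinates

-- The degree is expressed by a linear bijection onto coordinate vectors instead of a basis, so that
-- passing between F^d and the larger field involves no sums.
record Extension {c ℓ} (F : Field c ℓ) (d : ℕ) : Set (lsuc (c ⊔ ℓ)) where
  field
    field′ : Field c ℓ

  private
    module F = Field F
    module E = Field field′

  field
    ι      : F.Carrier → E.Carrier
    ι-cong : ∀ {a b} → a F.≈ b → ι a E.≈ ι b
    ι-+    : ∀ a b → ι (a F.+ b) E.≈ ι a E.+ ι b
    ι-*    : ∀ a b → ι (a F.* b) E.≈ ι a E.* ι b
    ι-1    : ι F.1# E.≈ E.1#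
    ι-injective : ∀ {a b} → ι a E.≈ ι b → a F.≈ b

    coordinates      : E.Carrier → Vector F.Carrier d
    coordinates-cong : ∀ {x y} → x E.≈ y → ∀ i → coordinates x i F.≈ coordinates y i
    coordinates-+    : ∀ x y i → coordinates (x E.+ y) i F.≈ coordinates x i F.+ coordinates y i
    coordinates-*    : ∀ a x i → coordinates (ι a E.* x) i F.≈ a F.* coordinates x i

    fromCoordinates      : Vector F.Carrier d → E.Carrier
    fromCoordinates-cong : ∀ {u v} → (∀ i → u i F.≈ v i) → fromCoordinates u E.≈ fromCoordinates v
    coordinates-from     : ∀ v i → coordinates (fromCoordinates v) i F.≈ v i
    from-coordinates     : ∀ x → fromCoordinates (coordinates x) E.≈ x

  ι-0 : ι F.0# E.≈ E.0#
  ι-0 = begin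
    z           ≈⟨ solve 1 (λ z → z := z :+ z :- z) refl z ⟩
    z + z - z   ≈⟨ +-congʳ (ι-+ F.0# F.0#) ⟨
    ι (F.0# F.+ F.0#) - z ≈⟨ +-congʳ (ι-cong (F.+-identityˡ F.0#)) ⟩
    z - z       ≈⟨ -‿inverseʳ z ⟩
    0#          ∎
    where
    open E
    open IntegerSolver commutativeRing using (solve; _:=_; _:+_; _:-_)
    open SetoidReasoning setoid
    z = ι F.0#

  extensionOrder : ∀ {N} → HasOrder F N → HasOrder field′ (N ℕ.^ d)
  extensionOrder {N} order = record
    { to        = to
    ; from      = from
    ; to-cong   = λ { ≡.refl → E.refl }
    ; from-cong = from-cong
    ; inverse   = (λ {x} eq → E.trans (E.reflexive (≡.cong to eq)) (to-from x))
                , (λ {i} eq → ≡.trans (from-cong eq) (from-to i))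
    }
    where
    open FiniteField F order
    to : Fin (N ℕ.^ d) → E.Carrier
    to i = fromCoordinates (λ j → element (finToFun i j))
    from : E.Carrier → Fin (N ℕ.^ d)
    from x = funToFin (λ j → index (coordinates x j))
    funToFin-cong : ∀ {m} {f g : Fin m → Fin N} → (∀ j → f j ≡ g j) → funToFin f ≡ funToFin g
    funToFin-cong {zero}  eq = ≡.refl
    funToFin-cong {suc m} eq = ≡.cong₂ combine (eq zero) (funToFin-cong (eq ∘ suc))
    from-cong : ∀ {x y} → x E.≈ y → from x ≡ from y
    from-cong eq = funToFin-cong (λ j → index-cong (coordinates-cong eq j))
    to-from : ∀ x → to (from x) E.≈ x
    to-from x = E.trans (fromCoordinates-cong (λ j → F.trans
      (F.reflexive (≡.cong element (Fin.finToFun-funToFin (λ j → index (coordinates x j)) j)))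
      (element-index _))) (from-coordinates x)
    from-to : ∀ i → from (to i) ≡ i
    from-to i = ≡.trans
      (funToFin-cong (λ j → ≡.trans (index-cong (coordinates-from _ j)) (index-element _)))
      (Fin.funToFin-finToFin {d} i)

  coordinates-0 : ∀ i → coordinates E.0# i F.≈ F.0#
  coordinates-0 i = F.trans
    (coordinates-cong (E.trans (E.sym (E.zeroˡ E.0#)) (E.*-congʳ (E.sym ι-0))) i)
    (F.trans (coordinates-* F.0# E.0# i) (F.zeroˡ _))

  fromCoordinates-0 : fromCoordinates (λ _ → F.0#) E.≈ E.0#
  fromCoordinates-0 = E.trans (fromCoordinates-cong (λ i → F.sym (coordinates-0 i)))
    (from-coordinates E.0#)

  fromCoordinates-+ : ∀ u v →
    fromCoordinates (λ i → u i F.+ v i) E.≈ fromCoordinates u E.+ fromCoordinates v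
  fromCoordinates-+ u v = E.trans
    (fromCoordinates-cong (λ i → F.trans
      (F.+-cong (F.sym (coordinates-from u i)) (F.sym (coordinates-from v i)))
      (F.sym (coordinates-+ _ _ i))))
    (from-coordinates _)

  fromCoordinates-* : ∀ a v → fromCoordinates (λ i → a F.* v i) E.≈ ι a E.* fromCoordinates v
  fromCoordinates-* a v = E.trans
    (fromCoordinates-cong (λ i → F.trans (F.*-congˡ (F.sym (coordinates-from v i)))
      (F.sym (coordinates-* a _ i))))
    (from-coordinates _)

-- Degrees multiply: an index below `n ℕ.* m` is a coordinate over the middle field together with a
-- coordinate of that coordinate.
compose : ∀ {c ℓ} {F : Field c ℓ} {m n} (K : Extension F m) →
  Extension (Extension.field′ K) n → Extension F (n ℕ.* m)
compose {F = F} {m} {n} K L = record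
  { field′ = L.field′
  ; ι = λ a → L.ι (K.ι a)
  ; ι-cong = λ eq → L.ι-cong (K.ι-cong eq)
  ; ι-+ = λ a b → E.trans (L.ι-cong (K.ι-+ a b)) (L.ι-+ _ _)
  ; ι-* = λ a b → E.trans (L.ι-cong (K.ι-* a b)) (L.ι-* _ _)
  ; ι-1 = E.trans (L.ι-cong K.ι-1) L.ι-1
  ; ι-injective = λ eq → K.ι-injective (L.ι-injective eq)
  ; coordinates = λ x i → entry x (remQuot m i)
  ; coordinates-cong = λ eq i → K.coordinates-cong (L.coordinates-cong eq _) _
  ; coordinates-+ = λ x y i →
      F.trans (K.coordinates-cong (L.coordinates-+ x y _) _) (K.coordinates-+ _ _ _)
  ; coordinates-* = λ a x i →
      F.trans (K.coordinates-cong (L.coordinates-* (K.ι a) x _) _) (K.coordinates-* a _ _)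
  ; fromCoordinates = λ v → L.fromCoordinates (λ j → K.fromCoordinates (λ k → v (combine j k)))
  ; fromCoordinates-cong = λ eq →
      L.fromCoordinates-cong (λ j → K.fromCoordinates-cong (λ k → eq (combine j k)))
  ; coordinates-from = λ v i →
      F.trans (K.coordinates-cong (L.coordinates-from _ (proj₁ (remQuot {n} m i))) _)
        (F.trans (K.coordinates-from _ (proj₂ (remQuot {n} m i)))
          (F.reflexive (≡.cong v (Fin.combine-remQuot {n} m i))))
  ; from-coordinates = λ x → E.trans
      (L.fromCoordinates-cong (λ j → K′.trans
        (K.fromCoordinates-cong (λ k → F.reflexive (≡.cong (entry x) (Fin.remQuot-combine j k))))
        (K.from-coordinates _)))
      (L.from-coordinates x)
  }
  where
  module K = Extension K
  module L = Extension L
  module F = Field F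
  module K′ = Field K.field′
  module E = Field L.field′
  entry : E.Carrier → Fin n × Fin m → F.Carrier
  entry x (j , k) = K.coordinates (L.coordinates x j) k

-- Adjoining roots of t² - t - c and t³ - t - c

QuadraticRootless : ∀ {a ℓ} (F : Field a ℓ) → Field.Carrier F → Set (a ⊔ ℓ)
QuadraticRootless F c = ∀ x → ¬ x * x ≈ x + c
  where open Field F

module QuadraticExtension {a ℓ} (F : Field a ℓ)
  (_≈0? : DecidableZero F) (c : Field.Carrier F) (rootless : QuadraticRootless F c) where

  open Field F
  open FieldProperties F
  open IntegerSolver commutativeRing
  private
    R = Quadratic.commutativeRing commutativeRing c
    module R = CommutativeRing R

    -- The conjugate of t is 1 - t, so the inverse is (x₀ + x₁) - x₁t divided by the norm. For
    -- nonzero x₁ a vanishing norm would make -x₀/x₁ a root of t² - t - c.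
    invertible : ∀ x → ¬ x R.≈ R.0# → ∃ λ y → x R.* y R.≈ R.1#
    invertible x x≉0 = y , λ { 0F → eq₀ ; 1F → eq₁ }
      where
      x₀ = x 0F
      x₁ = x 1F
      norm = x₀ * x₀ + x₀ * x₁ - c * (x₁ * x₁)
      norm≉0 : ¬ norm ≈ 0#
      norm≉0 norm≈0 with x₁ ≈0?
      ... | yes x₁≈0 = *-nonzero x₀≉0 x₀≉0 (trans (sym (trans
            (+-cong (+-congˡ (trans (*-congˡ x₁≈0) (zeroʳ _)))
              (-‿cong (trans (*-congˡ (trans (*-congˡ x₁≈0) (zeroʳ _))) (zeroʳ _))))
            (solve 1 (λ x₀ → x₀ :* x₀ :+ :0 :- :0 := x₀ :* x₀) refl x₀))) norm≈0)
        where
        x₀≉0 : ¬ x₀ ≈ 0#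
        x₀≉0 x₀≈0 = x≉0 λ { 0F → x₀≈0 ; 1F → x₁≈0 }
      ... | no x₁≉0 with u , x₁u≈1 ← inverse x₁ x₁≉0 = rootless r (x-y≈0⇒x≈y (begin
        r * r - (r + c)
          ≈⟨ solve 3 (λ x₀ u c → let r = :- (x₀ :* u) in
               r :* r :- (r :+ c) := x₀ :* x₀ :* (u :* u) :+ x₀ :* u :* :1 :- c :* (:1 :* :1))
             refl x₀ u c ⟩
        x₀ * x₀ * (u * u) + x₀ * u * 1# - c * (1# * 1#)
          ≈⟨ +-cong (+-congˡ (*-congˡ x₁u≈1)) (-‿cong (*-congˡ (*-cong x₁u≈1 x₁u≈1))) ⟨
        x₀ * x₀ * (u * u) + x₀ * u * (x₁ * u) - c * (x₁ * u * (x₁ * u))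
          ≈⟨ solve 4 (λ x₀ x₁ u c →
               x₀ :* x₀ :* (u :* u) :+ x₀ :* u :* (x₁ :* u) :- c :* (x₁ :* u :* (x₁ :* u))
               := u :* u :* (x₀ :* x₀ :+ x₀ :* x₁ :- c :* (x₁ :* x₁)))
             refl x₀ x₁ u c ⟩
        u * u * norm ≈⟨ *-congˡ norm≈0 ⟩
        u * u * 0#   ≈⟨ zeroʳ _ ⟩
        0#           ∎))
        where
        open SetoidReasoning setoid
        r = - (x₀ * u)
      v = proj₁ (inverse norm norm≉0)
      y : Vector Carrier 2
      y = (x₀ + x₁) * v ∷ - (x₁ * v) ∷ []
      eq₀ : x₀ * ((x₀ + x₁) * v) + c * (x₁ * - (x₁ * v)) ≈ 1#
      eq₀ = trans (solve 4 (λ x₀ x₁ v c → x₀ :* ((x₀ :+ x₁) :* v) :+ c :* (x₁ :* :- (x₁ :* v))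
          := (x₀ :* x₀ :+ x₀ :* x₁ :- c :* (x₁ :* x₁)) :* v) refl x₀ x₁ v c)
        (proj₂ (inverse norm norm≉0))
      eq₁ : x₀ * - (x₁ * v) + x₁ * ((x₀ + x₁) * v) + x₁ * - (x₁ * v) ≈ 0#
      eq₁ = solve 3 (λ x₀ x₁ v →
          x₀ :* :- (x₁ :* v) :+ x₁ :* ((x₀ :+ x₁) :* v) :+ x₁ :* :- (x₁ :* v) := :0) refl x₀ x₁ v

  extension : Extension F 2
  extension = record
    { field′ = record
      { commutativeRing = R
      ; 0≉1 = λ eq → 0≉1 (eq 0F)
      ; inverse = invertible }
    ; ι = λ a → a ∷ 0# ∷ []
    ; ι-cong = λ eq → λ { 0F → eq ; 1F → refl }
    ; ι-+ = λ a b → λ { 0F → refl ; 1F → sym (+-identityˡ _) }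
    ; ι-* = λ a b → λ
        { 0F → solve 3 (λ c a b → a :* b := a :* b :+ c :* (:0 :* :0)) refl c a b
        ; 1F → solve 2 (λ a b → :0 := a :* :0 :+ :0 :* b :+ :0 :* :0) refl a b }
    ; ι-1 = λ { 0F → refl ; 1F → refl }
    ; ι-injective = λ eq → eq 0F
    ; coordinates = λ x → x
    ; coordinates-cong = λ eq → eq
    ; coordinates-+ = λ x y i → refl
    ; coordinates-* = λ a x → λ
        { 0F → solve 4 (λ c a x₀ x₁ → a :* x₀ :+ c :* (:0 :* x₁) := a :* x₀) refl c a (x 0F) (x 1F)
        ; 1F → solve 3 (λ a x₀ x₁ → a :* x₁ :+ :0 :* x₀ :+ :0 :* x₁ := a :* x₁) refl a (x 0F) (x 1F) }
    ; fromCoordinates = λ v → v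
    ; fromCoordinates-cong = λ eq → eq
    ; coordinates-from = λ v i → refl
    ; from-coordinates = λ x i → refl
    }

  open Extension extension using (field′; ι)
  private module K = Field field′

  generator : K.Carrier
  generator = 0# ∷ 1# ∷ []

  generator² : generator K.* generator K.≈ generator K.+ ι c
  generator² 0F = solve 1 (λ c → :0 :* :0 :+ c :* (:1 :* :1) := :0 :+ c) refl c
  generator² 1F = solve 0 (:0 :* :1 :+ :1 :* :0 :+ :1 :* :1 := :1 :+ :0) refl

CubicRootless : ∀ {a ℓ} (F : Field a ℓ) → Field.Carrier F → Set (a ⊔ ℓ)
CubicRootless F c = ∀ x → ¬ x * x * x ≈ x + c
  where open Field F

module CubicExtension {a ℓ} (F : Field a ℓ)
  (_≈0? : DecidableZero F) (c : Field.Carrier F) (rootless : CubicRootless F c) where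

  open Field F hiding (zero)
  open FieldProperties F
  open IntegerSolver commutativeRing
  open SetoidReasoning setoid
  private
    R = Cubic.commutativeRing commutativeRing c
    module R = CommutativeRing R

    Invertible : R.Carrier → Set _
    Invertible x = ∃ λ y → x R.* y R.≈ R.1#

    -- It suffices to invert a multiple: the cases below multiply by a factor that lowers the
    -- degree, until a nonzero constant is reached.
    invertible-factor : ∀ x y → Invertible (x R.* y) → Invertible x
    invertible-factor x y (z , xyz≈1) = y R.* z , R.trans (R.sym (R.*-assoc x y z)) xyz≈1

    constant-invertible : ∀ x → x 2F ≈ 0# → x 1F ≈ 0# → ¬ x 0F ≈ 0# → Invertible x
    constant-invertible x x₂≈0 x₁≈0 x₀≉0 with u , x₀u≈1 ← inverse (x 0F) x₀≉0 = u ∷ 0# ∷ 0# ∷ [] , λ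
      { 0F → trans (solve 5 (λ c x₀ x₁ x₂ u → x₀ :* u :+ c :* (x₁ :* :0 :+ x₂ :* :0) := x₀ :* u)
          refl c (x 0F) (x 1F) (x 2F) u) x₀u≈1
      ; 1F → trans (solve 5 (λ c x₀ x₁ x₂ u →
          x₀ :* :0 :+ x₁ :* u :+ (x₁ :* :0 :+ x₂ :* :0) :+ c :* (x₂ :* :0) := x₁ :* u)
          refl c (x 0F) (x 1F) (x 2F) u) (trans (*-congʳ x₁≈0) (zeroˡ u))
      ; 2F → trans (solve 4 (λ x₀ x₁ x₂ u → x₀ :* :0 :+ x₁ :* :0 :+ x₂ :* u :+ x₂ :* :0 := x₂ :* u)
          refl (x 0F) (x 1F) (x 2F) u) (trans (*-congʳ x₂≈0) (zeroˡ u)) }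

    -- Modulo t³ − t − c, the product (t − r)(t² + rt + r² − 1) is r + c − r³.
    linear-invertible : ∀ x → x 2F ≈ 0# → ¬ x 1F ≈ 0# → Invertible x
    linear-invertible x x₂≈0 x₁≉0 with u , x₁u≈1 ← inverse (x 1F) x₁≉0 =
      invertible-factor x y (constant-invertible (x R.* y) xy₂ xy₁ xy₀)
      where
      x₀ = x 0F
      x₁ = x 1F
      x₂ = x 2F
      r = - (x₀ * u)
      y : Vector Carrier 3
      y = u * (r * r - 1#) ∷ u * r ∷ u ∷ []
      xy₀ : ¬ (x R.* y) 0F ≈ 0#
      xy₀ eq = rootless r (x-y≈0⇒x≈y (begin
        r * r * r - (r + c)
          ≈⟨ solve 3 (λ c x₀ u → let r = :- (x₀ :* u) in
               r :* r :* r :- (r :+ c)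
               := :- (x₀ :* (u :* (r :* r :- :1)) :+ c :* (:1 :+ :0 :* (u :* r)))) refl c x₀ u ⟩
        - (x₀ * (u * (r * r - 1#)) + c * (1# + 0# * (u * r)))
          ≈⟨ -‿cong (+-congˡ (*-congˡ (+-cong x₁u≈1 (*-congʳ x₂≈0)))) ⟨
        - (x R.* y) 0F ≈⟨ -‿cong eq ⟩
        - 0#           ≈⟨ solve 0 (:- :0 := :0) refl ⟩
        0#             ∎))
      xy₁ : (x R.* y) 1F ≈ 0#
      xy₁ = begin
        (x R.* y) 1F
          ≈⟨ solve 5 (λ c x₀ x₁ x₂ u → let r = :- (x₀ :* u) in
               x₀ :* (u :* r) :+ x₁ :* (u :* (r :* r :- :1)) :+ (x₁ :* u :+ x₂ :* (u :* r)) :+ c :*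
                 (x₂ :* u)
               := x₁ :* u :* (r :* r) :- r :* r :+ x₂ :* (u :* r :+ c :* u)) refl c x₀ x₁ x₂ u ⟩
        x₁ * u * (r * r) - r * r + x₂ * (u * r + c * u)
          ≈⟨ +-cong (+-congʳ (*-congʳ x₁u≈1)) (*-congʳ x₂≈0) ⟩
        1# * (r * r) - r * r + 0# * (u * r + c * u)
          ≈⟨ solve 2 (λ r s → :1 :* (r :* r) :- r :* r :+ :0 :* s := :0) refl r (u * r + c * u) ⟩
        0# ∎
      xy₂ : (x R.* y) 2F ≈ 0#
      xy₂ = begin
        (x R.* y) 2F
          ≈⟨ solve 4 (λ x₀ x₁ x₂ u → let r = :- (x₀ :* u) in
               x₀ :* u :+ x₁ :* (u :* r) :+ x₂ :* (u :* (r :* r :- :1)) :+ x₂ :* u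
               := x₁ :* u :* r :- r :+ x₂ :* (u :* (r :* r :- :1) :+ u)) refl x₀ x₁ x₂ u ⟩
        x₁ * u * r - r + x₂ * (u * (r * r - 1#) + u) ≈⟨ +-cong (+-congʳ (*-congʳ x₁u≈1)) (*-congʳ x₂≈0) ⟩
        1# * r - r + 0# * (u * (r * r - 1#) + u)
          ≈⟨ solve 2 (λ r s → :1 :* r :- r :+ :0 :* s := :0) refl r (u * (r * r - 1#) + u) ⟩
        0# ∎

    -- Modulo t³ − t − c, the product (t² + bt + d)(t − b) is (1 + d − b²)t + (c − bd);
    -- both coefficients vanish only if b is a root of t³ − t − c.
    quadratic-invertible : ∀ x → ¬ x 2F ≈ 0# → Invertible x
    quadratic-invertible x x₂≉0 with u , x₂u≈1 ← inverse (x 2F) x₂≉0 =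
      invertible-factor x y xy-invertible
      where
      x₀ = x 0F
      x₁ = x 1F
      x₂ = x 2F
      b = u * x₁
      d = u * x₀
      y : Vector Carrier 3
      y = - (u * b) ∷ u ∷ 0# ∷ []
      xy₀ : (x R.* y) 0F ≈ c - b * d
      xy₀ = begin
        (x R.* y) 0F
          ≈⟨ solve 5 (λ c x₀ x₁ x₂ u → x₀ :* :- (u :* (u :* x₁)) :+ c :* (x₁ :* :0 :+ x₂ :* u)
               := c :* (x₂ :* u) :- u :* x₁ :* (u :* x₀)) refl c x₀ x₁ x₂ u ⟩
        c * (x₂ * u) - b * d ≈⟨ +-congʳ (*-congˡ x₂u≈1) ⟩
        c * 1# - b * d       ≈⟨ +-congʳ (*-identityʳ c) ⟩
        c - b * d            ∎
      xy₁ : (x R.* y) 1F ≈ 1# + d - b * b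
      xy₁ = begin
        (x R.* y) 1F
          ≈⟨ solve 5 (λ c x₀ x₁ x₂ u →
               x₀ :* u :+ x₁ :* :- (u :* (u :* x₁)) :+ (x₁ :* :0 :+ x₂ :* u) :+ c :* (x₂ :* :0)
               := x₂ :* u :+ u :* x₀ :- u :* x₁ :* (u :* x₁)) refl c x₀ x₁ x₂ u ⟩
        x₂ * u + d - b * b ≈⟨ +-congʳ (+-congʳ x₂u≈1) ⟩
        1# + d - b * b     ∎
      xy₂ : (x R.* y) 2F ≈ 0#
      xy₂ = begin
        (x R.* y) 2F
          ≈⟨ solve 4 (λ x₀ x₁ x₂ u →
               x₀ :* :0 :+ x₁ :* u :+ x₂ :* :- (u :* (u :* x₁)) :+ x₂ :* :0
               := (:1 :- x₂ :* u) :* (u :* x₁)) refl x₀ x₁ x₂ u ⟩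
        (1# - x₂ * u) * b ≈⟨ *-congʳ (trans (+-congˡ (-‿cong x₂u≈1)) (-‿inverseʳ 1#)) ⟩
        0# * b            ≈⟨ zeroˡ b ⟩
        0#                ∎
      xy-invertible : Invertible (x R.* y)
      xy-invertible with (x R.* y) 1F ≈0?
      ... | no  xy₁≉0 = linear-invertible (x R.* y) xy₂ xy₁≉0
      ... | yes xy₁≈0 = constant-invertible (x R.* y) xy₂ xy₁≈0 λ xy₀≈0 →
        -- From 1 + d = b² and c = bd follows b³ = b + bd = b + c.
        rootless b (begin
          b * b * b
            ≈⟨ solve 3 (λ c b d → b :* b :* b
                 := b :* (:1 :+ d) :- b :* (:1 :+ d :- b :* b)) refl c b d ⟩
          b * (1# + d) - b * (1# + d - b * b)
            ≈⟨ +-congˡ (-‿cong (*-congˡ (trans (sym xy₁) xy₁≈0))) ⟩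
          b * (1# + d) - b * 0#
            ≈⟨ solve 3 (λ c b d → b :* (:1 :+ d) :- b :* :0 := b :+ c :- (c :- b :* d)) refl c b d ⟩
          b + c - (c - b * d) ≈⟨ +-congˡ (-‿cong (trans (sym xy₀) xy₀≈0)) ⟩
          b + c - 0#          ≈⟨ solve 1 (λ x → x :- :0 := x) refl (b + c) ⟩
          b + c               ∎)

    invertible : ∀ x → ¬ x R.≈ R.0# → Invertible x
    invertible x x≉0 with x 2F ≈0? | x 1F ≈0?
    ... | no x₂≉0  | _         = quadratic-invertible x x₂≉0
    ... | yes x₂≈0 | no x₁≉0  = linear-invertible x x₂≈0 x₁≉0
    ... | yes x₂≈0 | yes x₁≈0 = constant-invertible x x₂≈0 x₁≈0 λ x₀≈0 →
      x≉0 λ { 0F → x₀≈0 ; 1F → x₁≈0 ; 2F → x₂≈0 }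

  extension : Extension F 3
  extension = record
    { field′ = record
      { commutativeRing = R
      ; 0≉1 = λ eq → 0≉1 (eq 0F)
      ; inverse = invertible }
    ; ι = λ a → a ∷ 0# ∷ 0# ∷ []
    ; ι-cong = λ eq → λ { 0F → eq ; 1F → refl ; 2F → refl }
    ; ι-+ = λ a b → λ { 0F → refl ; 1F → sym (+-identityˡ _) ; 2F → sym (+-identityˡ _) }
    ; ι-* = λ a b → λ
        { 0F → solve 3 (λ c a b → a :* b := a :* b :+ c :* (:0 :* :0 :+ :0 :* :0)) refl c a b
        ; 1F → solve 3 (λ c a b →
            :0 := a :* :0 :+ :0 :* b :+ (:0 :* :0 :+ :0 :* :0) :+ c :* (:0 :* :0)) refl c a b
        ; 2F → solve 2 (λ a b → :0 := a :* :0 :+ :0 :* :0 :+ :0 :* b :+ :0 :* :0) refl a b }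
    ; ι-1 = λ { 0F → refl ; 1F → refl ; 2F → refl }
    ; ι-injective = λ eq → eq 0F
    ; coordinates = λ x → x
    ; coordinates-cong = λ eq → eq
    ; coordinates-+ = λ x y i → refl
    ; coordinates-* = λ a x → λ
        { 0F → solve 5 (λ c a x₀ x₁ x₂ →
            a :* x₀ :+ c :* (:0 :* x₂ :+ :0 :* x₁) := a :* x₀) refl c a (x 0F) (x 1F) (x 2F)
        ; 1F → solve 5 (λ c a x₀ x₁ x₂ →
            a :* x₁ :+ :0 :* x₀ :+ (:0 :* x₂ :+ :0 :* x₁) :+ c :* (:0 :* x₂) := a :* x₁)
            refl c a (x 0F) (x 1F) (x 2F)
        ; 2F → solve 4 (λ a x₀ x₁ x₂ →
            a :* x₂ :+ :0 :* x₁ :+ :0 :* x₀ :+ :0 :* x₂ := a :* x₂)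
            refl a (x 0F) (x 1F) (x 2F) }
    ; fromCoordinates = λ v → v
    ; fromCoordinates-cong = λ eq → eq
    ; coordinates-from = λ v i → refl
    ; from-coordinates = λ x i → refl
    }

  open Extension extension using (field′; ι)
  private module E = Field field′

  generator : E.Carrier
  generator = 0# ∷ 1# ∷ 0# ∷ []

  generator³ : generator E.* generator E.* generator E.≈ generator E.+ ι c
  generator³ = E.trans (E.*-congʳ t²) λ
    { 0F → solve 1 (λ c → :0 :* :0 :+ c :* (:0 :* :0 :+ :1 :* :1) := :0 :+ c) refl c
    ; 1F → solve 1 (λ c → :0 :* :1 :+ :0 :* :0 :+ (:0 :* :0 :+ :1 :* :1) :+ c :* (:1 :* :0)
                          := :1 :+ :0) refl c
    ; 2F → solve 0 (:0 :* :0 :+ :0 :* :1 :+ :1 :* :0 :+ :1 :* :0 := :0 :+ :0) refl }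
    where
    t² : generator E.* generator E.≈ (0# ∷ 0# ∷ 1# ∷ [])
    t² 0F = solve 1 (λ c → :0 :* :0 :+ c :* (:1 :* :0 :+ :0 :* :1) := :0) refl c
    t² 1F = solve 1 (λ c → :0 :* :1 :+ :1 :* :0 :+ (:1 :* :0 :+ :0 :* :1) :+ c :* (:0 :* :0)
                          := :0) refl c
    t² 2F = solve 0 (:0 :* :0 :+ :1 :* :1 :+ :0 :* :0 :+ :0 :* :0 := :1) refl

-- Counting values and elements

module _ {c ℓ} (F : Field c ℓ) {N} (order : HasOrder F N) where
  open Field F hiding (zero)
  open FiniteField F order

  element-index-injective : ∀ {x y} → index x ≡ index y → x ≈ y
  element-index-injective eq =
    trans (sym (element-index _)) (trans (reflexive (≡.cong element eq)) (element-index _))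

  -- A section of f would be an injection of the finite set F into itself
  -- missing u or v.
  nonInjective⇒missesValue : ∀ (f : Carrier → Carrier) → (∀ {x y} → x ≈ y → f x ≈ f y) →
    ∀ {u v} → ¬ u ≈ v → f u ≈ f v → ∃ λ b → ∀ x → ¬ f x ≈ b
  nonInjective⇒missesValue f f-cong {u} {v} u≉v fu≈fv
    with Fin.all? (λ j → Fin.any? (λ i → f (element i) ≟ element j))
  ... | no ¬surjective
    with j , ¬hit ← Fin.¬∀⟶∃¬ N _ (λ j → Fin.any? (λ i → f (element i) ≟ element j)) ¬surjective =
    element j , λ x fx≈j → ¬hit (index x , trans (f-cong (element-index x)) fx≈j)
  ... | yes surjective = ⊥-elim (missed u λ j sj≡u → missed v λ k sk≡v →
      u≉v (element-index-injective (≡.trans (≡.sym sj≡u) (≡.trans (≡.cong section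
        (≡.trans (section-value sj≡u) (≡.trans (index-cong fu≈fv) (≡.sym (section-value sk≡v)))))
        sk≡v))))
    where
    section : Fin N → Fin N
    section = proj₁ ∘ surjective
    section-value : ∀ {j w} → section j ≡ index w → j ≡ index (f w)
    section-value {j} {w} eq = ≡.trans (≡.sym (index-element j)) (index-cong
      (trans (sym (proj₂ (surjective j)))
        (f-cong (trans (reflexive (≡.cong element eq)) (element-index w)))))
    section-injective : ∀ {j k} → section j ≡ section k → j ≡ k
    section-injective {j} {k} eq = element-injective (trans (sym (proj₂ (surjective j)))
      (trans (f-cong (reflexive (≡.cong element eq))) (proj₂ (surjective k))))
    missed : ∀ w → ¬ (∀ j → section j ≢ index w)
    missed w avoids with i , j , i<j , eq ← Fin.pigeonhole (ℕ.n<1+n N) (index w ∷ section) =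
      distinct i j (Fin.<⇒≢ i<j) eq
      where
      distinct : ∀ i j → i ≢ j → ¬ (index w ∷ section) i ≡ (index w ∷ section) j
      distinct zero    zero    i≢j _  = i≢j ≡.refl
      distinct zero    (suc j) _   eq = avoids j (≡.sym eq)
      distinct (suc i) zero    _   eq = avoids i eq
      distinct (suc i) (suc j) i≢j eq = i≢j (≡.cong suc (section-injective eq))

1<order : ∀ {c ℓ} (F : Field c ℓ) {N} → HasOrder F N → 1 ℕ.< N
1<order F {N} order = Fin.injective⇒≤ {f = f} λ {i} {j} → f-injective i j
  where
  open Field F using (0#; 1#; 0≉1; sym)
  open FiniteField F order using (index)
  f : Fin 2 → Fin N
  f = index 0# ∷ index 1# ∷ []
  f-injective : ∀ i j → f i ≡ f j → i ≡ j
  f-injective 0F 0F eq = ≡.refl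
  f-injective 0F 1F eq = ⊥-elim (0≉1 (element-index-injective F order eq))
  f-injective 1F 0F eq = ⊥-elim (0≉1 (sym (element-index-injective F order eq)))
  f-injective 1F 1F eq = ≡.refl

-- The Frobenius map of an extension

module Frobenius {c ℓ} {F : Field c ℓ} {q} (order : HasOrder F q) {d} (L : Extension F d) where

  open Extension L
  private module F = Field F
  open Field field′ hiding (zero)
  open FieldProperties field′
  open FiniteField F order using (element; element-injective)
  open Exp commutativeSemiring
  open PolynomialFunctions field′
  open IntegerSolver commutativeRing using (solve; _:=_; _:+_; _:*_; _:-_; :-_; :0; :1)
  open SetoidReasoning setoid

  φ : Carrier → Carrier
  φ x = x ^ q

  φ-cong : ∀ {x y} → x ≈ y → φ x ≈ φ y
  φ-cong = ^-congˡ q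

  φ-* : ∀ x y → φ (x * y) ≈ φ x * φ y
  φ-* x y = ^-distrib-* x y q

  φ-ι : ∀ a → φ (ι a) ≈ ι a
  φ-ι a = trans (sym (ι-^ q)) (ι-cong (fermat F order a))
    where
    open Exp F.commutativeSemiring renaming (_^_ to _^F_)
    ι-^ : ∀ n → ι (a ^F n) ≈ ι a ^ n
    ι-^ zero    = ι-1
    ι-^ (suc n) = trans (ι-* a (a ^F n)) (*-congˡ (ι-^ n))

  φ-1 : φ 1# ≈ 1#
  φ-1 = trans (φ-cong (sym ι-1)) (trans (φ-ι F.1#) ι-1)

  φ-0 : φ 0# ≈ 0#
  φ-0 = trans (φ-cong (sym ι-0)) (trans (φ-ι F.0#) ι-0)

  private
    -- The root count in `φ-+1` depends only on the degree of this difference, so its coefficients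
    -- stay implicit.
    binomial : ∀ n → ∃₂ λ a f → PolynomialOfDegree n a f ×
      ∀ x → (x + 1#) ^ suc n ≈ x ^ suc n + f x
    binomial zero = 1# , (λ _ → 1#) , (λ _ → refl) ,
      λ x → solve 1 (λ x → (x :+ :1) :* :1 := x :* :1 :+ :1) refl x
    binomial (suc n) with a , f , p , eq ← binomial n =
      _ , (λ x → x ^ suc n + x * f x + f x) ,
      add (suc n) (add (suc n) (power (suc n)) (shift n p)) (raise n p) ,
      λ x → trans (*-congˡ (eq x))
        (solve 3 (λ x y f → (x :+ :1) :* (y :+ f) := x :* y :+ (y :+ x :* f :+ f))
          refl x (x ^ suc n) (f x))

  -- (x + 1)^q − x^q − 1 has degree less than q and vanishes on the q elements of F.
  φ-+1 : ∀ x → φ (x + 1#) ≈ φ x + 1#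
  φ-+1 = lemma q ≡.refl
    where
    -- The detour through `n ≡ q` exposes q as a successor, as `binomial` requires.
    lemma : ∀ n → n ≡ q → ∀ x → (x + 1#) ^ n ≈ x ^ n + 1#
    lemma zero    0≡q = ⊥-elim (ℕ.n≮0 (≡.subst (1 ℕ.<_) (≡.sym 0≡q) (1<order F order)))
    lemma (suc n) ≡.refl x with a , f , p , eq ← binomial n = begin
      (x + 1#) ^ suc n ≈⟨ eq x ⟩
      x ^ suc n + f x
        ≈⟨ +-congˡ (x-y≈0⇒x≈y (proj₂ (manyRoots⇒zero n (add n p (proj₂ (constant n (- 1#))))
             (ι ∘ element) (element-injective ∘ ι-injective) root) x)) ⟩
      x ^ suc n + 1# ∎
      where
      root : ∀ i → f (ι (element i)) - 1# ≈ 0#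
      root i = begin
        f y - 1# ≈⟨ solve 2 (λ y f → f :- :1 := y :+ f :- (y :+ :1)) refl (φ y) (f y) ⟩
        φ y + f y - (φ y + 1#) ≈⟨ +-cong (sym (eq y)) (-‿cong (+-congʳ (φ-ι _))) ⟩
        φ (y + 1#) - (y + 1#)
          ≈⟨ +-congʳ (trans (φ-cong y+1≈) (trans (φ-ι _) (sym y+1≈))) ⟩
        y + 1# - (y + 1#) ≈⟨ -‿inverseʳ _ ⟩
        0# ∎
        where
        y = ι (element i)
        y+1≈ : y + 1# ≈ ι (element i F.+ F.1#)
        y+1≈ = trans (+-congˡ (sym ι-1)) (sym (ι-+ _ _))

  private
    _≟_ = FiniteField._≟_ field′ (extensionOrder order)

  -- The case y = 1 implies the general one by homogeneity: x + y = y (x/y + 1).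
  φ-+ : ∀ x y → φ (x + y) ≈ φ x + φ y
  φ-+ x y with y ≟ 0#
  ... | yes y≈0 = begin
    φ (x + y)  ≈⟨ φ-cong (trans (+-congˡ y≈0) (+-identityʳ x)) ⟩
    φ x        ≈⟨ +-identityʳ _ ⟨
    φ x + 0#   ≈⟨ +-congˡ (trans (φ-cong y≈0) φ-0) ⟨
    φ x + φ y  ∎
  ... | no y≉0 with z , yz≈1 ← inverse y y≉0 = begin
    φ (x + y)                ≈⟨ φ-cong (scale z yz≈1) ⟩
    φ (y * (x * z + 1#))     ≈⟨ φ-* _ _ ⟩
    φ y * φ (x * z + 1#)     ≈⟨ *-congˡ (trans (φ-+1 _) (+-congʳ (φ-* x z))) ⟩
    φ y * (φ x * φ z + 1#)   ≈⟨ scale′ (φ z) (trans (sym (φ-* y z)) (trans (φ-cong yz≈1) φ-1)) ⟨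
    φ x + φ y                ∎
    where
    factorOut : ∀ x y z → y * z ≈ 1# → x + y ≈ y * (x * z + 1#)
    factorOut x y z yz≈1 = begin
      x + y            ≈⟨ +-congʳ (*-identityʳ x) ⟨
      x * 1# + y       ≈⟨ +-congʳ (*-congˡ yz≈1) ⟨
      x * (y * z) + y  ≈⟨ solve 3 (λ x y z → x :* (y :* z) :+ y := y :* (x :* z :+ :1)) refl x y z ⟩
      y * (x * z + 1#) ∎
    scale = factorOut x y
    scale′ = factorOut (φ x) (φ y)

  φ-neg : ∀ x → φ (- x) ≈ - φ x
  φ-neg x = begin
    φ (- x)              ≈⟨ solve 2 (λ a b → a := a :+ b :- b) refl (φ (- x)) (φ x) ⟩
    φ (- x) + φ x - φ x  ≈⟨ +-congʳ (φ-+ (- x) x) ⟨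
    φ (- x + x) - φ x    ≈⟨ +-congʳ (trans (φ-cong (-‿inverseˡ x)) φ-0) ⟩
    0# - φ x             ≈⟨ +-identityˡ _ ⟩
    - φ x                ∎

  -- The elements of F are already q roots of x^q - x. One more fixed element would be root number q
  -- + 1 and force the leading coefficient 1 to vanish.
  φ-fixed : ∀ y → φ y ≈ y → ∃ λ a → ι a ≈ y
  φ-fixed y φy≈y with Fin.any? (λ i → ι (element i) ≟ y)
  ... | yes (i , eq) = element i , eq
  ... | no  notInF = ⊥-elim (1≉0 (proj₁ (manyRoots⇒zero q
      (addLower (1<order F order) (power q) linear) (y ∷ ι ∘ element)
      (λ {i} {j} → distinct i j)
      λ { zero → root φy≈y ; (suc i) → root (φ-ι _) })))
    where
    linear : PolynomialOfDegree 1 (- 1#) (λ x → - x)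
    linear = 0# , (λ _ → - 1#) , (λ _ → refl) ,
      λ x → solve 1 (λ x → :- x := :0 :+ x :* :- :1) refl x
    root : ∀ {x} → φ x ≈ x → φ x - x ≈ 0#
    root eq = trans (+-congʳ eq) (-‿inverseʳ _)
    distinct : ∀ i j → (y ∷ ι ∘ element) i ≈ (y ∷ ι ∘ element) j → i ≡ j
    distinct zero    zero    _  = ≡.refl
    distinct zero    (suc j) eq = ⊥-elim (notInF (j , sym eq))
    distinct (suc i) zero    eq = ⊥-elim (notInF (i , eq))
    distinct (suc i) (suc j) eq = ≡.cong suc (element-injective (ι-injective eq))

  φ^ : ℕ → Carrier → Carrier
  φ^ zero    x = x
  φ^ (suc n) x = φ (φ^ n x)

  φ^-cong : ∀ n {x y} → x ≈ y → φ^ n x ≈ φ^ n y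
  φ^-cong zero    eq = eq
  φ^-cong (suc n) eq = φ-cong (φ^-cong n eq)

  φ^-* : ∀ n x y → φ^ n (x * y) ≈ φ^ n x * φ^ n y
  φ^-* zero    x y = refl
  φ^-* (suc n) x y = trans (φ-cong (φ^-* n x y)) (φ-* _ _)

  φ^-+ : ∀ n x y → φ^ n (x + y) ≈ φ^ n x + φ^ n y
  φ^-+ zero    x y = refl
  φ^-+ (suc n) x y = trans (φ-cong (φ^-+ n x y)) (φ-+ _ _)

  φ^-neg : ∀ n x → φ^ n (- x) ≈ - φ^ n x
  φ^-neg zero    x = refl
  φ^-neg (suc n) x = trans (φ-cong (φ^-neg n x)) (φ-neg _)

  φ^-zero : ∀ n {x} → x ≈ 0# → φ^ n x ≈ 0#
  φ^-zero zero    x≈0 = x≈0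
  φ^-zero (suc n) x≈0 = trans (φ-cong (φ^-zero n x≈0)) φ-0

  φ^-ι : ∀ n a → φ^ n (ι a) ≈ ι a
  φ^-ι zero    a = refl
  φ^-ι (suc n) a = trans (φ-cong (φ^-ι n a)) (φ-ι a)

  φ^-power : ∀ n x → φ^ n x ≈ x ^ (q ℕ.^ n)
  φ^-power zero    x = sym (*-identityʳ x)
  φ^-power (suc n) x = trans (φ-cong (φ^-power n x))
    (trans (^-assocʳ x (q ℕ.^ n) q) (^-congʳ x (ℕ.*-comm (q ℕ.^ n) q)))

  φ-nonzero : ∀ {x} → ¬ x ≈ 0# → ¬ φ x ≈ 0#
  φ-nonzero {x} x≉0 φx≈0 with y , xy≈1 ← inverse x x≉0 =
    0≉1 (trans (sym (zeroˡ (φ y))) (trans (*-congʳ (sym φx≈0))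
      (trans (sym (φ-* x y)) (trans (φ-cong xy≈1) φ-1))))

  φ^-nonzero : ∀ n {x} → ¬ x ≈ 0# → ¬ φ^ n x ≈ 0#
  φ^-nonzero zero    x≉0 = x≉0
  φ^-nonzero (suc n) x≉0 = φ-nonzero (φ^-nonzero n x≉0)

  φ^-*₃ : ∀ n x y z → φ^ n (x * y * z) ≈ φ^ n x * φ^ n y * φ^ n z
  φ^-*₃ n x y z = trans (φ^-* n _ _) (*-congʳ (φ^-* n x y))

  φ^-linear : ∀ n {a b x y z} → x ≈ ι a * y + ι b * z → φ^ n x ≈ ι a * φ^ n y + ι b * φ^ n z
  φ^-linear n eq = trans (φ^-cong n eq) (trans (φ^-+ n _ _)
    (+-cong (trans (φ^-* n _ _) (*-congʳ (φ^-ι n _))) (trans (φ^-* n _ _) (*-congʳ (φ^-ι n _)))))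

-- Linear dependence

module LinearAlgebra {c ℓ} (F : Field c ℓ) (_≈0? : DecidableZero F) where

  open Field F hiding (zero)
  open SemiringSum semiring using
    (sum; sum-cong-≋; sum-remove; ∑-distrib-+; *-distribʳ-sum; sum-replicate-zero)
  open IntegerSolver commutativeRing using (solve; _:=_; _:+_; _:*_; _:-_; :-_)
  open SetoidReasoning setoid

  sum-zero : ∀ n (x : Vector Carrier n) → (∀ i → x i ≈ 0#) → sum x ≈ 0#
  sum-zero n x x≈0 = trans (sum-cong-≋ {n} x≈0) (sum-replicate-zero n)

  -- Gaussian elimination: a pivot row clears the first column of the other rows, and a relation
  -- among the cleared rows extends to the pivot row. Without a pivot the first column vanishes, and
  -- row zero can be left out with it.
  dependent : ∀ n (M : Fin (suc n) → Vector Carrier n) →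
    ∃ λ (a : Vector Carrier (suc n)) →
      (∃ λ i → ¬ a i ≈ 0#) × ∀ j → sum (λ i → a i * M i j) ≈ 0#
  dependent zero    M = (λ _ → 1#) , (zero , λ 1≈0 → 0≉1 (sym 1≈0)) , λ ()
  dependent (suc n) M with Fin.any? (λ i → ¬? (M i zero ≈0?))
  ... | no allZero with a , (i , aᵢ≉0) , relation ← dependent n (λ i j → M (suc i) (suc j)) =
    0# ∷ a , (suc i , aᵢ≉0) , λ
      { zero    → sum-zero (suc (suc n)) (λ i → (0# ∷ a) i * M i zero)
                    λ i → trans (*-congˡ {(0# ∷ a) i} (column i)) (zeroʳ _)
      ; (suc j) → trans (+-cong (zeroˡ _) (relation j)) (+-identityʳ 0#) }
    where
    column : ∀ i → M i zero ≈ 0#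
    column i = decidable-stable (M i zero ≈0?) (λ ≉0 → allZero (i , ≉0))
  ... | yes (p , Mp≉0) with u , Mpu≈1 ← inverse _ Mp≉0
    with a , (i , aᵢ≉0) , relation ← dependent n
      (λ i j → M (punchIn p i) (suc j) - M (punchIn p i) zero * u * M p (suc j)) =
    insertAt a p aₚ , (punchIn p i , aᵢ≉0 ∘ trans (reflexive (≡.sym
      (Vector.insertAt-punchIn a p aₚ i)))) ,
    λ { zero    → trans (expand zero) (begin
          aₚ * M p zero + sum (λ i → a i * M (punchIn p i) zero)
            ≈⟨ solve 4 (λ s u m t → :- (s :* u) :* m :+ t := t :- s :* (m :* u)) refl s u _ _ ⟩
          sum (λ i → a i * M (punchIn p i) zero) - s * (M p zero * u)
            ≈⟨ +-congˡ (-‿cong (trans (*-congˡ Mpu≈1) (*-identityʳ s))) ⟩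
          s - s ≈⟨ -‿inverseʳ s ⟩
          0# ∎)
      ; (suc j) → trans (expand (suc j)) (begin
          aₚ * M p (suc j) + sum (λ i → a i * M (punchIn p i) (suc j))
            ≈⟨ solve 4 (λ s u m t → :- (s :* u) :* m :+ t := t :+ s :* (:- (u :* m))) refl s u _ _ ⟩
          sum (λ i → a i * M (punchIn p i) (suc j)) + s * (- (u * M p (suc j)))
            ≈⟨ +-congˡ (*-distribʳ-sum (- (u * M p (suc j))) (λ i → a i * M (punchIn p i) zero)) ⟩
          sum (λ i → a i * M (punchIn p i) (suc j))
            + sum (λ i → a i * M (punchIn p i) zero * - (u * M p (suc j)))
            ≈⟨ ∑-distrib-+ (λ i → a i * M (punchIn p i) (suc j))
                 (λ i → a i * M (punchIn p i) zero * - (u * M p (suc j))) ⟨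
          sum (λ i → a i * M (punchIn p i) (suc j) + a i * M (punchIn p i) zero * - (u * M p (suc j)))
            ≈⟨ sum-cong-≋ {suc n} (λ i → solve 5 (λ a x y u m →
                 a :* x :+ a :* y :* :- (u :* m) := a :* (x :- y :* u :* m)) 
                 refl (a i) (M (punchIn p i) (suc j)) (M (punchIn p i) zero) u (M p (suc j))) ⟩
          sum (λ i → a i * (M (punchIn p i) (suc j) - M (punchIn p i) zero * u * M p (suc j)))
            ≈⟨ relation j ⟩
          0# ∎) }
    where
    s = sum (λ i → a i * M (punchIn p i) zero)
    -- Solves the first column for the pivot coefficient, u being the inverse of the pivot; in the
    -- other columns this choice undoes the elimination.
    aₚ = - (s * u)
    expand : ∀ j → sum (λ i → insertAt a p aₚ i * M i j)
      ≈ aₚ * M p j + sum (λ i → a i * M (punchIn p i) j)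
    expand j = trans (sum-remove {i = p} (λ i → insertAt a p aₚ i * M i j)) (+-cong
      (*-congʳ (reflexive (Vector.insertAt-lookup a p aₚ)))
      (sum-cong-≋ {suc n} (λ i → *-congʳ {M (punchIn p i) j} (reflexive
        (Vector.insertAt-punchIn a p aₚ i)))))

-- Power sums and orthogonality of characters

module PowerSums {c ℓ} (F : Field c ℓ) where
  open Field F hiding (zero)
  open FieldProperties F
  open PolynomialFunctions F using (power; addLower; scaleBy; manyRoots⇒zero)
  open Exp commutativeSemiring
  open MonoidMult +-monoid using () renaming (_×_ to _·_)
  open SemiringSum semiring using (sum; sum-cong-≋; sum-replicate; sum-remove; *-distribˡ-sum)
  open SetoidReasoning setoid

  0^n : ∀ {n} → 0 ℕ.< n → ∀ {x} → x ≈ 0# → x ^ n ≈ 0#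
  0^n {suc n} _ x≈0 = trans (*-congʳ x≈0) (zeroˡ _)

  ^-nonzero : ∀ n {x} → ¬ x ≈ 0# → ¬ x ^ n ≈ 0#
  ^-nonzero zero    x≉0 = 1≉0
  ^-nonzero (suc n) x≉0 = *-nonzero x≉0 (^-nonzero n x≉0)

  -- Inversion written as a power is total and multiplicative, and commutes with taking powers.
  reciprocal-inverse : ∀ {N} → HasOrder F N → ∀ {x} → ¬ x ≈ 0# → x * x ^ (N ℕ.∸ 2) ≈ 1#
  reciprocal-inverse {zero}        order = contradiction (1<order F order) λ ()
  reciprocal-inverse {suc zero}    order = contradiction (1<order F order) λ { (ℕ.s≤s ()) }
  reciprocal-inverse {suc (suc M)} order = unit-power F order

  -- The sum consists of N - 1 ones, and N · 1 = 0.
  sum-of-ones : ∀ {N} (order : HasOrder F N) (f : Carrier → Carrier) →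
    (∀ {x} → x ≈ 0# → f x ≈ 0#) → (∀ {x} → ¬ x ≈ 0# → f x ≈ 1#) →
    FiniteField.∑ F order f ≈ - 1#
  sum-of-ones {zero}  order with () ← Inverse.from order 0#
  sum-of-ones {suc n} order f f-zero f-nonzero = begin
    sum (f ∘ element) ≈⟨ sum-remove {i = i₀} (f ∘ element) ⟩
    f (element i₀) + sum (removeAt (f ∘ element) i₀)
      ≈⟨ +-cong (f-zero (element-index 0#)) (trans
           (sum-cong-≋ {n} (λ j → f-nonzero λ eq →
             Fin.punchInᵢ≢i i₀ j (element-injective (trans eq (sym (element-index 0#))))))
           (sum-replicate n)) ⟩
    0# + n · 1#  ≈⟨ +-identityˡ _ ⟩
    n · 1#       ≈⟨ GroupProperties.inverseʳ-unique +-group 1# (n · 1#) order·1≈0 ⟩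
    - 1#         ∎
    where
    open FiniteField F order
    i₀ = index 0#

  module _ {N} (order : HasOrder F N) where
    open FiniteField F order

    -- Substituting g x for x multiplies the sum by χ(g), so χ(g) - 1 annihilates it.
    multiplicative-sum : ∀ (χ : Carrier → Carrier) → (∀ {x y} → x ≈ y → χ x ≈ χ y) →
      (∀ x y → χ (x * y) ≈ χ x * χ y) → ∀ {g} → ¬ g ≈ 0# → ¬ χ g ≈ 1# → ∑ χ ≈ 0#
    multiplicative-sum χ χ-cong χ-* {g} g≉0 χg≉1 =
      *-zero-cancelˡ (λ eq → χg≉1 (x-y≈0⇒x≈y eq)) (begin
        (χ g - 1#) * ∑ χ      ≈⟨ solve 2 (λ x s → (x :- :1) :* s := x :* s :- s) refl (χ g) (∑ χ) ⟩
        χ g * ∑ χ - ∑ χ       ≈⟨ +-congʳ (*-distribˡ-sum (χ g) (χ ∘ element)) ⟩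
        sum (λ i → χ g * χ (element i)) - ∑ χ
          ≈⟨ +-congʳ (sum-cong-≋ {N} (λ i → χ-* g (element i))) ⟨
        ∑ (λ x → χ (g * x)) - ∑ χ ≈⟨ +-congʳ (∑-scale χ χ-cong g≉0) ⟨
        ∑ χ - ∑ χ             ≈⟨ -‿inverseʳ _ ⟩
        0#                    ∎)
      where open IntegerSolver commutativeRing using (solve; _:=_; _:*_; _:-_; :1)

    -- Otherwise x^e - x^f, of degree e with leading coefficient 1, would vanish at e + 1 of the N
    -- elements.
    distinct-powers : ∀ {e f} → f ℕ.< e → e ℕ.< N → ∃ λ x → ¬ x ^ e ≈ x ^ f
    distinct-powers {e} {f} f<e e<N = element (proj₁ found) , proj₂ found
      where
      open import Algebra.Properties.Ring ring using (-1*x≈-x)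
      allEqual-impossible : ¬ (∀ i → element i ^ e ≈ element i ^ f)
      allEqual-impossible allEqual = 1≉0 (proj₁ (manyRoots⇒zero e
        (addLower f<e (power e) (scaleBy f (- 1#) (power f)))
        (λ i → element (inject≤ i e<N))
        (λ {i} {j} eq → Fin.inject≤-injective e<N e<N i j (element-injective eq))
        λ i → trans (+-cong (allEqual (inject≤ i e<N)) (-1*x≈-x _)) (-‿inverseʳ _)))
      found : ∃ λ i → ¬ element i ^ e ≈ element i ^ f
      found = Fin.¬∀⟶∃¬ N _ (λ i → element i ^ e ≟ element i ^ f) allEqual-impossible

    -- For positive e the term at zero vanishes, and this is the sum of x^(e - f) over the units.
    powerSum : ℕ → ℕ → Carrier
    powerSum e f = ∑ (λ x → (x ^ f) ^ (N ℕ.∸ 2) * x ^ e)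

    powerSum-≡ : ∀ {e} → 0 ℕ.< e → powerSum e e ≈ - 1#
    powerSum-≡ {e} 0<e = sum-of-ones order _
      (λ x≈0 → trans (*-congˡ (0^n 0<e x≈0)) (zeroʳ _))
      (λ x≉0 → trans (*-comm _ _) (reciprocal-inverse order (^-nonzero e x≉0)))

    -- Some g has g^e different from g^f. It is a unit, since both powers of zero vanish, and the
    -- quotient of the two characters is not 1 at g.
    powerSum-≢ : ∀ {e f} → 0 ℕ.< e → 0 ℕ.< f → e ℕ.< N → f ℕ.< N → e ≢ f → powerSum e f ≈ 0#
    powerSum-≢ {e} {f} 0<e 0<f e<N f<N e≢f = multiplicative-sum χ
      (λ eq → *-cong (^-congˡ (N ℕ.∸ 2) (^-congˡ f eq)) (^-congˡ e eq))
      (λ x y → trans (*-cong (trans (^-congˡ (N ℕ.∸ 2) (^-distrib-* x y f))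
          (^-distrib-* (x ^ f) (y ^ f) (N ℕ.∸ 2))) (^-distrib-* x y e))
        (solve 4 (λ a b c d → (a :* b) :* (c :* d) := (a :* c) :* (b :* d)) refl _ _ _ _))
      g≉0 χg≉1
      where
      open IntegerSolver commutativeRing using (solve; _:=_; _:*_)
      χ : Carrier → Carrier
      χ x = (x ^ f) ^ (N ℕ.∸ 2) * x ^ e
      separating : ∃ λ x → ¬ x ^ e ≈ x ^ f
      separating with ℕ.<-cmp e f
      ... | tri< e<f _ _ = let x , neq = distinct-powers e<f f<N in x , neq ∘ sym
      ... | tri≈ _ e≡f _ = contradiction e≡f e≢f
      ... | tri> _ _ f<e = distinct-powers f<e e<N
      g = proj₁ separating
      g≉0 : ¬ g ≈ 0#
      g≉0 g≈0 = proj₂ separating (trans (0^n 0<e g≈0) (sym (0^n 0<f g≈0)))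
      χg≉1 : ¬ χ g ≈ 1#
      χg≉1 χg≈1 = proj₂ separating (begin
        g ^ e                                       ≈⟨ *-identityˡ _ ⟨
        1# * g ^ e                                  ≈⟨ *-congʳ (reciprocal-inverse order
          (^-nonzero f g≉0)) ⟨
        g ^ f * (g ^ f) ^ (N ℕ.∸ 2) * g ^ e         ≈⟨ *-assoc _ _ _ ⟩
        g ^ f * χ g                                 ≈⟨ *-congˡ χg≈1 ⟩
        g ^ f * 1#                                  ≈⟨ *-identityʳ _ ⟩
        g ^ f                                       ∎)

-- Exponents with digits 0 and 1 in base q

module Digits (q : ℕ) (1<q : 1 ℕ.< q) where

  bit : Bool → ℕ
  bit false = 0
  bit true  = 1

  -- A product of distinct conjugates of x is a power of x; this is its exponent. Unique digits in
  -- base q then make different products different characters.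
  value : ∀ {n} → Vec Bool n → ℕ
  value Vec.[]      = 0
  value (b Vec.∷ T) = bit b ℕ.+ q ℕ.* value T

  value< : ∀ {n} (T : Vec Bool n) → value T ℕ.< q ℕ.^ n
  value< Vec.[]            = ℕ.z<s
  value< {suc n} (b Vec.∷ T) = begin-strict
    bit b ℕ.+ q ℕ.* value T ≤⟨ ℕ.+-monoˡ-≤ _ (bit≤1 b) ⟩
    1 ℕ.+ q ℕ.* value T     <⟨ ℕ.+-monoˡ-< _ 1<q ⟩
    q ℕ.+ q ℕ.* value T     ≡⟨ ℕ.*-suc q (value T) ⟨
    q ℕ.* suc (value T)     ≤⟨ ℕ.*-monoʳ-≤ q (value< T) ⟩
    q ℕ.* q ℕ.^ n           ∎
    where
    open ℕ.≤-Reasoning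
    bit≤1 : ∀ b → bit b ℕ.≤ 1
    bit≤1 false = ℕ.z≤n
    bit≤1 true  = ℕ.≤-refl

  private
    cancel : ∀ t u → q ℕ.* t ≡ q ℕ.* u → t ≡ u
    cancel t u = ℕ.*-cancelˡ-≡ t u q {{ℕ.>-nonZero (ℕ.<-trans ℕ.z<s 1<q)}}

    indivisible : ∀ t u → q ℕ.* t ≢ suc (q ℕ.* u)
    indivisible t u eq = ℕ.<⇒≢ 1<q (≡.sym (∣1⇒≡1 (∣m+n∣m⇒∣n
      (≡.subst (q ∣_) (≡.trans eq (ℕ.+-comm 1 (q ℕ.* u))) (m∣m*n t)) (m∣m*n u))))

  value-injective : ∀ {n} (T U : Vec Bool n) → value T ≡ value U → T ≡ U
  value-injective Vec.[] Vec.[] eq = ≡.refl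
  value-injective (false Vec.∷ T) (false Vec.∷ U) eq =
    ≡.cong (false Vec.∷_) (value-injective T U (cancel (value T) (value U) eq))
  value-injective (true Vec.∷ T)  (true Vec.∷ U)  eq =
    ≡.cong (true Vec.∷_) (value-injective T U (cancel (value T) (value U) (ℕ.suc-injective eq)))
  value-injective (true Vec.∷ T)  (false Vec.∷ U) eq = ⊥-elim (indivisible (value U) (value T)
    (≡.sym eq))
  value-injective (false Vec.∷ T) (true Vec.∷ U)  eq = ⊥-elim (indivisible (value T) (value U) eq)

  value-positive : ∀ {n} (T : Vec Bool n) → T ≢ Vec.replicate n false → 0 ℕ.< value T
  value-positive {n} T T≢0 = ℕ.n≢0⇒n>0 λ eq → T≢0 (value-injective T _ (≡.trans eq (≡.sym (zeros n))))
    where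
    zeros : ∀ n → value (Vec.replicate n false) ≡ 0
    zeros zero    = ≡.refl
    zeros (suc n) = ≡.trans (≡.cong (q ℕ.*_) (zeros n)) (ℕ.*-zeroʳ q)

-- Counting the points of a projective space

-- The summand `q ℕ.^ d` counts the vectors with first coordinate 1, so that the recursion runs
-- parallel to `normalized`.
pointCount : ℕ → ℕ → ℕ
pointCount q zero    = 0
pointCount q (suc d) = q ℕ.^ d ℕ.+ pointCount q d

pointCount-/ : ∀ q d → 0 ℕ.< q → .{{_ : NonZero (q ℕ.∸ 1)}} →
  pointCount q d ≡ (q ℕ.^ d ℕ.∸ 1) ℕ./ (q ℕ.∸ 1)
pointCount-/ (suc p) d _ = ≡.trans (≡.sym (m*n/n≡m (pointCount (suc p) d) p))
  (≡.cong (λ n → (n ℕ.∸ 1) ℕ./ p) (geometric d))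
  where
  open +-*-Solver
  geometric : ∀ d → suc (pointCount (suc p) d ℕ.* p) ≡ suc p ℕ.^ d
  geometric zero    = ≡.refl
  geometric (suc d) = ≡.trans
    (solve 3 (λ n c p → con 1 :+ (n :+ c) :* p := (con 1 :+ c :* p) :+ p :* n) ≡.refl
      (suc p ℕ.^ d) (pointCount (suc p) d) p)
    (≡.cong (ℕ._+ p ℕ.* suc p ℕ.^ d) (geometric d))

-- The vectors whose first nonzero coordinate is 1 represent the points of a
-- projective space.
module NormalizedVectors {c ℓ} (F : Field c ℓ) {q} (order : HasOrder F q) where
  open Field F hiding (zero)
  open FieldProperties F
  open FiniteField F order

  private
    vector : ∀ d → Fin (q ℕ.^ d) → Vector Carrier d
    vector d i l = element (finToFun i l)

    vector-injective : ∀ d i j → (∀ l → vector d i l ≈ vector d j l) → i ≡ j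
    vector-injective d i j eq = ≡.trans (≡.sym (Fin.funToFin-finToFin {d} i)) (≡.trans
      (funToFin-cong (λ l → element-injective (eq l))) (Fin.funToFin-finToFin {d} j))
      where
      funToFin-cong : ∀ {m n} {f g : Fin m → Fin n} → (∀ l → f l ≡ g l) → funToFin f ≡ funToFin g
      funToFin-cong {zero}  eq = ≡.refl
      funToFin-cong {suc m} eq = ≡.cong₂ combine (eq zero) (funToFin-cong (eq ∘ suc))

    vector-surjective : ∀ d v → ∃ λ i → ∀ l → vector d i l ≈ v l
    vector-surjective d v = funToFin (index ∘ v) , λ l →
      trans (reflexive (≡.cong element (Fin.finToFun-funToFin (index ∘ v) l))) (element-index (v l))

    extend : ∀ d → (Fin (pointCount q d) → Vector Carrier d) →
      Fin (q ℕ.^ d) ⊎ Fin (pointCount q d) → Vector Carrier (suc d)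
    extend d r (inj₁ i) = 1# ∷ vector d i
    extend d r (inj₂ k) = 0# ∷ r k

  normalized : ∀ d → Fin (pointCount q d) → Vector Carrier d
  normalized zero    ()
  normalized (suc d) i = extend d (normalized d) (splitAt (q ℕ.^ d) i)

  normalized-nonzero : ∀ d i → ¬ (∀ l → normalized d i l ≈ 0#)
  normalized-nonzero (suc d) i eq with splitAt (q ℕ.^ d) i
  ... | inj₁ j = 1≉0 (eq zero)
  ... | inj₂ k = normalized-nonzero d k (eq ∘ suc)

  -- Two leading ones force a = 1. A leading 1 cannot be a multiple of 0, and a leading 0 against a
  -- leading 1 forces a = 0, hence a zero vector.
  normalized-injective : ∀ d i j {a} → (∀ l → normalized d i l ≈ a * normalized d j l) → i ≡ j
  normalized-injective (suc d) i j {a} eq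
    with splitAt (q ℕ.^ d) i in eqᵢ | splitAt (q ℕ.^ d) j in eqⱼ
  ... | inj₁ i′ | inj₁ j′ = ≡.trans (≡.sym (Fin.splitAt⁻¹-↑ˡ eqᵢ)) (≡.trans
    (≡.cong (_↑ˡ pointCount q d) (vector-injective d i′ j′ λ l →
      trans (eq (suc l)) (trans (*-congʳ (trans (sym (*-identityʳ a)) (sym (eq zero))))
        (*-identityˡ _))))
    (Fin.splitAt⁻¹-↑ˡ eqⱼ))
  ... | inj₁ _  | inj₂ _  = contradiction (trans (eq zero) (zeroʳ a)) 1≉0
  ... | inj₂ k  | inj₁ _  = contradiction
    (λ l → trans (eq (suc l)) (trans (*-congʳ (trans (sym (*-identityʳ a)) (sym (eq zero)))) (zeroˡ _)))
    (normalized-nonzero d k)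
  ... | inj₂ i′ | inj₂ j′ = ≡.trans (≡.sym (Fin.splitAt⁻¹-↑ʳ eqᵢ)) (≡.trans
    (≡.cong (q ℕ.^ d ↑ʳ_) (normalized-injective d i′ j′ (eq ∘ suc))) (Fin.splitAt⁻¹-↑ʳ eqⱼ))

  normalize : ∀ d (v : Vector Carrier d) → ¬ (∀ l → v l ≈ 0#) →
    ∃₂ λ i a → ¬ a ≈ 0# × ∀ l → v l ≈ a * normalized d i l
  normalize zero    v v≉0 = contradiction (λ ()) v≉0
  normalize (suc d) v v≉0 with v zero ≟ 0#
  ... | yes v₀≈0
    with k , a , a≉0 , eq ← normalize d (v ∘ suc) (λ eq → v≉0 λ { zero → v₀≈0 ; (suc l) → eq l }) =
    (q ℕ.^ d ↑ʳ k) , a , a≉0 , λ l → trans (eq′ l) (*-congˡ (reflexive (≡.cong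
      (λ s → extend d (normalized d) s l) (≡.sym (Fin.splitAt-↑ʳ (q ℕ.^ d) _ k)))))
    where
    eq′ : ∀ l → v l ≈ a * (0# ∷ normalized d k) l
    eq′ zero    = trans v₀≈0 (sym (zeroʳ a))
    eq′ (suc l) = eq l
  ... | no v₀≉0
    with u , v₀u≈1 ← inverse (v zero) v₀≉0
    with j , eq ← vector-surjective d (λ l → u * v (suc l)) =
    (j ↑ˡ pointCount q d) , v zero , v₀≉0 , λ l → trans (eq′ l) (*-congˡ (reflexive (≡.cong
      (λ s → extend d (normalized d) s l) (≡.sym (Fin.splitAt-↑ˡ (q ℕ.^ d) j _)))))
    where
    eq′ : ∀ l → v l ≈ v zero * (1# ∷ vector d j) l
    eq′ zero    = sym (*-identityʳ _)
    eq′ (suc l) = sym (trans (*-congˡ (eq l)) (trans (sym (*-assoc _ _ _))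
      (trans (*-congʳ v₀u≈1) (*-identityˡ _))))

-- Exponents of the embedding, and certificates for q = 2 and q = 3

-- The components of the embedding are the products of the conjugates φᵉ x over the
-- three exponents e in a row.
exponent : Fin 3 → Vector ℕ 3
exponent 0F = 1 ∷ 2 ∷ 4 ∷ []
exponent 1F = 0 ∷ 3 ∷ 5 ∷ []
exponent 2F = 0 ∷ 2 ∷ 4 ∷ []

-- Representatives Σ aᵢⱼ wⁱ tʲ with natural coefficients of elements of a ring in
-- which w² = w + 1 and t³ = t + 1.
Representative₂ Representative : Set
Representative₂ = ℕ × ℕ
Representative  = Representative₂ × Representative₂ × Representative₂

infixl 6 _⊕₂_ _⊕_
infixl 7 _⊗₂_ _⊗_

_⊕₂_ _⊗₂_ : Representative₂ → Representative₂ → Representative₂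
(a , b) ⊕₂ (c , d) = a ℕ.+ c , b ℕ.+ d
(a , b) ⊗₂ (c , d) = a ℕ.* c ℕ.+ b ℕ.* d , a ℕ.* d ℕ.+ b ℕ.* c ℕ.+ b ℕ.* d

_⊕_ _⊗_ : Representative → Representative → Representative
(x₀ , x₁ , x₂) ⊕ (y₀ , y₁ , y₂) = x₀ ⊕₂ y₀ , x₁ ⊕₂ y₁ , x₂ ⊕₂ y₂
(x₀ , x₁ , x₂) ⊗ (y₀ , y₁ , y₂) =
    x₀ ⊗₂ y₀ ⊕₂ (x₁ ⊗₂ y₂ ⊕₂ x₂ ⊗₂ y₁)
  , x₀ ⊗₂ y₁ ⊕₂ x₁ ⊗₂ y₀ ⊕₂ (x₁ ⊗₂ y₂ ⊕₂ x₂ ⊗₂ y₁) ⊕₂ x₂ ⊗₂ y₂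
  , x₀ ⊗₂ y₂ ⊕₂ x₁ ⊗₂ y₁ ⊕₂ x₂ ⊗₂ y₀ ⊕₂ x₂ ⊗₂ y₂

numeral : ℕ → Representative
numeral n = (n , 0) , (0 , 0) , (0 , 0)

reduce : (p : ℕ) .{{_ : NonZero p}} → Representative → Representative
reduce p ((a , b) , (c , d) , (e , f)) =
  (a ℕ.% p , b ℕ.% p) , (c ℕ.% p , d ℕ.% p) , (e ℕ.% p , f ℕ.% p)

power : ℕ → Representative → Representative
power ℕ.zero    x = numeral 1
power (ℕ.suc n) x = x ⊗ power n x

frobenius : (p : ℕ) .{{_ : NonZero p}} → Representative → Representative
frobenius p x = reduce p (power p x)

conjugate : (p : ℕ) .{{_ : NonZero p}} → ℕ → Representative → Representative
conjugate p ℕ.zero    x = x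
conjugate p (ℕ.suc k) x = frobenius p (conjugate p k x)

total : ∀ {n} → (Fin n → Representative) → Representative
total {ℕ.zero}  f = numeral 0
total {ℕ.suc n} f = f zero ⊕ total (f ∘ suc)

-- The condition (φ(xⱼ) xᵢ - xⱼ φ(xᵢ)) zᵢⱼ = 1 with the subtracted product moved to the other side,
-- since the coefficients are natural numbers.
Independent : (p : ℕ) .{{_ : NonZero p}} → (Fin 5 → Representative) →
  (Fin 5 → Fin 5 → Representative) → Set
Independent p x z = ∀ i j → i Fin.< j →
  reduce p (frobenius p (x j) ⊗ x i ⊗ z i j) ≡ reduce p (x j ⊗ frobenius p (x i) ⊗ z i j ⊕ numeral 1)

independent? : (p : ℕ) .{{_ : NonZero p}} → ∀ x z → Dec (Independent p x z)
independent? p x z = Fin.all? λ i → Fin.all? λ j → (i Fin.<? j) →-dec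
  (reduce p (frobenius p (x j) ⊗ x i ⊗ z i j) ≟ᴿ reduce p (x j ⊗ frobenius p (x i) ⊗ z i j ⊕ numeral 1))
  where
  _≟ᴿ_ : (x y : Representative) → Dec (x ≡ y)
  _≟ᴿ_ = ≡-dec (≡-dec ℕ._≟_ ℕ._≟_) (≡-dec (≡-dec ℕ._≟_ ℕ._≟_) (≡-dec ℕ._≟_ ℕ._≟_))

-- detInverse i j is inverse to the determinant of base i and base j modulo p, and so
-- certifies that they are not proportional.
record Dependency (p : ℕ) .{{_ : NonZero p}} : Set where
  field
    base        : Fin 5 → Representative
    coefficient : Fin 5 → ℕ
    detInverse  : Fin 5 → Fin 5 → Representative

  combination : Fin 3 → Representative
  combination k = total λ i → numeral (coefficient i)
    ⊗ (conjugate p (exponent k 0F) (base i) ⊗ conjugate p (exponent k 1F) (base i)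
      ⊗ conjugate p (exponent k 2F) (base i))

  field
    coefficient₀ : coefficient 0F ≡ 1
    relation     : ∀ k → reduce p (combination k) ≡ numeral 0
    independent  : Independent p base detInverse

dependency₂ : Dependency 2
dependency₂ = record
  { base = base
  ; coefficient = λ _ → 1
  ; detInverse = detInverse
  ; coefficient₀ = ≡.refl
  ; relation = λ { 0F → ≡.refl ; 1F → ≡.refl ; 2F → ≡.refl }
  ; independent = from-yes (independent? 2 base detInverse)
  }
  where
  base : Fin 5 → Representative
  base 0F = (1 , 0) , (0 , 0) , (0 , 0)
  base 1F = (0 , 0) , (1 , 0) , (0 , 0)
  base 2F = (0 , 0) , (0 , 0) , (1 , 0)
  base 3F = (1 , 0) , (1 , 0) , (0 , 1)
  base 4F = (1 , 0) , (1 , 0) , (1 , 1)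
  detInverse : Fin 5 → Fin 5 → Representative
  detInverse 0F 1F = (1 , 0) , (1 , 0) , (0 , 0)
  detInverse 0F 2F = (1 , 0) , (0 , 0) , (1 , 0)
  detInverse 0F 3F = (1 , 1) , (0 , 0) , (1 , 1)
  detInverse 0F 4F = (0 , 1) , (0 , 0) , (0 , 1)
  detInverse 1F 2F = (1 , 0) , (0 , 0) , (0 , 0)
  detInverse 1F 3F = (0 , 1) , (0 , 0) , (0 , 0)
  detInverse 1F 4F = (1 , 1) , (0 , 0) , (0 , 0)
  -- Covers the pairs (2,3), (2,4) and (3,4), which share this inverse.
  detInverse _  _  = (1 , 0) , (1 , 0) , (0 , 0)

-- The coefficient 2 stands for -1. A line has only four points here; three of the five base
-- elements, t, w and w + t, come from one line.
dependency₃ : Dependency 3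
dependency₃ = record
  { base = base
  ; coefficient = λ { 4F → 2 ; _ → 1 }
  ; detInverse = detInverse
  ; coefficient₀ = ≡.refl
  ; relation = λ { 0F → ≡.refl ; 1F → ≡.refl ; 2F → ≡.refl }
  ; independent = from-yes (independent? 3 base detInverse)
  }
  where
  base : Fin 5 → Representative
  base 0F = (1 , 0) , (0 , 0) , (0 , 0)
  base 1F = (0 , 0) , (1 , 0) , (0 , 0)
  base 2F = (0 , 1) , (0 , 0) , (0 , 0)
  base 3F = (0 , 1) , (1 , 0) , (0 , 0)
  base 4F = (1 , 1) , (0 , 0) , (1 , 0)
  detInverse : Fin 5 → Fin 5 → Representative
  detInverse 0F 1F = (1 , 0) , (0 , 0) , (0 , 0)
  detInverse 0F 2F = (2 , 2) , (0 , 0) , (0 , 0)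
  detInverse 0F 3F = (0 , 1) , (0 , 0) , (0 , 0)
  detInverse 0F 4F = (1 , 1) , (2 , 2) , (2 , 1)
  detInverse 1F 2F = (2 , 0) , (1 , 0) , (0 , 1)
  detInverse 1F 3F = (2 , 0) , (1 , 0) , (0 , 1)
  detInverse 1F 4F = (2 , 1) , (1 , 0) , (1 , 1)
  detInverse 2F 3F = (1 , 0) , (2 , 0) , (0 , 2)
  detInverse 2F 4F = (0 , 1) , (1 , 1) , (2 , 0)
  -- The only pair i < j left is (3,4).
  detInverse _  _  = (1 , 1) , (1 , 2) , (0 , 2)

module Representatives {c ℓ} (R : CommutativeRing c ℓ) where

  open CommutativeRing R
  open SemiringMult semiring using (×-homo-+; ×1-homo-*) renaming (_×_ to _·_)
  open IntegerSolver R using (solve; _:=_; _:+_; _:*_; :0; :1)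
  open SetoidReasoning setoid

  -- Evaluation respects sums and products for any w and t that satisfy the two equations, so
  -- congruences between representatives become equations wherever the modulus is zero.
  module Evaluation {w t : Carrier} (w² : w * w ≈ w + 1#) (t³ : t * t * t ≈ t + 1#) where

    eval₂ : Representative₂ → Carrier
    eval₂ (a , b) = a · 1# + b · 1# * w

    eval : Representative → Carrier
    eval (x₀ , x₁ , x₂) = eval₂ x₀ + eval₂ x₁ * t + eval₂ x₂ * (t * t)

    eval₂-⊕ : ∀ x y → eval₂ (x ⊕₂ y) ≈ eval₂ x + eval₂ y
    eval₂-⊕ (a , b) (c , d) = begin
      (a ℕ.+ c) · 1# + (b ℕ.+ d) · 1# * w
        ≈⟨ +-cong (×-homo-+ 1# a c) (*-congʳ (×-homo-+ 1# b d)) ⟩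
      (a · 1# + c · 1#) + (b · 1# + d · 1#) * w
        ≈⟨ solve 5 (λ a b c d w → (a :+ c) :+ (b :+ d) :* w := (a :+ b :* w) :+ (c :+ d :* w))
             refl (a · 1#) (b · 1#) (c · 1#) (d · 1#) w ⟩
      eval₂ (a , b) + eval₂ (c , d) ∎

    eval₂-⊗ : ∀ x y → eval₂ (x ⊗₂ y) ≈ eval₂ x * eval₂ y
    eval₂-⊗ (a , b) (c , d) = begin
      (a ℕ.* c ℕ.+ b ℕ.* d) · 1# + (a ℕ.* d ℕ.+ b ℕ.* c ℕ.+ b ℕ.* d) · 1# * w
        ≈⟨ +-cong (trans (×-homo-+ 1# (a ℕ.* c) (b ℕ.* d)) (+-cong (×1-homo-* a c) (×1-homo-* b d)))
             (*-congʳ (trans (×-homo-+ 1# (a ℕ.* d ℕ.+ b ℕ.* c) (b ℕ.* d))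
               (+-cong (trans (×-homo-+ 1# (a ℕ.* d) (b ℕ.* c)) (+-cong (×1-homo-* a d) (×1-homo-* b c)))
                 (×1-homo-* b d)))) ⟩
      (A * C + B * D) + (A * D + B * C + B * D) * w
        ≈⟨ solve 5 (λ a b c d w → (a :* c :+ b :* d) :+ (a :* d :+ b :* c :+ b :* d) :* w
             := a :* c :+ (a :* d :+ b :* c) :* w :+ b :* d :* (w :+ :1)) refl A B C D w ⟩
      A * C + (A * D + B * C) * w + B * D * (w + 1#) ≈⟨ +-congˡ (*-congˡ w²) ⟨
      A * C + (A * D + B * C) * w + B * D * (w * w)
        ≈⟨ solve 5 (λ a b c d w → a :* c :+ (a :* d :+ b :* c) :* w :+ b :* d :* (w :* w)
             := (a :+ b :* w) :* (c :+ d :* w)) refl A B C D w ⟩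
      eval₂ (a , b) * eval₂ (c , d) ∎
      where
      A = a · 1#
      B = b · 1#
      C = c · 1#
      D = d · 1#

    eval-⊕ : ∀ x y → eval (x ⊕ y) ≈ eval x + eval y
    eval-⊕ (x₀ , x₁ , x₂) (y₀ , y₁ , y₂) = begin
      eval₂ (x₀ ⊕₂ y₀) + eval₂ (x₁ ⊕₂ y₁) * t + eval₂ (x₂ ⊕₂ y₂) * (t * t)
        ≈⟨ +-cong (+-cong (eval₂-⊕ x₀ y₀) (*-congʳ (eval₂-⊕ x₁ y₁))) (*-congʳ (eval₂-⊕ x₂ y₂)) ⟩
      (eval₂ x₀ + eval₂ y₀) + (eval₂ x₁ + eval₂ y₁) * t + (eval₂ x₂ + eval₂ y₂) * (t * t)
        ≈⟨ solve 7 (λ x₀ x₁ x₂ y₀ y₁ y₂ t →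
             (x₀ :+ y₀) :+ (x₁ :+ y₁) :* t :+ (x₂ :+ y₂) :* (t :* t)
             := (x₀ :+ x₁ :* t :+ x₂ :* (t :* t)) :+ (y₀ :+ y₁ :* t :+ y₂ :* (t :* t)))
             refl (eval₂ x₀) (eval₂ x₁) (eval₂ x₂) (eval₂ y₀) (eval₂ y₁) (eval₂ y₂) t ⟩
      eval (x₀ , x₁ , x₂) + eval (y₀ , y₁ , y₂) ∎

    eval-⊗ : ∀ x y → eval (x ⊗ y) ≈ eval x * eval y
    eval-⊗ (x₀ , x₁ , x₂) (y₀ , y₁ , y₂) = begin
      eval ((x₀ , x₁ , x₂) ⊗ (y₀ , y₁ , y₂))
        ≈⟨ +-cong (+-cong
             (value (p x₀ y₀ ⊞ (p x₁ y₂ ⊞ p x₂ y₁)))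
             (*-congʳ (value (p x₀ y₁ ⊞ p x₁ y₀ ⊞ (p x₁ y₂ ⊞ p x₂ y₁) ⊞ p x₂ y₂))))
             (*-congʳ (value (p x₀ y₂ ⊞ p x₁ y₁ ⊞ p x₂ y₀ ⊞ p x₂ y₂))) ⟩
      (X₀ * Y₀ + (X₁ * Y₂ + X₂ * Y₁)) + (X₀ * Y₁ + X₁ * Y₀ + (X₁ * Y₂ + X₂ * Y₁) + X₂ * Y₂) * t
        + (X₀ * Y₂ + X₁ * Y₁ + X₂ * Y₀ + X₂ * Y₂) * (t * t)
        ≈⟨ solve 7 (λ x₀ x₁ x₂ y₀ y₁ y₂ t →
             (x₀ :* y₀ :+ (x₁ :* y₂ :+ x₂ :* y₁))
               :+ (x₀ :* y₁ :+ x₁ :* y₀ :+ (x₁ :* y₂ :+ x₂ :* y₁) :+ x₂ :* y₂) :* t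
               :+ (x₀ :* y₂ :+ x₁ :* y₁ :+ x₂ :* y₀ :+ x₂ :* y₂) :* (t :* t)
             := x₀ :* y₀ :+ (x₀ :* y₁ :+ x₁ :* y₀) :* t :+ (x₀ :* y₂ :+ x₁ :* y₁ :+ x₂ :* y₀) :* (t :* t)
               :+ (x₁ :* y₂ :+ x₂ :* y₁ :+ x₂ :* y₂ :* t) :* (t :+ :1))
             refl X₀ X₁ X₂ Y₀ Y₁ Y₂ t ⟩
      X₀ * Y₀ + (X₀ * Y₁ + X₁ * Y₀) * t + (X₀ * Y₂ + X₁ * Y₁ + X₂ * Y₀) * (t * t)
        + (X₁ * Y₂ + X₂ * Y₁ + X₂ * Y₂ * t) * (t + 1#) ≈⟨ +-congˡ (*-congˡ t³) ⟨
      X₀ * Y₀ + (X₀ * Y₁ + X₁ * Y₀) * t + (X₀ * Y₂ + X₁ * Y₁ + X₂ * Y₀) * (t * t)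
        + (X₁ * Y₂ + X₂ * Y₁ + X₂ * Y₂ * t) * (t * t * t)
        ≈⟨ solve 7 (λ x₀ x₁ x₂ y₀ y₁ y₂ t →
             x₀ :* y₀ :+ (x₀ :* y₁ :+ x₁ :* y₀) :* t :+ (x₀ :* y₂ :+ x₁ :* y₁ :+ x₂ :* y₀) :* (t :* t)
               :+ (x₁ :* y₂ :+ x₂ :* y₁ :+ x₂ :* y₂ :* t) :* (t :* t :* t)
             := (x₀ :+ x₁ :* t :+ x₂ :* (t :* t)) :* (y₀ :+ y₁ :* t :+ y₂ :* (t :* t)))
             refl X₀ X₁ X₂ Y₀ Y₁ Y₂ t ⟩
      eval (x₀ , x₁ , x₂) * eval (y₀ , y₁ , y₂) ∎
      where
      X₀ = eval₂ x₀
      X₁ = eval₂ x₁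
      X₂ = eval₂ x₂
      Y₀ = eval₂ y₀
      Y₁ = eval₂ y₁
      Y₂ = eval₂ y₂
      -- A record, so that representative and value can be inferred when the nested sums in `_⊗_`
      -- are assembled.
      record _represents_ (x : Representative₂) (a : Carrier) : Set ℓ where
        field value : eval₂ x ≈ a
      open _represents_
      infixl 6 _⊞_
      _⊞_ : ∀ {x y a b} → x represents a → y represents b → (x ⊕₂ y) represents (a + b)
      _⊞_ {x} {y} r s .value = trans (eval₂-⊕ x y) (+-cong (value r) (value s))
      p : ∀ x y → (x ⊗₂ y) represents (eval₂ x * eval₂ y)
      p x y .value = eval₂-⊗ x y

    eval-numeral : ∀ n → eval (numeral n) ≈ n · 1#
    eval-numeral n = solve 3 (λ n w t → n :+ :0 :* w :+ (:0 :+ :0 :* w) :* t :+ (:0 :+ :0 :* w) :*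
      (t :* t) := n)
      refl (n · 1#) w t

    eval-reduce : ∀ {p} .{{_ : NonZero p}} → p · 1# ≈ 0# → ∀ x → eval (reduce p x) ≈ eval x
    eval-reduce {p} p·1≈0 ((a , b) , (c , d) , (e , f)) =
      +-cong (+-cong (residue₂ a b) (*-congʳ (residue₂ c d))) (*-congʳ (residue₂ e f))
      where
      residue : ∀ a → (a ℕ.% p) · 1# ≈ a · 1#
      residue a = sym (begin
        a · 1#                                       ≡⟨ ≡.cong (_· 1#) (m≡m%n+[m/n]*n a p) ⟩
        (a ℕ.% p ℕ.+ a ℕ./ p ℕ.* p) · 1#             ≈⟨ ×-homo-+ 1# (a ℕ.% p) _ ⟩
        (a ℕ.% p) · 1# + (a ℕ./ p ℕ.* p) · 1#        ≈⟨ +-congˡ (×1-homo-* (a ℕ./ p) p) ⟩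
        (a ℕ.% p) · 1# + (a ℕ./ p) · 1# * (p · 1#)   ≈⟨ +-congˡ (trans (*-congˡ p·1≈0) (zeroʳ _)) ⟩
        (a ℕ.% p) · 1# + 0#                          ≈⟨ +-identityʳ _ ⟩
        (a ℕ.% p) · 1#                               ∎)
      residue₂ : ∀ a b → (a ℕ.% p) · 1# + (b ℕ.% p) · 1# * w ≈ eval₂ (a , b)
      residue₂ a b = +-cong (residue a) (*-congʳ (residue b))

-- Linear combinations and spans

module Spans {c ℓ} (F : Field c ℓ) (n : ℕ) where
  open Field F hiding (zero)
  open PG F n
  open LeftModule (coordinateSpace F (suc n)) using (Carrierᴹ; _≈ᴹ_; _+ᴹ_; _*ₗ_; 0ᴹ)
  open IntegerSolver commutativeRing using (solve; _:=_; _:+_; _:*_)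
  open SemiringSum semiring using (sum)

  lc-pointwise : ∀ {k} (a : Vector Carrier k) (v : Vector Carrierᴹ k) j →
    linearCombination a v j ≡ sum (λ i → a i * v i j)
  lc-pointwise {zero}  a v j = ≡.refl
  lc-pointwise {suc k} a v j = ≡.cong (a zero * v zero j +_) (lc-pointwise (a ∘ suc) (v ∘ suc) j)

  lc-0 : ∀ {k} {a : Vector Carrier k} v → (∀ i → a i ≈ 0#) → linearCombination a v ≈ᴹ 0ᴹ
  lc-0 {zero}  v a≈0 j = refl
  lc-0 {suc k} v a≈0 j =
    trans (+-cong (trans (*-congʳ (a≈0 zero)) (zeroˡ _)) (lc-0 (v ∘ suc) (a≈0 ∘ suc) j)) (+-identityˡ 0#)

  lc-congʳ : ∀ {k} (a : Vector Carrier k) {v w} → (∀ i → v i ≈ᴹ w i) →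
    linearCombination a v ≈ᴹ linearCombination a w
  lc-congʳ {zero}  a eq j = refl
  lc-congʳ {suc k} a eq j = +-cong (*-congˡ (eq zero j)) (lc-congʳ (a ∘ suc) (eq ∘ suc) j)

  lc-+ : ∀ {k} (a b : Vector Carrier k) v →
    linearCombination (λ i → a i + b i) v ≈ᴹ linearCombination a v +ᴹ linearCombination b v
  lc-+ {zero}  a b v j = sym (+-identityˡ 0#)
  lc-+ {suc k} a b v j = trans (+-congˡ (lc-+ (a ∘ suc) (b ∘ suc) (v ∘ suc) j))
    (solve 5 (λ a b v s t → (a :+ b) :* v :+ (s :+ t) := (a :* v :+ s) :+ (b :* v :+ t))
      refl (a zero) (b zero) (v zero j)
      (linearCombination (a ∘ suc) (v ∘ suc) j) (linearCombination (b ∘ suc) (v ∘ suc) j))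

  lc-* : ∀ {k} s (a : Vector Carrier k) v →
    linearCombination (λ i → s * a i) v ≈ᴹ s *ₗ linearCombination a v
  lc-* {zero}  s a v j = sym (zeroʳ s)
  lc-* {suc k} s a v j = trans (+-congˡ (lc-* s (a ∘ suc) (v ∘ suc) j))
    (solve 4 (λ s a v t → s :* a :* v :+ s :* t := s :* (a :* v :+ t)) refl s (a zero) (v zero j)
      (linearCombination (a ∘ suc) (v ∘ suc) j))

  lc-scaled : ∀ {k} (a b : Vector Carrier k) v →
    linearCombination a (λ i → b i *ₗ v i) ≈ᴹ linearCombination (λ i → a i * b i) v
  lc-scaled {zero}  a b v j = refl
  lc-scaled {suc k} a b v j =
    +-cong (sym (*-assoc (a zero) (b zero) (v zero j))) (lc-scaled (a ∘ suc) (b ∘ suc) (v ∘ suc) j)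

  -- Interchanging the two summations carries a relation between coefficient rows over to the
  -- vectors that they describe.
  lc-lc : ∀ {m k} (a : Vector Carrier m) (M : Fin m → Vector Carrier k) v →
    (∀ j → sum (λ i → a i * M i j) ≈ 0#) →
    linearCombination a (λ i → linearCombination (M i) v) ≈ᴹ 0ᴹ
  lc-lc {k = k} a M v relation = λ l → trans (collect a M l) (lc-0 v relation l)
    where
    collect : ∀ {m} (a : Vector Carrier m) (M : Fin m → Vector Carrier k) →
      linearCombination a (λ i → linearCombination (M i) v)
        ≈ᴹ linearCombination (λ j → sum (λ i → a i * M i j)) v
    collect {zero}  a M l = sym (lc-0 v (λ _ → refl) l)
    collect {suc m} a M l = trans
      (+-cong (sym (lc-* (a zero) (M zero) v l)) (collect (a ∘ suc) (M ∘ suc) l))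
      (sym (lc-+ (λ j → a zero * M zero j) (λ j → sum (λ i → a (suc i) * M (suc i) j)) v l))

  span : ∀ {k} → Vector Carrierᴹ k → Subspace
  span {k} v = record
    { Member    = λ w → ∃ λ (a : Vector Carrier k) → w ≈ᴹ linearCombination a v
    ; ≈-closed  = λ { u≈w (a , eq) → a , λ j → trans (sym (u≈w j)) (eq j) }
    ; 0-closed  = (λ _ → 0#) , λ j → sym (lc-0 v (λ _ → refl) j)
    ; +-closed  = λ { (a , eq) (b , eq′) → (λ i → a i + b i) ,
                      λ j → trans (+-cong (eq j) (eq′ j)) (sym (lc-+ a b v j)) }
    ; *ₗ-closed = λ { s (a , eq) → (λ i → s * a i) ,
                      λ j → trans (*-congˡ (eq j)) (sym (lc-* s a v j)) }
    }

  span-generators : ∀ {k} (v : Vector Carrierᴹ k) i → Member (span v) (v i)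
  span-generators {suc k} v zero = 1# ∷ (λ _ → 0#) , λ j →
    sym (trans (+-cong (*-identityˡ _) (lc-0 (v ∘ suc) (λ _ → refl) j)) (+-identityʳ _))
  span-generators {suc k} v (suc i) with a , eq ← span-generators (v ∘ suc) i =
    0# ∷ a , λ j → trans (eq j) (sym (trans (+-congʳ (zeroˡ _)) (+-identityˡ _)))

-- The embedding Φ and its components

module Construction {c ℓ} {F : Field c ℓ} {q} (order : HasOrder F q)
  (K : Extension F 2) (L : Extension (Extension.field′ K) 3) where

  E/F : Extension F 6
  E/F = compose K L

  module F = Field F
  module K = Field (Extension.field′ K)
  module K/F = Extension K
  module E/K = Extension L
  module E/F = Extension E/F

  orderE : HasOrder (Extension.field′ L) (q ℕ.^ 6)
  orderE = E/F.extensionOrder order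

  open Field (Extension.field′ L) public hiding (zero)
  open FieldProperties (Extension.field′ L) public
  open Frobenius order E/F public
  open FiniteField (Extension.field′ L) orderE public using (_≟_)
  open PG F 13 renaming (_∼_ to _~_)
  open Spans F 13

  φ⁶ : ∀ x → φ^ 6 x ≈ x
  φ⁶ x = trans (φ^-power 6 x) (fermat (Extension.field′ L) orderE x)

  -- K has q² elements, so φ² is the Frobenius map of the large field over K.
  φ²-fixed : ∀ x → φ^ 2 x ≈ x → ∃ λ k → E/K.ι k ≈ x
  φ²-fixed x eq = Frobenius.φ-fixed (K/F.extensionOrder order) L x (trans (sym (φ^-power 2 x)) eq)

  φ²-ι : ∀ k → φ^ 2 (E/K.ι k) ≈ E/K.ι k
  φ²-ι k = trans (φ^-power 2 (E/K.ι k)) (Frobenius.φ-ι (K/F.extensionOrder order) L k)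

  *₃-cong : ∀ {x y z x′ y′ z′} → x ≈ x′ → y ≈ y′ → z ≈ z′ → x * y * z ≈ x′ * y′ * z′
  *₃-cong p q r = *-cong (*-cong p q) r

  χ : Fin 3 → Carrier → Carrier
  χ k x = φ^ (exponent k 0F) x * φ^ (exponent k 1F) x * φ^ (exponent k 2F) x

  χ-cong : ∀ k {x y} → x ≈ y → χ k x ≈ χ k y
  χ-cong k eq = *₃-cong (φ^-cong (exponent k 0F) eq) (φ^-cong (exponent k 1F) eq) (φ^-cong
    (exponent k 2F) eq)

  χ-* : ∀ k x y → χ k (x * y) ≈ χ k x * χ k y
  χ-* k x y = trans
    (*₃-cong (φ^-* (exponent k 0F) x y) (φ^-* (exponent k 1F) x y) (φ^-* (exponent k 2F) x y))
    (solve 6 (λ x y z x′ y′ z′ → (x :* x′) :* (y :* y′) :* (z :* z′) := x :* y :* z :* (x′ :* y′ :* z′))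
      refl (φ^ (exponent k 0F) x) (φ^ (exponent k 1F) x) (φ^ (exponent k 2F) x)
      (φ^ (exponent k 0F) y) (φ^ (exponent k 1F) y) (φ^ (exponent k 2F) y))
    where open IntegerSolver commutativeRing using (solve; _:=_; _:*_)

  χ-ι : ∀ k a → χ k (E/F.ι a) ≈ E/F.ι (a F.* a F.* a)
  χ-ι k a = trans
    (*₃-cong (φ^-ι (exponent k 0F) a) (φ^-ι (exponent k 1F) a) (φ^-ι (exponent k 2F) a))
    (sym (trans (E/F.ι-* _ _) (*-congʳ (E/F.ι-* _ _))))

  χ-nonzero : ∀ k {x} → ¬ x ≈ 0# → ¬ χ k x ≈ 0#
  χ-nonzero k x≉0 = *-nonzero
    (*-nonzero (φ^-nonzero (exponent k 0F) x≉0) (φ^-nonzero (exponent k 1F) x≉0))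
    (φ^-nonzero (exponent k 2F) x≉0)

  -- Adding 2 modulo 6 permutes the exponents 0, 2, 4 cyclically.
  φ²-χ₂ : ∀ x → φ^ 2 (χ 2F x) ≈ χ 2F x
  φ²-χ₂ x = trans (φ^-*₃ 2 x (φ^ 2 x) (φ^ 4 x)) (trans (*-congˡ (φ⁶ x))
    (trans (*-comm _ _) (sym (*-assoc _ _ _))))

  Vec₁₄ : Set c
  Vec₁₄ = Vector F.Carrier 14

  infix 4 _≋_
  _≋_ : Vec₁₄ → Vec₁₄ → Set ℓ
  v ≋ w = ∀ i → v i F.≈ w i

  opaque
    -- The third component is an element of the intermediate field K.
    encode : (y : Fin 3 → Carrier) → φ^ 2 (y 2F) ≈ y 2F → Vec₁₄
    encode y fixed = (E/F.coordinates (y 0F) ++ E/F.coordinates (y 1F))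
      ++ K/F.coordinates (proj₁ (φ²-fixed (y 2F) fixed))

    private
      part₀ part₁ : Vec₁₄ → Vector F.Carrier 6
      part₀ w i = w (i ↑ˡ 6 ↑ˡ 2)
      part₁ w i = w ((6 ↑ʳ i) ↑ˡ 2)

      part₂ : Vec₁₄ → Vector F.Carrier 2
      part₂ w i = w (12 ↑ʳ i)

    -- The three components are linear over F and jointly injective, so every identity between
    -- vectors of length 14 is checked in the large field.
    component : Fin 3 → Vec₁₄ → Carrier
    component 0F w = E/F.fromCoordinates (part₀ w)
    component 1F w = E/F.fromCoordinates (part₁ w)
    component 2F w = E/K.ι (K/F.fromCoordinates (part₂ w))

    component-encode : ∀ y fixed k → component k (encode y fixed) ≈ y k
    component-encode y fixed 0F = trans (E/F.fromCoordinates-cong (λ i → F.reflexive (≡.trans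
      (Vector.lookup-++ˡ _ (K/F.coordinates _) (i ↑ˡ 6))
      (Vector.lookup-++ˡ (E/F.coordinates (y 0F)) (E/F.coordinates (y 1F)) i))))
      (E/F.from-coordinates (y 0F))
    component-encode y fixed 1F = trans (E/F.fromCoordinates-cong (λ i → F.reflexive (≡.trans
      (Vector.lookup-++ˡ _ (K/F.coordinates _) (6 ↑ʳ i))
      (Vector.lookup-++ʳ (E/F.coordinates (y 0F)) (E/F.coordinates (y 1F)) i))))
      (E/F.from-coordinates (y 1F))
    component-encode y fixed 2F = trans (E/K.ι-cong (K.trans (K/F.fromCoordinates-cong (λ i → F.reflexive
      (Vector.lookup-++ʳ (E/F.coordinates (y 0F) ++ E/F.coordinates (y 1F)) (K/F.coordinates _) i)))
      (K/F.from-coordinates _))) (proj₂ (φ²-fixed (y 2F) fixed))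

    component-injective : ∀ {v w} → (∀ k → component k v ≈ component k w) → v ≋ w
    component-injective {v} {w} eq i with splitAt 12 i in eqᵢ
    ... | inj₂ j = ≡.subst (λ i → v i F.≈ w i) (Fin.splitAt⁻¹-↑ʳ eqᵢ)
      (F.trans (F.sym (K/F.coordinates-from (part₂ v) j))
        (F.trans (K/F.coordinates-cong (E/K.ι-injective (eq 2F)) j) (K/F.coordinates-from (part₂ w) j)))
    ... | inj₁ i′ with splitAt 6 i′ in eqᵢ′
    ... | inj₁ j = ≡.subst (λ i → v i F.≈ w i)
      (≡.trans (≡.cong (_↑ˡ 2) (Fin.splitAt⁻¹-↑ˡ eqᵢ′)) (Fin.splitAt⁻¹-↑ˡ eqᵢ))
      (F.trans (F.sym (E/F.coordinates-from (part₀ v) j))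
        (F.trans (E/F.coordinates-cong (eq 0F) j) (E/F.coordinates-from (part₀ w) j)))
    ... | inj₂ j = ≡.subst (λ i → v i F.≈ w i)
      (≡.trans (≡.cong (_↑ˡ 2) (Fin.splitAt⁻¹-↑ʳ eqᵢ′)) (Fin.splitAt⁻¹-↑ˡ eqᵢ))
      (F.trans (F.sym (E/F.coordinates-from (part₁ v) j))
        (F.trans (E/F.coordinates-cong (eq 1F) j) (E/F.coordinates-from (part₁ w) j)))

    component-cong : ∀ k {v w} → v ≋ w → component k v ≈ component k w
    component-cong 0F eq = E/F.fromCoordinates-cong (λ i → eq (i ↑ˡ 6 ↑ˡ 2))
    component-cong 1F eq = E/F.fromCoordinates-cong (λ i → eq ((6 ↑ʳ i) ↑ˡ 2))
    component-cong 2F eq = E/K.ι-cong (K/F.fromCoordinates-cong (λ i → eq (12 ↑ʳ i)))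

    component-+ : ∀ k v w → component k (λ i → v i F.+ w i) ≈ component k v + component k w
    component-+ 0F v w = E/F.fromCoordinates-+ (part₀ v) (part₀ w)
    component-+ 1F v w = E/F.fromCoordinates-+ (part₁ v) (part₁ w)
    component-+ 2F v w = trans (E/K.ι-cong (K/F.fromCoordinates-+ (part₂ v) (part₂ w))) (E/K.ι-+ _ _)

    component-* : ∀ k a v → component k (λ i → a F.* v i) ≈ E/F.ι a * component k v
    component-* 0F a v = E/F.fromCoordinates-* a (part₀ v)
    component-* 1F a v = E/F.fromCoordinates-* a (part₁ v)
    component-* 2F a v = trans (E/K.ι-cong (K/F.fromCoordinates-* a (part₂ v))) (E/K.ι-* _ _)

    φ²-component₂ : ∀ w → φ^ 2 (component 2F w) ≈ component 2F w
    φ²-component₂ w = φ²-ι (K/F.fromCoordinates (part₂ w))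

  component-0 : ∀ k → component k (λ _ → F.0#) ≈ 0#
  component-0 k = trans (component-cong k (λ i → F.sym (F.zeroˡ F.0#)))
    (trans (component-* k F.0# (λ _ → F.0#)) (trans (*-congʳ E/F.ι-0) (zeroˡ _)))

  opaque
    Φ : Carrier → Vec₁₄
    Φ x = encode (λ k → χ k x) (φ²-χ₂ x)

    component-Φ : ∀ x k → component k (Φ x) ≈ χ k x
    component-Φ x = component-encode (λ k → χ k x) (φ²-χ₂ x)

  Φ-cong : ∀ {x y} → x ≈ y → Φ x ≋ Φ y
  Φ-cong {x} {y} eq = component-injective λ k →
    trans (component-Φ x k) (trans (χ-cong k eq) (sym (component-Φ y k)))

  Φ-nonzero : ∀ {x} → ¬ x ≈ 0# → ¬ Φ x ≋ (λ _ → F.0#)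
  Φ-nonzero {x} x≉0 eq = χ-nonzero 0F x≉0 (trans (sym (component-Φ x 0F))
    (trans (component-cong 0F eq) (component-0 0F)))

  -- Conjugation fixes F and every component has three factors, so a scalar comes out cubed; hence Φ
  -- is well defined on the points of PG(5,q).
  Φ-ι* : ∀ a x → Φ (E/F.ι a * x) ≋ (λ i → a F.* a F.* a F.* Φ x i)
  Φ-ι* a x = component-injective λ k → trans (component-Φ (E/F.ι a * x) k) (trans (χ-* k _ _)
    (trans (*-cong (χ-ι k a) (sym (component-Φ x k))) (sym (component-* k _ (Φ x)))))

  -- Separating forms and independence of four points

  module _ where
    open IntegerSolver commutativeRing using (solve; _:=_; _:+_; _:*_; _:-_; :-_; :0)
    open SetoidReasoning setoid
    open SemiringSum semiring using
      (sum; sum-remove; sum-cong-≋; sum-replicate-zero; ∑-distrib-+; *-distribˡ-sum)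

    det : Carrier → Carrier → Carrier
    det x y = φ x * y - x * φ y

    _∝_ : Carrier → Carrier → Set (c ⊔ ℓ)
    y ∝ x = ∃ λ a → y ≈ E/F.ι a * x

    -- The vanishing determinant says that y/x is fixed by φ and therefore lies in F.
    det≈0⇒∝ : ∀ {x y} → ¬ x ≈ 0# → det x y ≈ 0# → y ∝ x
    det≈0⇒∝ {x} {y} x≉0 det≈0 = proj₁ fixed , sym (begin
        E/F.ι (proj₁ fixed) * x ≈⟨ *-congʳ (proj₂ fixed) ⟩
        y * z * x     ≈⟨ solve 3 (λ x y z → y :* z :* x := y :* (x :* z)) refl x y z ⟩
        y * (x * z)   ≈⟨ *-congˡ xz≈1 ⟩
        y * 1#        ≈⟨ *-identityʳ y ⟩
        y             ∎)
      where
      z = proj₁ (inverse x x≉0)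
      xz≈1 = proj₂ (inverse x x≉0)
      fixed : ∃ λ a → E/F.ι a ≈ y * z
      fixed = φ-fixed (y * z) (*-cancelˡ-nonzero (φ x) (φ-nonzero x≉0) (begin
        φ x * φ (y * z)    ≈⟨ *-congˡ (φ-* y z) ⟩
        φ x * (φ y * φ z)  ≈⟨ solve 3 (λ a b c → a :* (b :* c) := a :* c :* b) refl (φ x) (φ y) (φ z) ⟩
        φ x * φ z * φ y    ≈⟨ *-congʳ (trans (sym (φ-* x z)) (trans (φ-cong xz≈1) φ-1)) ⟩
        1# * φ y           ≈⟨ *-congʳ xz≈1 ⟨
        x * z * φ y        ≈⟨ solve 3 (λ a b c → a :* b :* c := a :* c :* b) refl x z (φ y) ⟩
        x * φ y * z        ≈⟨ *-congʳ (x-y≈0⇒x≈y det≈0) ⟨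
        φ x * y * z        ≈⟨ *-assoc (φ x) y z ⟩
        φ x * (y * z)      ∎))

    det-∝ : ∀ {x y} → y ∝ x → det x y ≈ 0#
    det-∝ {x} {y} (a , eq) = begin
      φ x * y - x * φ y                      ≈⟨ +-cong (*-congˡ eq) (-‿cong (*-congˡ
          (trans (φ-cong eq) (trans (φ-* _ _) (*-congʳ (φ-ι a)))))) ⟩
      φ x * (E/F.ι a * x) - x * (E/F.ι a * φ x)
        ≈⟨ solve 3 (λ a x y → y :* (a :* x) :- x :* (a :* y) := :0) refl (E/F.ι a) x (φ x) ⟩
      0#                                     ∎

    -- The product of three determinants, expanded into the eight monomials with one
    -- factor from each of {y₀, y₁}, {y₂, y₃}, {y₄, y₅}; each is a conjugate of a
    -- component of Φ y.
    module Separating (x₁ x₂ x₃ : Carrier) where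

      private
        a₀ b₀ a₁ b₁ a₂ b₂ : Carrier
        a₀ = φ x₁
        b₀ = x₁
        a₁ = φ^ 3 x₂
        b₁ = φ^ 2 x₂
        a₂ = φ^ 5 x₃
        b₂ = φ^ 4 x₃

        coefficients : Vector Carrier 8
        coefficients = a₀ * a₁ * a₂ ∷ - (a₀ * a₁ * b₂) ∷ - (a₀ * b₁ * a₂) ∷ a₀ * b₁ * b₂
          ∷ - (b₀ * a₁ * a₂) ∷ b₀ * a₁ * b₂ ∷ b₀ * b₁ * a₂ ∷ - (b₀ * b₁ * b₂) ∷ []

        -- Together with `place` this names each monomial as a conjugate of a component: y₅y₀y₂, for
        -- instance, is the image of y₁y₂y₄ under φ⁴, with indices modulo 6.
        twist : Vector ℕ 8
        twist = 0 ∷ 4 ∷ 2 ∷ 0 ∷ 0 ∷ 2 ∷ 4 ∷ 1 ∷ []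

        place : Vector (Fin 3) 8
        place = 2F ∷ 0F ∷ 0F ∷ 1F ∷ 0F ∷ 1F ∷ 1F ∷ 2F ∷ []

        argument : Vec₁₄ → Vector Carrier 8
        argument w j = φ^ (twist j) (component (place j) w)

      -- Linear over F in spite of the powers of φ, because these fix F.
      Λ : Vec₁₄ → Carrier
      Λ w = sum (λ j → coefficients j * argument w j)

      G : Carrier → Carrier
      G y = det x₁ y * φ^ 2 (det x₂ y) * φ^ 4 (det x₃ y)

      Λ-cong : ∀ {v w} → v ≋ w → Λ v ≈ Λ w
      Λ-cong eq = sum-cong-≋ {8} λ j →
        *-congˡ {coefficients j} (φ^-cong (twist j) (component-cong (place j) eq))

      Λ-0 : Λ (λ _ → F.0#) ≈ 0#
      Λ-0 = trans (sum-cong-≋ {8} λ j → trans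
        (*-congˡ {coefficients j} (φ^-zero (twist j) (component-0 (place j)))) (zeroʳ _))
        (sum-replicate-zero 8)

      Λ-+ : ∀ v w → Λ (λ i → v i F.+ w i) ≈ Λ v + Λ w
      Λ-+ v w = trans (sum-cong-≋ {8} λ j → trans
        (*-congˡ {coefficients j} (trans (φ^-cong (twist j) (component-+ (place j) v w)) (φ^-+
          (twist j) _ _)))
        (distribˡ _ _ _))
        (∑-distrib-+ (λ j → coefficients j * argument v j) (λ j → coefficients j * argument w j))

      Λ-* : ∀ a v → Λ (λ i → a F.* v i) ≈ E/F.ι a * Λ v
      Λ-* a v = trans (sum-cong-≋ {8} λ j → trans
        (*-congˡ {coefficients j} (trans (φ^-cong (twist j) (component-* (place j) a v))
          (trans (φ^-* (twist j) _ _) (*-congʳ (φ^-ι (twist j) a)))))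
        (solve 3 (λ x y z → x :* (y :* z) := y :* (x :* z)) refl (coefficients j) (E/F.ι a)
          (argument v j)))
        (sym (*-distribˡ-sum (E/F.ι a) (λ j → coefficients j * argument v j)))

      Λ-Φ : ∀ y → Λ (Φ y) ≈ G y
      Λ-Φ y = trans (sum-cong-≋ {8} λ j → *-congˡ {coefficients j}
          (trans (φ^-cong (twist j) (component-Φ y (place j))) (monomials j)))
        (trans
          (solve 12 (λ a₀ b₀ a₁ b₁ a₂ b₂ y₀ y₁ y₂ y₃ y₄ y₅ →
            a₀ :* a₁ :* a₂ :* (y₀ :* y₂ :* y₄) :+ (:- (a₀ :* a₁ :* b₂) :* (y₅ :* y₀ :* y₂)
            :+ (:- (a₀ :* b₁ :* a₂) :* (y₃ :* y₄ :* y₀) :+ (a₀ :* b₁ :* b₂ :* (y₀ :* y₃ :* y₅)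
            :+ (:- (b₀ :* a₁ :* a₂) :* (y₁ :* y₂ :* y₄) :+ (b₀ :* a₁ :* b₂ :* (y₂ :* y₅ :* y₁)
            :+ (b₀ :* b₁ :* a₂ :* (y₄ :* y₁ :* y₃) :+ (:- (b₀ :* b₁ :* b₂) :*
              (y₁ :* y₃ :* y₅) :+ :0)))))))
            := (a₀ :* y₀ :- b₀ :* y₁) :* (a₁ :* y₂ :- b₁ :* y₃) :* (a₂ :* y₄ :- b₂ :* y₅))
            refl a₀ b₀ a₁ b₁ a₂ b₂ y (φ^ 1 y) (φ^ 2 y) (φ^ 3 y) (φ^ 4 y) (φ^ 5 y))
          (*₃-cong refl (sym (φ^-det 2 x₂)) (sym (φ^-det 4 x₃))))
        where
        reducedMonomials : Vector Carrier 8
        reducedMonomials = y * φ^ 2 y * φ^ 4 y ∷ φ^ 5 y * y * φ^ 2 y ∷ φ^ 3 y * φ^ 4 y * y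
          ∷ y * φ^ 3 y * φ^ 5 y ∷ φ^ 1 y * φ^ 2 y * φ^ 4 y ∷ φ^ 2 y * φ^ 5 y * φ^ 1 y
          ∷ φ^ 4 y * φ^ 1 y * φ^ 3 y ∷ φ^ 1 y * φ^ 3 y * φ^ 5 y ∷ []
        monomials : ∀ j → φ^ (twist j) (χ (place j) y) ≈ reducedMonomials j
        monomials 0F = refl
        monomials 1F = trans (φ^-*₃ 4 _ _ _) (*₃-cong refl (φ⁶ y) (φ^-cong 2 (φ⁶ y)))
        monomials 2F = trans (φ^-*₃ 2 _ _ _) (*-congˡ (φ⁶ y))
        monomials 3F = refl
        monomials 4F = refl
        monomials 5F = trans (φ^-*₃ 2 _ _ _) (*-congˡ (φ^-cong 1 (φ⁶ y)))
        monomials 6F = trans (φ^-*₃ 4 _ _ _) (*₃-cong refl (φ^-cong 1 (φ⁶ y)) (φ^-cong 3 (φ⁶ y)))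
        monomials 7F = φ^-*₃ 1 _ _ _
        φ^-det : ∀ n x → φ^ n (det x y) ≈ φ^ n (φ x) * φ^ n y - φ^ n x * φ^ n (φ y)
        φ^-det n x = trans (φ^-+ n _ _) (+-cong (φ^-* n _ _) (trans (φ^-neg n _) (-‿cong (φ^-* n _ _))))

      G≈0 : ∀ {y} → det x₁ y ≈ 0# ⊎ det x₂ y ≈ 0# ⊎ det x₃ y ≈ 0# → G y ≈ 0#
      G≈0 (inj₁ z)        = trans (*-congʳ (trans (*-congʳ z) (zeroˡ _))) (zeroˡ _)
      G≈0 (inj₂ (inj₁ z)) = trans (*-congʳ (trans (*-congˡ (φ^-zero 2 z)) (zeroʳ _))) (zeroˡ _)
      G≈0 (inj₂ (inj₂ z)) = trans (*-congˡ (φ^-zero 4 z)) (zeroʳ _)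

      G≉0 : ∀ {y} → ¬ det x₁ y ≈ 0# → ¬ det x₂ y ≈ 0# → ¬ det x₃ y ≈ 0# → ¬ G y ≈ 0#
      G≉0 d₁ d₂ d₃ = *-nonzero (*-nonzero d₁ (φ^-nonzero 2 d₂)) (φ^-nonzero 4 d₃)

    module _ (x₁ x₂ x₃ : Carrier) where
      open Separating x₁ x₂ x₃

      Λ-linearCombination : ∀ {m} (a : Vector F.Carrier m) (v : Vector Vec₁₄ m) →
        Λ (linearCombination a v) ≈ sum (λ i → E/F.ι (a i) * Λ (v i))
      Λ-linearCombination {zero}  a v = Λ-0
      Λ-linearCombination {suc m} a v = trans
        (Λ-+ (λ i → a zero F.* v zero i) (linearCombination (a ∘ suc) (v ∘ suc)))
        (+-cong (Λ-* (a zero) (v zero)) (Λ-linearCombination (a ∘ suc) (v ∘ suc)))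

    PairwiseIndependent : ∀ {m} → Vector Carrier m → Set (c ⊔ ℓ)
    PairwiseIndependent x = ∀ i j → i ≢ j → ¬ x i ∝ x j

    independent₄ : (x : Vector Carrier 4) → (∀ i → ¬ x i ≈ 0#) → PairwiseIndependent x →
      ∀ a → linearCombination a (Φ ∘ x) ≋ (λ _ → F.0#) → ∀ i → a i F.≈ F.0#
    independent₄ x x≉0 independent a relation i = E/F.ι-injective (trans
      (*-zero-cancelˡ (G≉0 (separated 0F) (separated 1F) (separated 2F)) (begin
        G (x i) * E/F.ι (a i)           ≈⟨ *-comm _ _ ⟩
        E/F.ι (a i) * G (x i)           ≈⟨ *-congˡ (Λ-Φ (x i)) ⟨
        term i                          ≈⟨ +-identityʳ _ ⟨
        term i + 0#                     ≈⟨ +-congˡ (trans (sum-cong-≋ {3} others)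
          (sum-replicate-zero 3)) ⟨
        term i + sum (removeAt term i)  ≈⟨ sum-remove {i = i} term ⟨
        sum term                        ≈⟨ Λ-linearCombination x₁ x₂ x₃ a (Φ ∘ x) ⟨
        Λ (linearCombination a (Φ ∘ x)) ≈⟨ Λ-cong relation ⟩
        Λ (λ _ → F.0#)                  ≈⟨ Λ-0 ⟩
        0#                              ∎))
      (sym E/F.ι-0))
      where
      -- The form built from the three other elements kills every term of the relation except the
      -- i-th.
      x₁ = x (punchIn i 0F)
      x₂ = x (punchIn i 1F)
      x₃ = x (punchIn i 2F)
      open Separating x₁ x₂ x₃
      term : Vector Carrier 4
      term j = E/F.ι (a j) * Λ (Φ (x j))
      separated : ∀ j → ¬ det (x (punchIn i j)) (x i) ≈ 0#
      separated j det≈0 = independent i (punchIn i j) (Fin.punchInᵢ≢i i j ∘ ≡.sym)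
        (det≈0⇒∝ (x≉0 (punchIn i j)) det≈0)
      self : ∀ y → det y y ≈ 0#
      self y = trans (+-congˡ (-‿cong (*-comm y (φ y)))) (-‿inverseʳ _)
      vanishes : ∀ j → let y = x (punchIn i j) in
        det x₁ y ≈ 0# ⊎ det x₂ y ≈ 0# ⊎ det x₃ y ≈ 0#
      vanishes 0F = inj₁ (self x₁)
      vanishes 1F = inj₂ (inj₁ (self x₂))
      vanishes 2F = inj₂ (inj₂ (self x₃))
      others : ∀ j → term (punchIn i j) ≈ 0#
      others j = trans (*-congˡ (trans (Λ-Φ _) (G≈0 (vanishes j)))) (zeroʳ _)

    -- The form with all three elements equal to y vanishes at Φ y, hence at its multiple Φ x; but
    -- its value there is a product of conjugates of the single determinant of y and x.
    Φ-∝ : ∀ {x y a} → ¬ y ≈ 0# → Φ x ≋ (λ i → a F.* Φ y i) → x ∝ y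
    Φ-∝ {x} {y} {a} y≉0 eq = det≈0⇒∝ y≉0 (decidable-stable (det y x ≟ 0#) λ det≉0 →
      G≉0 det≉0 det≉0 det≉0 (begin
        G x                         ≈⟨ Λ-Φ x ⟨
        Λ (Φ x)                     ≈⟨ Λ-cong eq ⟩
        Λ (λ i → a F.* Φ y i)       ≈⟨ Λ-* a (Φ y) ⟩
        E/F.ι a * Λ (Φ y)           ≈⟨ *-congˡ (trans (Λ-Φ y) (G≈0 (inj₁ self))) ⟩
        E/F.ι a * 0#                ≈⟨ zeroʳ _ ⟩
        0#                          ∎))
      where
      open Separating y y y
      self : det y y ≈ 0#
      self = trans (+-congˡ (-‿cong (*-comm y (φ y)))) (-‿inverseʳ _)

  -- The point set X, its planes and its solids

  private
    module FP = FieldProperties F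
    _≈0? : ∀ a → Dec (a F.≈ F.0#)
    a ≈0? = FiniteField._≟_ F order a F.0#

  X : PointSet
  X .Contains P = ∃ λ x → ¬ x ≈ 0# × ∃ λ a → ¬ a F.≈ F.0# × vec P ≋ (λ i → a F.* Φ x i)
  X .respects {P} {Q} (s , s≉0 , P≈sQ) (x , x≉0 , a , a≉0 , P≈aΦ)
    = x , x≉0 , t F.* a , FP.*-nonzero t≉0 a≉0 , λ i → begin
      vec Q i                 ≈⟨ F.*-identityˡ _ ⟨
      F.1# F.* vec Q i        ≈⟨ F.*-congʳ st≈1 ⟨
      s F.* t F.* vec Q i     ≈⟨ solve 3 (λ s t v → s :* t :* v := t :* (s :* v)) F.refl s t (vec Q i) ⟩
      t F.* (s F.* vec Q i)   ≈⟨ F.*-congˡ (F.trans (F.sym (P≈sQ i)) (P≈aΦ i)) ⟩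
      t F.* (a F.* Φ x i)     ≈⟨ F.*-assoc _ _ _ ⟨
      t F.* a F.* Φ x i       ∎
    where
    open SetoidReasoning F.setoid
    open IntegerSolver F.commutativeRing using (solve; _:=_; _:*_)
    t = proj₁ (F.inverse s s≉0)
    st≈1 = proj₂ (F.inverse s s≉0)
    t≉0 : ¬ t F.≈ F.0#
    t≉0 = FP.unit-nonzero (F.trans (F.*-comm t s) st≈1)

  point : ∀ x → ¬ x ≈ 0# → Point
  point x x≉0 = record { vec = Φ x ; nonzero = Φ-nonzero x≉0 }

  point∈X : ∀ x (x≉0 : ¬ x ≈ 0#) → Contains X (point x x≉0)
  point∈X x x≉0 = x , x≉0 , F.1# , FP.1≉0 , λ i → F.sym (F.*-identityˡ _)

  -- With its converse `∝⇒~` this identifies the points of X with those of PG(5,q), so that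
  -- distinctness can be tested on parameters.
  ~⇒∝ : ∀ {P Q} (p : Contains X P) (r : Contains X Q) → P ~ Q → proj₁ p ∝ proj₁ r
  ~⇒∝ {P} {Q} (x , x≉0 , a , a≉0 , P≈aΦx) (y , y≉0 , b , b≉0 , Q≈bΦy) (s , s≉0 , P≈sQ) =
    Φ-∝ {a = t F.* (s F.* b)} y≉0 λ i → FP.*-cancelˡ-nonzero a a≉0 (begin
      a F.* Φ x i                   ≈⟨ P≈aΦx i ⟨
      vec P i                       ≈⟨ P≈sQ i ⟩
      s F.* vec Q i                 ≈⟨ F.*-congˡ (Q≈bΦy i) ⟩
      s F.* (b F.* Φ y i)           ≈⟨ F.*-identityˡ _ ⟨
      F.1# F.* (s F.* (b F.* Φ y i)) ≈⟨ F.*-congʳ at≈1 ⟨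
      a F.* t F.* (s F.* (b F.* Φ y i))
        ≈⟨ solve 5 (λ a t s b v → a :* t :* (s :* (b :* v)) := a :* (t :* (s :* b) :* v))
             F.refl a t s b (Φ y i) ⟩
      a F.* (t F.* (s F.* b) F.* Φ y i) ∎)
    where
    open SetoidReasoning F.setoid
    open IntegerSolver F.commutativeRing using (solve; _:=_; _:*_)
    t = proj₁ (F.inverse a a≉0)
    at≈1 = proj₂ (F.inverse a a≉0)

  ∝-nonzero : ∀ {x y} → ¬ x ≈ 0# → ((a , _) : x ∝ y) → ¬ a F.≈ F.0#
  ∝-nonzero x≉0 (a , x≈ay) a≈0 =
    x≉0 (trans x≈ay (trans (*-congʳ (trans (E/F.ι-cong a≈0) E/F.ι-0)) (zeroˡ _)))

  ∝⇒~ : ∀ {P Q} (p : Contains X P) (r : Contains X Q) → proj₁ p ∝ proj₁ r → P ~ Q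
  ∝⇒~ {P} {Q} (x , x≉0 , a , a≉0 , P≈aΦx) (y , y≉0 , b , b≉0 , Q≈bΦy) x∝y@(s , x≈sy) =
    a F.* s³ F.* t , FP.*-nonzero (FP.*-nonzero a≉0 s³≉0) t≉0 , λ i → begin
      vec P i                            ≈⟨ P≈aΦx i ⟩
      a F.* Φ x i                        ≈⟨ F.*-congˡ (F.trans (Φ-cong x≈sy i) (Φ-ι* s y i)) ⟩
      a F.* (s³ F.* Φ y i)               ≈⟨ F.*-identityˡ _ ⟨
      F.1# F.* (a F.* (s³ F.* Φ y i))    ≈⟨ F.*-congʳ bt≈1 ⟨
      b F.* t F.* (a F.* (s³ F.* Φ y i))
        ≈⟨ solve 5 (λ a b s t v → b :* t :* (a :* (s :* v)) := a :* s :* t :* (b :* v))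
             F.refl a b s³ t (Φ y i) ⟩
      a F.* s³ F.* t F.* (b F.* Φ y i)   ≈⟨ F.*-congˡ (Q≈bΦy i) ⟨
      a F.* s³ F.* t F.* vec Q i         ∎
    where
    open SetoidReasoning F.setoid
    open IntegerSolver F.commutativeRing using (solve; _:=_; _:*_)
    s³ = s F.* s F.* s
    s≉0 : ¬ s F.≈ F.0#
    s≉0 = ∝-nonzero x≉0 x∝y
    s³≉0 : ¬ s³ F.≈ F.0#
    s³≉0 = FP.*-nonzero (FP.*-nonzero s≉0 s≉0) s≉0
    t = proj₁ (F.inverse b b≉0)
    bt≈1 = proj₂ (F.inverse b b≉0)
    t≉0 : ¬ t F.≈ F.0#
    t≉0 = FP.unit-nonzero (F.trans (F.*-comm t b) bt≈1)

  open LinearAlgebra F _≈0? using (dependent)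

  -- Four points on a plane are four vectors in a span of three, hence dependent. Each point is a
  -- nonzero multiple of some Φ x, and absorbing these multiples into the coefficients contradicts
  -- `independent₄`.
  atMost : ∀ W → HasDimension W 2 → ∀ m → DistinctPoints X W m → m ℕ.≤ 3
  atMost W (b , basis) m (f , f-injective , f∈) = ℕ.≮⇒≥ λ 4≤m → impossible 4≤m
    where
    impossible : ¬ 4 ℕ.≤ m
    impossible 4≤m = FP.*-nonzero aₖ≉0 (proj₁ (proj₂ (scale k)))
      (independent₄ x (λ i → proj₁ (proj₂ (inX i))) pairwise (λ i → a i F.* s i) vanishes k)
      where
      g : Fin 4 → Fin m
      g i = inject≤ i 4≤m
      inX : ∀ i → Contains X (f (g i))
      inX i = proj₁ (f∈ (g i))
      x : Vector Carrier 4
      x i = proj₁ (inX i)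
      scale : ∀ i → ∃ λ s → ¬ s F.≈ F.0# × vec (f (g i)) ≋ (λ j → s F.* Φ (x i) j)
      scale i = proj₂ (proj₂ (inX i))
      s : Vector F.Carrier 4
      s i = proj₁ (scale i)
      pairwise : PairwiseIndependent x
      pairwise i j i≢j x∝ = i≢j (Fin.inject≤-injective 4≤m 4≤m i j
        (f-injective (∝⇒~ {f (g i)} {f (g j)} (inX i) (inX j) x∝)))
      combination : ∀ i → ∃ λ (k : Vector F.Carrier 3) → vec (f (g i)) ≋ linearCombination k b
      combination i = IsBasis.spanning basis (vec (f (g i))) (proj₂ (f∈ (g i)))
      relation = dependent 3 (λ i → proj₁ (combination i))
      a = proj₁ relation
      k = proj₁ (proj₁ (proj₂ relation))
      aₖ≉0 = proj₂ (proj₁ (proj₂ relation))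
      vanishes : linearCombination (λ i → a i F.* s i) (Φ ∘ x) ≋ (λ _ → F.0#)
      vanishes j = F.trans (F.sym (lc-scaled a s (Φ ∘ x) j)) (F.trans
        (lc-congʳ a (λ i j → F.trans (F.sym (proj₂ (proj₂ (scale i)) j)) (proj₂ (combination i) j)) j)
        (lc-lc a (λ i → proj₁ (combination i)) b (proj₂ (proj₂ relation)) j))

  -- The last four points are independent and span a solid. A nontrivial relation must therefore
  -- involve the first point, which then lies in that solid too.
  attained-by : (x : Vector Carrier 5) → (∀ i → ¬ x i ≈ 0#) → PairwiseIndependent x →
    (a : Vector F.Carrier 5) → (∃ λ i → ¬ a i F.≈ F.0#) →
    linearCombination a (Φ ∘ x) ≋ (λ _ → F.0#) →
    ∃ λ W → HasDimension W 3 × DistinctPoints X W 5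
  attained-by x x≉0 pairwise a (k , aₖ≉0) relation =
    W , (b , record
      { members     = span-generators b
      ; independent = independent
      ; spanning    = λ _ w → w }) ,
    (λ i → point (x i) (x≉0 i)) ,
    (λ {i} {j} eq → decidable-stable (i Fin.≟ j) λ i≢j → pairwise i j i≢j
      (~⇒∝ {point (x i) (x≉0 i)} {point (x j) (x≉0 j)}
        (point∈X (x i) (x≉0 i)) (point∈X (x j) (x≉0 j)) eq)) ,
    λ i → point∈X (x i) (x≉0 i) , member i
    where
    b : Vector Vec₁₄ 4
    b = Φ ∘ x ∘ suc
    W = span b
    independent : ∀ a → linearCombination a b ≋ (λ _ → F.0#) → ∀ i → a i F.≈ F.0#
    independent = independent₄ (x ∘ suc) (x≉0 ∘ suc)
      (λ i j i≢j → pairwise (suc i) (suc j) (i≢j ∘ Fin.suc-injective))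
    a₀≉0 : ¬ a zero F.≈ F.0#
    a₀≉0 a₀≈0 = aₖ≉0 (all k)
      where
      all : ∀ i → a i F.≈ F.0#
      all zero    = a₀≈0
      all (suc i) = independent (a ∘ suc) (λ j → F.trans (F.sym (F.trans
        (F.+-congʳ (F.trans (F.*-congʳ a₀≈0) (F.zeroˡ _))) (F.+-identityˡ _))) (relation j)) i
    t = proj₁ (F.inverse (a zero) a₀≉0)
    a₀t≈1 = proj₂ (F.inverse (a zero) a₀≉0)
    member : ∀ i → Member W (Φ (x i))
    member (suc i) = span-generators b i
    member zero = (λ i → F.- t F.* a (suc i)) , λ j → F.sym (begin
      linearCombination (λ i → F.- t F.* a (suc i)) b j ≈⟨ lc-* (F.- t) (a ∘ suc) b j ⟩
      F.- t F.* s j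
        ≈⟨ solve 4 (λ t s a v → :- t :* s := a :* t :* v :- t :* (a :* v :+ s))
             F.refl t (s j) (a zero) (Φ (x zero) j) ⟩
      a zero F.* t F.* Φ (x zero) j F.- t F.* (a zero F.* Φ (x zero) j F.+ s j)
        ≈⟨ F.+-cong (F.*-congʳ a₀t≈1) (F.-‿cong (F.*-congˡ (relation j))) ⟩
      F.1# F.* Φ (x zero) j F.- t F.* F.0#
        ≈⟨ solve 2 (λ t v → :1 :* v :- t :* :0 := v) F.refl t (Φ (x zero) j) ⟩
      Φ (x zero) j ∎)
      where
      open SetoidReasoning F.setoid
      open IntegerSolver F.commutativeRing using (solve; _:=_; _:+_; _:*_; _:-_; :-_; :0; :1)
      s = linearCombination (a ∘ suc) b

  -- The group action and transitivity

  opaque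
    -- Diagonal in the components. The third factor χ₂(g) is fixed by φ², so the product remains in
    -- K and can be encoded.
    act : Carrier → Vec₁₄ → Vec₁₄
    act g w = encode (λ k → χ k g * component k w)
      (trans (φ^-* 2 _ _) (*-cong (φ²-χ₂ g) (φ²-component₂ w)))

    component-act : ∀ g w k → component k (act g w) ≈ χ k g * component k w
    component-act g w = component-encode (λ k → χ k g * component k w) _

  act-cong : ∀ g {v w} → v ≋ w → act g v ≋ act g w
  act-cong g {v} {w} eq = component-injective λ k →
    trans (component-act g v k) (trans (*-congˡ (component-cong k eq)) (sym (component-act g w k)))

  act-+ : ∀ g v w → act g (λ i → v i F.+ w i) ≋ (λ i → act g v i F.+ act g w i)
  act-+ g v w = component-injective λ k →
    trans (component-act g _ k) (trans (*-congˡ (component-+ k v w)) (trans (distribˡ _ _ _)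
      (sym (trans (component-+ k (act g v) (act g w)) (+-cong (component-act g v k)
        (component-act g w k))))))

  act-* : ∀ g a v → act g (λ i → a F.* v i) ≋ (λ i → a F.* act g v i)
  act-* g a v = component-injective λ k →
    trans (component-act g _ k) (trans (*-congˡ (component-* k a v))
      (trans (sym (*-assoc _ _ _)) (trans (*-congʳ (*-comm _ _)) (trans (*-assoc _ _ _)
        (sym (trans (component-* k a (act g v)) (*-congˡ (component-act g v k))))))))

  act-inverse : ∀ {g h} → g * h ≈ 1# → ∀ w → act g (act h w) ≋ w
  act-inverse {g} {h} gh≈1 w = component-injective λ k →
    trans (component-act g (act h w) k) (trans (*-congˡ (component-act h w k))
      (trans (sym (*-assoc _ _ _)) (trans (*-congʳ (trans (sym (χ-* k g h)) (trans (χ-cong k gh≈1)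
        (χ-1 k))))
        (*-identityˡ _))))
    where
    χ-1 : ∀ k → χ k 1# ≈ 1#
    χ-1 k = trans (χ-cong k (sym E/F.ι-1)) (trans (χ-ι k F.1#)
      (trans (E/F.ι-cong (F.trans (F.*-identityʳ _) (F.*-identityʳ _))) E/F.ι-1))

  act-Φ : ∀ g x → act g (Φ x) ≋ Φ (g * x)
  act-Φ g x = component-injective λ k → trans (component-act g (Φ x) k)
    (trans (*-congˡ (component-Φ x k)) (sym (trans (component-Φ (g * x) k) (χ-* k g x))))

  projectivity : ∀ {g h} → g * h ≈ 1# → Projectivity
  projectivity {g} {h} gh≈1 = record
    { map = act g
    ; isIsomorphism = record
      { isLeftModuleMonomorphism = record
        { isLeftModuleHomomorphism = record
          { +ᴹ-isGroupHomomorphism = record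
            { isMonoidHomomorphism = record
              { isMagmaHomomorphism = record
                { isRelHomomorphism = record { cong = act-cong g }
                ; homo = act-+ g
                }
              ; ε-homo = act-0
              }
            ; ⁻¹-homo = λ v i → GroupProperties.inverseˡ-unique F.+-group _ _
                (F.trans (F.sym (act-+ g (λ j → F.- v j) v i))
                  (F.trans (act-cong g (λ j → F.-‿inverseˡ (v j)) i) (act-0 i)))
            }
          ; *ₗ-homo = act-* g
          }
        ; injective = λ {v} {w} eq i → F.trans (F.sym (act-inverse hg≈1 v i))
            (F.trans (act-cong h eq i) (act-inverse hg≈1 w i))
        }
      ; surjective = λ w → act h w , λ eq i → F.trans (act-cong g eq i) (act-inverse gh≈1 w i)
      }
    }
    where
    hg≈1 : h * g ≈ 1#
    hg≈1 = trans (*-comm h g) gh≈1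
    act-0 : act g (λ _ → F.0#) ≋ (λ _ → F.0#)
    act-0 i = F.trans (act-cong g (λ j → F.sym (F.zeroˡ F.0#)) i)
      (F.trans (act-* g F.0# (λ _ → F.0#) i) (F.zeroˡ _))

  act-∈X : ∀ {g} → ¬ g ≈ 0# → ∀ {P Q} → vec Q ≋ act g (vec P) → Contains X P → Contains X Q
  act-∈X {g} g≉0 eq (x , x≉0 , a , a≉0 , P≈aΦ) = g * x , *-nonzero g≉0 x≉0 , a , a≉0 , λ i →
    F.trans (eq i) (F.trans (act-cong g P≈aΦ i) (F.trans (act-* g a (Φ x) i) (F.*-congˡ (act-Φ g x i))))

  transitive : IsTransitive X
  transitive P Q p@(x , x≉0 , a , a≉0 , P≈aΦx) r@(y , y≉0 , b , b≉0 , Q≈bΦy) =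
    projectivity gh≈1 ,
    (λ R → mk⇔ (act-∈X g≉0 {R} {apply (projectivity gh≈1) R} (λ i → F.refl))
      (act-∈X h≉0 {apply (projectivity gh≈1) R} {R} (λ i → F.sym (act-inverse hg≈1 (vec R) i)))) ,
    ∝⇒~ {apply (projectivity gh≈1) P} {Q} (act-∈X g≉0 {P} {apply (projectivity gh≈1) P} (λ i →
      F.refl) p) r
      (F.1# , trans (trans (*-assoc y _ x) (trans (*-congˡ (trans (*-comm _ x) (proj₂
        (inverse x x≉0)))) (*-identityʳ y)))
        (sym (trans (*-congʳ E/F.ι-1) (*-identityˡ y))))
    where
    x⁻¹ = proj₁ (inverse x x≉0)
    y⁻¹ = proj₁ (inverse y y≉0)
    g = y * x⁻¹
    h = x * y⁻¹
    gh≈1 : g * h ≈ 1#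
    gh≈1 = begin
      y * x⁻¹ * (x * y⁻¹)
        ≈⟨ solve 4 (λ y x⁻¹ x y⁻¹ → y :* x⁻¹ :* (x :* y⁻¹) := x :* x⁻¹ :* (y :* y⁻¹)) refl y x⁻¹ x y⁻¹ ⟩
      x * x⁻¹ * (y * y⁻¹) ≈⟨ *-cong (proj₂ (inverse x x≉0)) (proj₂ (inverse y y≉0)) ⟩
      1# * 1#             ≈⟨ *-identityʳ 1# ⟩
      1#                  ∎
      where
      open SetoidReasoning setoid
      open IntegerSolver commutativeRing using (solve; _:=_; _:*_)
    hg≈1 : h * g ≈ 1#
    hg≈1 = trans (*-comm h g) gh≈1
    g≉0 : ¬ g ≈ 0#
    g≉0 = unit-nonzero gh≈1
    h≉0 : ¬ h ≈ 0#
    h≉0 = unit-nonzero hg≈1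

  -- X spans the space

  module _ where
    open IntegerSolver commutativeRing using (solve; _:=_; _:+_; _:*_; _:-_; :-_; :0; :1)
    open SetoidReasoning setoid
    open Exp commutativeSemiring
    open SemiringSum semiring using (sum; sum-cong-≋; ∑-comm; *-distribˡ-sum; *-distribʳ-sum)
    open LinearAlgebra (Extension.field′ L) (_≟ 0#) using (sum-zero)

    private
      open FiniteField (Extension.field′ L) orderE using (∑; element)
      open PowerSums (Extension.field′ L) using (powerSum; powerSum-≡; powerSum-≢)
      open Digits q (1<order F order)

      factor : Bool → Carrier → Carrier
      factor false x = 1#
      factor true  x = x

    -- The product of the conjugates selected by T; each recursive step moves on to the next
    -- conjugate by replacing x with φ x.
    monomial : ∀ {n} → Vec Bool n → Carrier → Carrier
    monomial Vec.[]      x = 1#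
    monomial (b Vec.∷ T) x = factor b x * monomial T (φ x)

    monomial-power : ∀ {n} (T : Vec Bool n) x → monomial T x ≈ x ^ value T
    monomial-power Vec.[]      x = refl
    monomial-power (b Vec.∷ T) x = begin
      factor b x * monomial T (φ x)      ≈⟨ *-cong (factor-power b) (monomial-power T (φ x)) ⟩
      x ^ bit b * (x ^ q) ^ value T      ≈⟨ *-congˡ (^-assocʳ x q (value T)) ⟩
      x ^ bit b * x ^ (q ℕ.* value T)    ≈⟨ ^-homo-* x (bit b) (q ℕ.* value T) ⟨
      x ^ (bit b ℕ.+ q ℕ.* value T)      ∎
      where
      factor-power : ∀ b → factor b x ≈ x ^ bit b
      factor-power false = refl
      factor-power true  = sym (*-identityʳ x)

    reciprocal : Carrier → Carrier
    reciprocal x = x ^ (q ℕ.^ 6 ℕ.∸ 2)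

    -- The orthogonality pairing of two characters. For a nonempty T paired with itself it counts
    -- the q⁶ - 1 units, which is -1 in the field.
    pairing : Vec Bool 6 → Vec Bool 6 → Carrier
    pairing T U = ∑ (λ x → monomial T (reciprocal x) * monomial U x)

    pairing-power : ∀ T U → pairing T U ≈ powerSum orderE (value U) (value T)
    pairing-power T U = sum-cong-≋ {q ℕ.^ 6} λ i → *-cong
      (trans (monomial-power T (reciprocal (element i)))
        (power-comm (element i) (q ℕ.^ 6 ℕ.∸ 2) (value T)))
      (monomial-power U (element i))
      where
      power-comm : ∀ x m n → (x ^ m) ^ n ≈ (x ^ n) ^ m
      power-comm x m n = trans (^-assocʳ x m n) (trans (^-congʳ x (ℕ.*-comm m n)) (sym (^-assocʳ x n m)))

    pairing-≡ : ∀ T → T ≢ Vec.replicate 6 false → pairing T T ≈ - 1#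
    pairing-≡ T T≢0 = trans (pairing-power T T) (powerSum-≡ orderE (value-positive T T≢0))

    pairing-≢ : ∀ T U → T ≢ Vec.replicate 6 false → U ≢ Vec.replicate 6 false → T ≢ U →
      pairing T U ≈ 0#
    pairing-≢ T U T≢0 U≢0 T≢U = trans (pairing-power T U)
      (powerSum-≢ orderE (value-positive U U≢0) (value-positive T T≢0) (value< U) (value< T)
        (T≢U ∘ ≡.sym ∘ value-injective U T))

    rotate : Vec Bool 6 → Vec Bool 6
    rotate (b₀ Vec.∷ b₁ Vec.∷ b₂ Vec.∷ b₃ Vec.∷ b₄ Vec.∷ b₅ Vec.∷ Vec.[]) =
      b₅ Vec.∷ b₀ Vec.∷ b₁ Vec.∷ b₂ Vec.∷ b₃ Vec.∷ b₄ Vec.∷ Vec.[]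

    rotate^ : ℕ → Vec Bool 6 → Vec Bool 6
    rotate^ zero    T = T
    rotate^ (suc n) T = rotate (rotate^ n T)

    rotate^-zero : ∀ n T → rotate^ n T ≡ Vec.replicate 6 false → T ≡ Vec.replicate 6 false
    rotate^-zero zero    T eq = eq
    rotate^-zero (suc n) T eq = rotate^-zero n T (rotate-zero (rotate^ n T) eq)
      where
      rotate-zero : ∀ T → rotate T ≡ Vec.replicate 6 false → T ≡ Vec.replicate 6 false
      rotate-zero (_ Vec.∷ _ Vec.∷ _ Vec.∷ _ Vec.∷ _ Vec.∷ _ Vec.∷ Vec.[]) ≡.refl = ≡.refl

    -- φ moves every conjugate one place on, and φ⁶ = 1 brings the last one back to the front.
    φ^-monomial : ∀ n T x → φ^ n (monomial T x) ≈ monomial (rotate^ n T) x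
    φ^-monomial zero    T x = refl
    φ^-monomial (suc n) T x = trans (φ-cong (φ^-monomial n T x)) (φ-monomial (rotate^ n T) x)
      where
      f = factor
      f-cong : ∀ b {x y} → x ≈ y → f b x ≈ f b y
      f-cong false _  = refl
      f-cong true  eq = eq
      step : ∀ b x {y z} → φ y ≈ z → φ (f b x * y) ≈ f b (φ x) * z
      step false x eq = trans (φ-* _ _) (*-cong φ-1 eq)
      step true  x eq = trans (φ-* _ _) (*-congˡ eq)
      φ-monomial : ∀ T x → φ (monomial T x) ≈ monomial (rotate T) x
      φ-monomial (b₀ Vec.∷ b₁ Vec.∷ b₂ Vec.∷ b₃ Vec.∷ b₄ Vec.∷ b₅ Vec.∷ Vec.[]) x = trans
        (step b₀ x (step b₁ (φ x) (step b₂ (φ^ 2 x) (step b₃ (φ^ 3 x) (step b₄ (φ^ 4 x)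
          (step b₅ (φ^ 5 x) φ-1))))))
        (trans
          (solve 6 (λ y₀ y₁ y₂ y₃ y₄ y₅ → y₀ :* (y₁ :* (y₂ :* (y₃ :* (y₄ :* (y₅ :* :1)))))
              := y₅ :* (y₀ :* (y₁ :* (y₂ :* (y₃ :* (y₄ :* :1))))))
            refl (f b₀ (φ x)) (f b₁ (φ^ 2 x)) (f b₂ (φ^ 3 x)) (f b₃ (φ^ 4 x)) (f b₄ (φ^ 5 x)) (f b₅
              (φ^ 6 x)))
          (*-congʳ (f-cong b₅ (φ⁶ x))))

    -- On the field fixed by φᵐ this is the trace to F; it is applied with m = 6 for the first two
    -- components and m = 2 for the third.
    trace : ℕ → Carrier → Carrier
    trace m y = sum {m} (λ n → φ^ (toℕ n) y)

    -- Applying φ shifts the summands by one, and the term φᵐ y that enters equals the term y that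
    -- leaves.
    φ-trace : ∀ m {y} → φ^ m y ≈ y → φ (trace m y) ≈ trace m y
    φ-trace m {y} fixed = GroupProperties.∙-cancelʳ +-group y _ _ (trans (+-congʳ (φ-sum m (λ n → φ^
      (toℕ n) y)))
      (trans (shift m (λ n → φ^ n y)) (+-congˡ fixed)))
      where
      φ-sum : ∀ m (f : Vector Carrier m) → φ (sum f) ≈ sum (λ n → φ (f n))
      φ-sum zero    f = φ-0
      φ-sum (suc m) f = trans (φ-+ _ _) (+-congˡ (φ-sum m (f ∘ suc)))
      shift : ∀ m (g : ℕ → Carrier) →
        sum {m} (λ n → g (suc (toℕ n))) + g 0 ≈ sum {m} (λ n → g (toℕ n)) + g m
      shift zero    g = refl
      shift (suc m) g = trans (solve 3 (λ x s y → x :+ s :+ y := y :+ (s :+ x)) refl (g 1) _ (g 0))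
        (trans (+-congˡ (shift m (g ∘ suc))) (sym (+-assoc _ _ _)))

    -- The trace of a multiple of a character is a combination of its rotations, so the sum over all
    -- x breaks up into pairings.
    ∑-trace : ∀ m a T U → ∑ (λ x → trace m (a * monomial T (reciprocal x)) * monomial U x) ≈
      sum {m} (λ n → φ^ (toℕ n) a * pairing (rotate^ (toℕ n) T) U)
    ∑-trace m a T U = begin
      ∑ (λ x → trace m (a * monomial T (reciprocal x)) * monomial U x)
        ≈⟨ sum-cong-≋ {q ℕ.^ 6} (λ i → trans
             (*-distribʳ-sum {m} (monomial U (element i)) (λ n → φ^ (toℕ n) (a * monomial T
               (reciprocal (element i)))))
             (sum-cong-≋ {m} (λ n → trans (*-congʳ (trans (φ^-* (toℕ n) _ _) (*-congˡ (φ^-monomial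
               (toℕ n) T _))))
               (*-assoc _ _ _)))) ⟩
      ∑ (λ x → sum {m} (λ n → term n x))
        ≈⟨ ∑-comm {q ℕ.^ 6} {m} (λ i n → term n (element i)) ⟩
      sum {m} (λ n → ∑ (term n))
        ≈⟨ sum-cong-≋ {m} (λ n → *-distribˡ-sum {q ℕ.^ 6} (φ^ (toℕ n) a)
             (λ i → monomial (rotate^ (toℕ n) T) (reciprocal (element i)) * monomial U (element i))) ⟨
      sum {m} (λ n → φ^ (toℕ n) a * pairing (rotate^ (toℕ n) T) U) ∎
      where
      term : Fin m → Carrier → Carrier
      term n x = φ^ (toℕ n) a * (monomial (rotate^ (toℕ n) T) (reciprocal x) * monomial U x)

    positions : Fin 3 → Vec Bool 6
    positions 0F = false Vec.∷ true  Vec.∷ true  Vec.∷ false Vec.∷ true  Vec.∷ false Vec.∷ Vec.[]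
    positions 1F = true  Vec.∷ false Vec.∷ false Vec.∷ true  Vec.∷ false Vec.∷ true  Vec.∷ Vec.[]
    positions 2F = true  Vec.∷ false Vec.∷ true  Vec.∷ false Vec.∷ true  Vec.∷ false Vec.∷ Vec.[]

    positions≢0 : ∀ k → positions k ≢ Vec.replicate 6 false
    positions≢0 0F ()
    positions≢0 1F ()
    positions≢0 2F ()

    χ-monomial : ∀ k x → χ k x ≈ monomial (positions k) x
    χ-monomial 0F x = solve 3 (λ x y z → x :* y :* z
      := :1 :* (x :* (y :* (:1 :* (z :* (:1 :* :1)))))) refl (φ^ 1 x) (φ^ 2 x) (φ^ 4 x)
    χ-monomial 1F x = solve 3 (λ x y z → x :* y :* z
      := x :* (:1 :* (:1 :* (y :* (:1 :* (z :* :1)))))) refl x (φ^ 3 x) (φ^ 5 x)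
    χ-monomial 2F x = solve 3 (λ x y z → x :* y :* z
      := x :* (:1 :* (y :* (:1 :* (z :* (:1 :* :1)))))) refl x (φ^ 2 x) (φ^ 4 x)

    -- One less than the size of the orbit of a component under conjugation.
    period-1 : Fin 3 → ℕ
    period-1 0F = 5
    period-1 1F = 5
    period-1 2F = 1

    private
      _≟ᵀ_ : (T U : Vec Bool 6) → Dec (T ≡ U)
      _≟ᵀ_ = Vec.≡-dec Bool._≟_

    -- Evaluation shows that the three subsets lie in different rotation orbits, which makes all
    -- pairings between different components vanish.
    orbits-distinct : ∀ j k → j ≢ k → (n : Fin (suc (period-1 j))) → rotate^ (toℕ n)
      (positions j) ≢ positions k
    orbits-distinct = from-yes (Fin.all? λ j → Fin.all? λ k → ¬? (j Fin.≟ k) →-dec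
      Fin.all? λ (n : Fin (suc (period-1 j))) → ¬? (rotate^ (toℕ n) (positions j) ≟ᵀ positions k))

    -- No proper part of a period returns to the start, so exactly one summand of the trace survives
    -- in the component itself.
    orbit-regular : ∀ j (n : Fin (period-1 j)) → rotate^ (suc (toℕ n)) (positions j) ≢ positions j
    orbit-regular = from-yes (Fin.all? λ j → Fin.all? λ (n : Fin (period-1 j)) →
      ¬? (rotate^ (suc (toℕ n)) (positions j) ≟ᵀ positions j))

    component-lc : ∀ k {m} a (v : Vector Vec₁₄ m) →
      component k (linearCombination a v) ≈ sum (λ i → E/F.ι (a i) * component k (v i))
    component-lc k {zero}  a v = component-0 k
    component-lc k {suc m} a v = trans
      (component-+ k (λ i → a zero F.* v zero i) (linearCombination (a ∘ suc) (v ∘ suc)))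
      (+-cong (component-* k (a zero) (v zero)) (component-lc k (a ∘ suc) (v ∘ suc)))

    module _ (W : Subspace) (X⊆W : ∀ P → Contains X P → P liesOn W) where

      -- Since Φ maps 0 to the zero vector, the sums below may run over the whole field and not only
      -- over units.
      Φ-member : ∀ x → Member W (Φ x)
      Φ-member x = byCases (x ≟ 0#)
        where
        byCases : Dec (x ≈ 0#) → Member W (Φ x)
        byCases (no  x≉0) = X⊆W (point x x≉0) (point∈X x x≉0)
        byCases (yes x≈0) = ≈-closed W (λ i → F.sym (F.trans (Φ-cong (trans x≈0 (sym (zeroʳ _))) i)
          (F.trans (Φ-ι* F.0# 0# i) (F.trans (F.*-congʳ (F.zeroʳ _)) (F.zeroˡ _))))) (0-closed W)

      lc-member : ∀ {m} a (v : Vector Vec₁₄ m) → (∀ i → Member W (v i)) → Member W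
        (linearCombination a v)
      lc-member {zero}  a v v∈W = 0-closed W
      lc-member {suc m} a v v∈W =
        +-closed W (*ₗ-closed W (a zero) (v∈W zero)) (lc-member (a ∘ suc) (v ∘ suc) (v∈W ∘ suc))

      -- Weights fixed by φ are scalars of F, so a weighted sum of all Φ x stays in W.
      weightedSum : ∀ (w : Carrier → Carrier) → (∀ x → φ (w x) ≈ w x) → ∃ λ v → Member W v ×
        ∀ k → component k v ≈ ∑ (λ x → w x * monomial (positions k) x)
      weightedSum w fixed = linearCombination τ (Φ ∘ element) ,
        lc-member τ (Φ ∘ element) (λ i → Φ-member (element i)) ,
        λ k → trans (component-lc k τ (Φ ∘ element)) (sum-cong-≋ {q ℕ.^ 6} λ i →
          *-cong (proj₂ (scalar i)) (trans (component-Φ (element i) k) (χ-monomial k (element i))))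
        where
        scalar : ∀ i → ∃ λ t → E/F.ι t ≈ w (element i)
        scalar i = φ-fixed (w (element i)) (fixed (element i))
        τ : Vector F.Carrier (q ℕ.^ 6)
        τ i = proj₁ (scalar i)

      -- The weight is the trace of -u times the reciprocal of the character of component j. After
      -- summation the only surviving term is the unrotated one in component j; its pairing is -1,
      -- hence the sign of u.
      singleComponent : ∀ j u → φ^ (suc (period-1 j)) u ≈ u → ∃ λ v → Member W v ×
        component j v ≈ u × ∀ k → j ≢ k → component k v ≈ 0#
      singleComponent j u fixed = proj₁ v , proj₁ (proj₂ v) ,
        trans (proj₂ (proj₂ v) j) (trans (∑-trace m (- u) T T) (begin
          - u * pairing T T + sum {period-1 j} (λ n → φ^ (suc (toℕ n)) (- u) * pairing (rotate^ (suc
            (toℕ n)) T) T)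
            ≈⟨ +-cong (*-congˡ (pairing-≡ T (positions≢0 j)))
                 (sum-zero (period-1 j) _ λ n → trans (*-congˡ {φ^ (suc (toℕ n)) (- u)} (pairing-≢
                   (rotate^ (suc (toℕ n)) T) T
                   (positions≢0 j ∘ rotate^-zero (suc (toℕ n)) T) (positions≢0 j) (orbit-regular j n)))
                   (zeroʳ _)) ⟩
          - u * - 1# + 0# ≈⟨ solve 1 (λ u → :- u :* :- :1 :+ :0 := u) refl u ⟩
          u               ∎)) ,
        λ k j≢k → trans (proj₂ (proj₂ v) k) (trans (∑-trace m (- u) T (positions k))
          (sum-zero m _ λ n → trans (*-congˡ {φ^ (toℕ n) (- u)} (pairing-≢ (rotate^ (toℕ n) T)
            (positions k)
            (positions≢0 j ∘ rotate^-zero (toℕ n) T) (positions≢0 k) (orbits-distinct j k j≢k n)))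
            (zeroʳ _)))
        where
        m = suc (period-1 j)
        T = positions j
        rotation : ∀ j → rotate^ (suc (period-1 j)) (positions j) ≡ positions j
        rotation 0F = ≡.refl
        rotation 1F = ≡.refl
        rotation 2F = ≡.refl
        v = weightedSum (λ x → trace m (- u * monomial T (reciprocal x))) λ x → φ-trace m (trans
          (φ^-* m _ _)
          (*-cong (trans (φ^-neg m u) (-‿cong fixed)) (trans (φ^-monomial m T (reciprocal x))
            (reflexive (≡.cong (λ T → monomial T (reciprocal x)) (rotation j))))))

      spanning : ∀ v → Member W v
      spanning v = ≈-closed W (component-injective λ k → trans (component-+ k _ (part 2F))
          (trans (+-congʳ (component-+ k (part 0F) (part 1F))) (sumOfParts k)))
        (+-closed W (+-closed W (member 0F) (member 1F)) (member 2F))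
        where
        fixed : ∀ j → φ^ (suc (period-1 j)) (component j v) ≈ component j v
        fixed 0F = φ⁶ _
        fixed 1F = φ⁶ _
        fixed 2F = φ²-component₂ v
        part : Fin 3 → Vec₁₄
        part j = proj₁ (singleComponent j (component j v) (fixed j))
        member : ∀ j → Member W (part j)
        member j = proj₁ (proj₂ (singleComponent j (component j v) (fixed j)))
        same : ∀ j → component j (part j) ≈ component j v
        same j = proj₁ (proj₂ (proj₂ (singleComponent j (component j v) (fixed j))))
        other : ∀ j k → j ≢ k → component k (part j) ≈ 0#
        other j = proj₂ (proj₂ (proj₂ (singleComponent j (component j v) (fixed j))))
        sumOfParts : ∀ k → component k (part 0F) + component k (part 1F) + component k
          (part 2F) ≈ component k v
        sumOfParts 0F = trans (+-cong (+-cong (same 0F) (other 1F 0F λ ())) (other 2F 0F λ ()))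
          (trans (+-identityʳ _) (+-identityʳ _))
        sumOfParts 1F = trans (+-cong (+-cong (other 0F 1F λ ()) (same 1F)) (other 2F 1F λ ()))
          (trans (+-identityʳ _) (+-identityˡ _))
        sumOfParts 2F = trans (+-cong (+-cong (other 0F 2F λ ()) (other 1F 2F λ ())) (same 2F))
          (trans (+-congʳ (+-identityʳ _)) (+-identityˡ _))

  -- The number of points of X

  -- Every parameter is proportional to exactly one whose coordinate vector over F is normalized.
  hasCardinality : HasCardinality X (pointCount q 6)
  hasCardinality = f , f-injective , λ P → mk⇔ (cover P) (λ { (i , fi~P) → respects X {f i} {P} fi~P
    (f∈X i) })
    where
    open NormalizedVectors F order
    x : Fin (pointCount q 6) → Carrier
    x i = E/F.fromCoordinates (normalized 6 i)
    x≉0 : ∀ i → ¬ x i ≈ 0#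
    x≉0 i x≈0 = normalized-nonzero 6 i λ l → F.trans (F.sym (E/F.coordinates-from (normalized 6 i) l))
      (F.trans (E/F.coordinates-cong x≈0 l) (E/F.coordinates-0 l))
    f : Fin (pointCount q 6) → Point
    f i = point (x i) (x≉0 i)
    f∈X : ∀ i → Contains X (f i)
    f∈X i = point∈X (x i) (x≉0 i)
    f-injective : ∀ {i j} → f i ~ f j → i ≡ j
    f-injective {i} {j} eq = injective (~⇒∝ {f i} {f j} (f∈X i) (f∈X j) eq)
      where
      injective : x i ∝ x j → i ≡ j
      injective (a , xᵢ≈axⱼ) = normalized-injective 6 i j {a} λ l → F.trans
        (F.sym (E/F.coordinates-from (normalized 6 i) l)) (F.trans (E/F.coordinates-cong xᵢ≈axⱼ l)
          (F.trans (E/F.coordinates-* a (x j) l) (F.*-congˡ (E/F.coordinates-from (normalized 6 j) l))))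
    cover : ∀ P → Contains X P → ∃ λ i → f i ~ P
    cover P p@(y , y≉0 , _) = i , ∝⇒~ {f i} {P} (f∈X i) p (b , (begin
        x i                              ≈⟨ E/F.fromCoordinates-cong (λ l → F.trans (F.sym
          (F.*-identityˡ _))
            (F.trans (F.*-congʳ (F.trans (F.sym ab≈1) (F.*-comm a b))) (F.trans (F.*-assoc _ _ _)
              (F.*-congˡ (F.sym (eq l)))))) ⟩
        E/F.fromCoordinates (λ l → b F.* E/F.coordinates y l)
                                         ≈⟨ E/F.fromCoordinates-* b (E/F.coordinates y) ⟩
        E/F.ι b * E/F.fromCoordinates (E/F.coordinates y) ≈⟨ *-congˡ (E/F.from-coordinates y) ⟩
        E/F.ι b * y                      ∎))
      where
      open SetoidReasoning setoid
      normal : ∃₂ λ i a → ¬ a F.≈ F.0# × ∀ l → E/F.coordinates y l F.≈ a F.* normalized 6 i l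
      normal = normalize 6 (E/F.coordinates y) λ coords≈0 → y≉0 (trans (sym (E/F.from-coordinates y))
        (trans (E/F.fromCoordinates-cong coords≈0) E/F.fromCoordinates-0))
      i = proj₁ normal
      a = proj₁ (proj₂ normal)
      a≉0 = proj₁ (proj₂ (proj₂ normal))
      eq = proj₂ (proj₂ (proj₂ normal))
      b = proj₁ (F.inverse a a≉0)
      ab≈1 = proj₂ (F.inverse a a≉0)

  -- Five points of X in a solid

  module _ where
    open IntegerSolver commutativeRing using (solve; _:=_; _:+_; _:*_; _:-_; :-_; :0; :1)
    open SetoidReasoning setoid
    open SemiringSum semiring using
      (sum; sum-cong-≋; ∑-comm; *-distribˡ-sum; *-distribʳ-sum; sum-replicate-zero)
    private module ΣF = SemiringSum F.semiring

    private
      relation-by-components : ∀ {m} (a : Vector F.Carrier m) (x : Vector Carrier m) →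
        (∀ k → sum (λ i → E/F.ι (a i) * χ k (x i)) ≈ 0#) → linearCombination a (Φ ∘ x) ≋ (λ _ → F.0#)
      relation-by-components {m} a x vanishes = component-injective λ k →
        trans (component-lc k a (Φ ∘ x)) (trans (sum-cong-≋ {m} (λ i → *-congˡ (component-Φ (x i) k)))
          (trans (vanishes k) (sym (component-0 k))))

      ι-sum : ∀ {m} (a : Vector F.Carrier m) → E/F.ι (ΣF.sum a) ≈ sum (λ i → E/F.ι (a i))
      ι-sum {zero}  a = E/F.ι-0
      ι-sum {suc m} a = trans (E/F.ι-+ _ _) (+-congˡ (ι-sum (a ∘ suc)))

      -- The rows M are the same for every component and only C changes, so one relation a serves
      -- all three components at once.
      relation-sum : ∀ {m n} (a : Vector F.Carrier m) (M : Fin m → Vector F.Carrier n) →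
        (∀ j → ΣF.sum (λ i → a i F.* M i j) F.≈ F.0#) → ∀ (C : Vector Carrier n) →
        sum (λ i → E/F.ι (a i) * sum (λ j → E/F.ι (M i j) * C j)) ≈ 0#
      relation-sum {m} {n} a M relation C = begin
        sum (λ i → E/F.ι (a i) * sum (λ j → E/F.ι (M i j) * C j))
          ≈⟨ sum-cong-≋ {m} (λ i → trans (*-distribˡ-sum (E/F.ι (a i)) (λ j → E/F.ι (M i j) * C j))
               (sum-cong-≋ {n} (λ j → trans (sym (*-assoc _ _ _)) (*-congʳ (sym (E/F.ι-* (a i)
                 (M i j))))))) ⟩
        sum (λ i → sum (λ j → E/F.ι (a i F.* M i j) * C j))
          ≈⟨ ∑-comm (λ i j → E/F.ι (a i F.* M i j) * C j) ⟩
        sum (λ j → sum (λ i → E/F.ι (a i F.* M i j) * C j))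
          ≈⟨ sum-cong-≋ {n} (λ j → *-distribʳ-sum (C j) (λ i → E/F.ι (a i F.* M i j))) ⟨
        sum (λ j → sum (λ i → E/F.ι (a i F.* M i j)) * C j)
          ≈⟨ sum-cong-≋ {n} (λ j → trans (*-congʳ (trans (sym (ι-sum (λ i → a i F.* M i j)))
               (trans (E/F.ι-cong (relation j)) E/F.ι-0))) (zeroˡ (C j))) ⟩
        sum (λ (_ : Fin n) → 0#) ≈⟨ sum-replicate-zero n ⟩
        0# ∎

      cubicPowers : F.Carrier → F.Carrier → Vector F.Carrier 4
      cubicPowers s r = s F.* s F.* s ∷ s F.* s F.* r ∷ s F.* r F.* r ∷ r F.* r F.* r ∷ []

      -- The coefficients of the product of the forms s uᵢ + r vᵢ as a binary cubic in s and r.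
      mixed : (u v : Vector Carrier 3) → Vector Carrier 4
      mixed u v =
          u 0F * u 1F * u 2F
        ∷ u 0F * u 1F * v 2F + u 0F * v 1F * u 2F + v 0F * u 1F * u 2F
        ∷ u 0F * v 1F * v 2F + v 0F * u 1F * v 2F + v 0F * v 1F * u 2F
        ∷ v 0F * v 1F * v 2F ∷ []

      cubic-expansion : ∀ s r (u v y : Vector Carrier 3) →
        (∀ i → y i ≈ E/F.ι s * u i + E/F.ι r * v i) →
        y 0F * y 1F * y 2F ≈ sum (λ j → E/F.ι (cubicPowers s r j) * mixed u v j)
      cubic-expansion s r u v y eq = trans (*₃-cong (eq 0F) (eq 1F) (eq 2F)) (trans
        (solve 8 (λ s r u₀ u₁ u₂ v₀ v₁ v₂ →
          (s :* u₀ :+ r :* v₀) :* (s :* u₁ :+ r :* v₁) :* (s :* u₂ :+ r :* v₂)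
          := s :* s :* s :* (u₀ :* u₁ :* u₂)
             :+ (s :* s :* r :* (u₀ :* u₁ :* v₂ :+ u₀ :* v₁ :* u₂ :+ v₀ :* u₁ :* u₂)
             :+ (s :* r :* r :* (u₀ :* v₁ :* v₂ :+ v₀ :* u₁ :* v₂ :+ v₀ :* v₁ :* u₂)
             :+ (r :* r :* r :* (v₀ :* v₁ :* v₂) :+ :0))))
          refl (E/F.ι s) (E/F.ι r) (u 0F) (u 1F) (u 2F) (v 0F) (v 1F) (v 2F))
        (+-cong (*-congʳ (ι³ s s s)) (+-cong (*-congʳ (ι³ s s r))
          (+-cong (*-congʳ (ι³ s r r)) (+-congʳ (*-congʳ (ι³ r r r)))))))
        where
        ι³ : ∀ a b c → E/F.ι a * E/F.ι b * E/F.ι c ≈ E/F.ι (a F.* b F.* c)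
        ι³ a b c = sym (trans (E/F.ι-* _ _) (*-congʳ (E/F.ι-* _ _)))

    -- On a line of PG(5,q) the embedding is given by cubic forms, so that line
    -- spans at most a solid, and it has at least five points.
    attained-≥4 : 4 ℕ.≤ q → ∃ λ W → HasDimension W 3 × DistinctPoints X W 5
    attained-≥4 4≤q = attained-by x x≉0 pairwise a nontrivial
      (relation-by-components a x λ k → trans
        (sum-cong-≋ {5} (λ i → *-congˡ {E/F.ι (a i)} (cubic-expansion (s i) (r i)
          (λ l → φ^ (exponent k l) u) (λ l → φ^ (exponent k l) v) (λ l → φ^ (exponent k l) (x i))
          (λ l → φ^-linear (exponent k l) (line i)))))
        (relation-sum a M relation (mixed (λ l → φ^ (exponent k l) u) (λ l → φ^ (exponent k l) v))))
      where
      open NormalizedVectors F order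
      5≤count : 5 ℕ.≤ pointCount q 2
      5≤count = ℕ.≤-trans (ℕ.+-monoˡ-≤ 1 4≤q) (ℕ.≤-reflexive (≡.cong (ℕ._+ 1) (≡.sym (ℕ.*-identityʳ q))))
      coords : Fin 5 → Vector F.Carrier 2
      coords i = normalized 2 (inject≤ i 5≤count)
      s r : Fin 5 → F.Carrier
      s i = coords i 0F
      r i = coords i 1F
      -- The line is the one through the first two coordinate points of F⁶.
      pad : F.Carrier → F.Carrier → Vector F.Carrier 6
      pad a b = a ∷ b ∷ λ _ → F.0#
      u v : Carrier
      u = E/F.fromCoordinates (pad F.1# F.0#)
      v = E/F.fromCoordinates (pad F.0# F.1#)
      x : Vector Carrier 5
      x i = E/F.fromCoordinates (pad (s i) (r i))
      x-coordinates : ∀ i (l : Fin 2) → E/F.coordinates (x i) (l ↑ˡ 4) F.≈ coords i l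
      x-coordinates i 0F = E/F.coordinates-from (pad (s i) (r i)) 0F
      x-coordinates i 1F = E/F.coordinates-from (pad (s i) (r i)) 1F
      x≉0 : ∀ i → ¬ x i ≈ 0#
      x≉0 i x≈0 = normalized-nonzero 2 (inject≤ i 5≤count) λ l → F.trans (F.sym (x-coordinates i l))
        (F.trans (E/F.coordinates-cong x≈0 (l ↑ˡ 4)) (E/F.coordinates-0 (l ↑ˡ 4)))
      pairwise : PairwiseIndependent x
      pairwise i j i≢j (b , xᵢ≈bxⱼ) = i≢j (Fin.inject≤-injective 5≤count 5≤count i j
        (normalized-injective 2 (inject≤ i 5≤count) (inject≤ j 5≤count) {b} λ l →
          F.trans (F.sym (x-coordinates i l)) (F.trans (E/F.coordinates-cong xᵢ≈bxⱼ (l ↑ˡ 4))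
            (F.trans (E/F.coordinates-* b (x j) (l ↑ˡ 4)) (F.*-congˡ (x-coordinates j l))))))
      line : ∀ i → x i ≈ E/F.ι (s i) * u + E/F.ι (r i) * v
      line i = begin
        E/F.fromCoordinates (pad (s i) (r i)) ≈⟨ E/F.fromCoordinates-cong split ⟩
        E/F.fromCoordinates (λ l → s i F.* pad F.1# F.0# l F.+ r i F.* pad F.0# F.1# l)
          ≈⟨ E/F.fromCoordinates-+ (λ l → s i F.* pad F.1# F.0# l) (λ l → r i F.* pad F.0# F.1# l) ⟩
        E/F.fromCoordinates (λ l → s i F.* pad F.1# F.0# l)
          + E/F.fromCoordinates (λ l → r i F.* pad F.0# F.1# l)
          ≈⟨ +-cong (E/F.fromCoordinates-* (s i) (pad F.1# F.0#)) (E/F.fromCoordinates-* (r i)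
            (pad F.0# F.1#)) ⟩
        E/F.ι (s i) * u + E/F.ι (r i) * v ∎
        where
        split : ∀ l → pad (s i) (r i) l F.≈ s i F.* pad F.1# F.0# l F.+ r i F.* pad F.0# F.1# l
        split 0F = F.sym (F.trans (F.+-cong (F.*-identityʳ _) (F.zeroʳ _)) (F.+-identityʳ _))
        split 1F = F.sym (F.trans (F.+-cong (F.zeroʳ _) (F.*-identityʳ _)) (F.+-identityˡ _))
        split (suc (suc l)) = F.sym (F.trans (F.+-cong (F.zeroʳ _) (F.zeroʳ _)) (F.+-identityˡ _))
      M : Fin 5 → Vector F.Carrier 4
      M i = cubicPowers (s i) (r i)
      -- A binary cubic has four monomials, so their values at five points of the line are
      -- dependent.
      dependence = dependent 4 M
      a = proj₁ dependence
      nontrivial = proj₁ (proj₂ dependence)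
      relation = proj₂ (proj₂ dependence)

    open SemiringMult semiring using () renaming (_×_ to _·_)
    open Exp commutativeSemiring using (_^_)

    -- The case of a prime field of order 2 or 3, where lines are too short.
    attained-by-dependency : ∀ {w t} → w * w ≈ w + 1# → t * t * t ≈ t + 1# →
      .{{_ : ℕ.NonZero q}} → Dependency q →
      ∃ λ W → HasDimension W 3 × DistinctPoints X W 5
    attained-by-dependency {w} {t} w² t³ dependency =
      attained-by x x≉0 pairwise a (0F , λ a₀≈0 → FP.1≉0 (F.trans (F.sym a₀≈1) a₀≈0))
        (relation-by-components a x vanishes)
      where
      open Dependency dependency
      open Representatives.Evaluation commutativeRing w² t³
      x : Vector Carrier 5
      x i = eval (base i)
      module ×F = SemiringMult F.semiring
      a : Vector F.Carrier 5
      a i = coefficient i ×F.× F.1#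
      a₀≈1 : a 0F F.≈ F.1#
      a₀≈1 = F.trans (F.reflexive (≡.cong (×F._× F.1#) coefficient₀)) (F.+-identityʳ _)
      ι-· : ∀ n → E/F.ι (n ×F.× F.1#) ≈ n · 1#
      ι-· zero    = E/F.ι-0
      ι-· (suc n) = trans (E/F.ι-+ _ _) (+-cong E/F.ι-1 (ι-· n))
      -- Justifies evaluating residues modulo q.
      q·1≈0 : q · 1# ≈ 0#
      q·1≈0 = trans (sym (ι-· q)) (trans (E/F.ι-cong (FiniteField.order·1≈0 F order)) E/F.ι-0)
      eval-1 : eval (numeral 1) ≈ 1#
      eval-1 = trans (eval-numeral 1) (+-identityʳ 1#)
      eval-frobenius : ∀ y → eval (frobenius q y) ≈ φ (eval y)
      eval-frobenius y = trans (eval-reduce q·1≈0 (power q y)) (eval-power q)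
        where
        eval-power : ∀ n → eval (power n y) ≈ eval y ^ n
        eval-power zero    = eval-1
        eval-power (suc n) = trans (eval-⊗ y (power n y)) (*-congˡ (eval-power n))
      eval-conjugate : ∀ k y → eval (conjugate q k y) ≈ φ^ k (eval y)
      eval-conjugate zero    y = refl
      eval-conjugate (suc k) y = trans (eval-frobenius (conjugate q k y)) (φ-cong (eval-conjugate k y))
      eval-total : ∀ {n} (f : Fin n → Representative) → eval (total f) ≈ sum (eval ∘ f)
      eval-total {zero}  f = eval-numeral 0
      eval-total {suc n} f = trans (eval-⊕ (f zero) (total (f ∘ suc))) (+-congˡ (eval-total (f ∘ suc)))
      vanishes : ∀ k → sum (λ i → E/F.ι (a i) * χ k (x i)) ≈ 0#
      vanishes k = begin
        sum (λ i → E/F.ι (a i) * χ k (x i))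
          ≈⟨ sum-cong-≋ {5} (λ i → trans (eval-⊗ (numeral (coefficient i)) (product i)) (*-cong
               (trans (eval-numeral (coefficient i)) (sym (ι-· (coefficient i))))
               (trans (eval-⊗ (conj 0F i ⊗ conj 1F i) (conj 2F i)) (*-cong (trans (eval-⊗
                 (conj 0F i) (conj 1F i))
                 (*-cong (eval-conj 0F i) (eval-conj 1F i))) (eval-conj 2F i))))) ⟨
        sum (λ i → eval (numeral (coefficient i) ⊗ product i))
          ≈⟨ eval-total (λ i → numeral (coefficient i) ⊗ product i) ⟨
        eval (combination k)             ≈⟨ eval-reduce q·1≈0 (combination k) ⟨
        eval (reduce q (combination k))  ≡⟨ ≡.cong eval (relation k) ⟩
        eval (numeral 0)                 ≈⟨ eval-numeral 0 ⟩
        0#                               ∎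
        where
        conj : Fin 3 → Fin 5 → Representative
        conj l i = conjugate q (exponent k l) (base i)
        eval-conj : ∀ l i → eval (conj l i) ≈ φ^ (exponent k l) (x i)
        eval-conj l i = eval-conjugate (exponent k l) (base i)
        product : Fin 5 → Representative
        product i = conj 0F i ⊗ conj 1F i ⊗ conj 2F i
      -- If the two products agreed, the certificate that the determinant times z is 1 would give 1
      -- = 0.
      separated : ∀ i j → i Fin.< j → ¬ φ (x j) * x i ≈ x j * φ (x i)
      separated i j i<j eq = 1≉0 (begin
        1#      ≈⟨ solve 2 (λ y o → o := (y :+ o) :- y) refl (x j * φ (x i) * z) 1# ⟩
        x j * φ (x i) * z + 1# - x j * φ (x i) * z
          ≈⟨ +-congʳ (trans (sym (trans (eval-⊕ (base j ⊗ frobenius q (base i) ⊗ detInverse i j)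
            (numeral 1))
               (+-cong (trans (eval-⊗ (base j ⊗ frobenius q (base i)) (detInverse i j)) (*-congʳ
                 (trans (eval-⊗ (base j) (frobenius q (base i))) (*-congˡ (eval-frobenius
                   (base i)))))) eval-1)))
               (sym (eval-reduce q·1≈0 (base j ⊗ frobenius q (base i) ⊗ detInverse i j ⊕ numeral 1)))) ⟩
        eval (reduce q (base j ⊗ frobenius q (base i) ⊗ detInverse i j ⊕ numeral 1)) - x j * φ (x i) * z
          ≡⟨ ≡.cong (λ y → eval y - x j * φ (x i) * z) (≡.sym (independent i j i<j)) ⟩
        eval (reduce q (frobenius q (base j) ⊗ base i ⊗ detInverse i j)) - x j * φ (x i) * z
          ≈⟨ +-congʳ (trans (eval-reduce q·1≈0 (frobenius q (base j) ⊗ base i ⊗ detInverse i j))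
               (trans (eval-⊗ (frobenius q (base j) ⊗ base i) (detInverse i j)) (*-congʳ
                 (trans (eval-⊗ (frobenius q (base j)) (base i)) (*-congʳ (eval-frobenius
                   (base j))))))) ⟩
        φ (x j) * x i * z - x j * φ (x i) * z ≈⟨ +-congʳ (*-congʳ eq) ⟩
        x j * φ (x i) * z - x j * φ (x i) * z ≈⟨ -‿inverseʳ _ ⟩
        0#      ∎)
        where z = eval (detInverse i j)
      determinants-differ : ∀ i j → i ≢ j → ¬ φ (x j) * x i ≈ x j * φ (x i)
      determinants-differ i j i≢j eq = byOrder (Fin.<-cmp i j)
        where
        byOrder : Tri (i Fin.< j) (i ≡ j) (j Fin.< i) → ⊥
        byOrder (tri< i<j _ _) = separated i j i<j eq
        byOrder (tri≈ _ i≡j _) = i≢j i≡j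
        byOrder (tri> _ _ j<i) = separated j i j<i
          (trans (*-comm _ _) (trans (sym eq) (*-comm _ _)))
      pairwise : PairwiseIndependent x
      pairwise i j i≢j xᵢ∝xⱼ = determinants-differ i j i≢j (x-y≈0⇒x≈y (det-∝ xᵢ∝xⱼ))
      -- A zero element would have determinant zero with every other one.
      x≉0 : ∀ i → ¬ x i ≈ 0#
      x≉0 i xᵢ≈0 = determinants-differ i (other i) (other≢ i) (trans
        (trans (*-congˡ xᵢ≈0) (zeroʳ _))
        (sym (trans (*-congˡ (trans (φ-cong xᵢ≈0) φ-0)) (zeroʳ _))))
        where
        other : Fin 5 → Fin 5
        other 0F      = 1F
        other (suc _) = 0F
        other≢ : ∀ i → i ≢ other i
        other≢ 0F      = λ ()
        other≢ (suc _) = λ ()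

-- Existence of the towers of extensions

module _ {c ℓ} (F : Field c ℓ) {q} (order : HasOrder F q) where
  open Field F
  open FieldProperties F
  open FiniteField F order using (_≟_)
  open IntegerSolver commutativeRing using (solve; _:=_; _:+_; _:*_; _:-_; :-_; :0; :1)

  private
    -- x² − x and x³ − x take equal values at 0 and 1, so they miss some value.
    missedQuadratic : ∃ λ b → ∀ x → ¬ x * x - x ≈ b
    missedQuadratic = nonInjective⇒missesValue F order (λ x → x * x - x)
      (λ eq → +-cong (*-cong eq eq) (-‿cong eq)) 0≉1
      (solve 0 (:0 :* :0 :- :0 := :1 :* :1 :- :1) refl)

    missedCubic : ∃ λ b → ∀ x → ¬ x * x * x - x ≈ b
    missedCubic = nonInjective⇒missesValue F order (λ x → x * x * x - x)
      (λ eq → +-cong (*-cong (*-cong eq eq) eq) (-‿cong eq)) 0≉1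
      (solve 0 (:0 :* :0 :* :0 :- :0 := :1 :* :1 :* :1 :- :1) refl)

    difference : ∀ {x y b} → y ≈ x + b → y - x ≈ b
    difference {x} {y} {b} eq = trans (+-congʳ eq) (solve 2 (λ x b → x :+ b :- x := b) refl x b)

  quadraticExtension : Extension F 2
  quadraticExtension = QuadraticExtension.extension F (_≟ 0#) (proj₁ missedQuadratic)
    λ x → proj₂ missedQuadratic x ∘ difference

  cubicExtension : Extension F 3
  cubicExtension = CubicExtension.extension F (_≟ 0#) (proj₁ missedCubic)
    λ x → proj₂ missedCubic x ∘ difference

-- The two equations are those modulo which the representatives are multiplied.
SpecialTower : ∀ {c ℓ} → Field c ℓ → Set _
SpecialTower F = ∃ λ (K : Extension F 2) → ∃ λ (L : Extension (Extension.field′ K) 3) →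
  let open Field (Extension.field′ L) in ∃₂ λ w t → w * w ≈ w + 1# × t * t * t ≈ t + 1#

specialTower : ∀ {c ℓ} (F : Field c ℓ) {q} (order : HasOrder F q) →
  QuadraticRootless F (Field.1# F) →
  (∀ (K : Extension F 2) → CubicRootless (Extension.field′ K) (Field.1# (Extension.field′ K))) →
  SpecialTower F
specialTower F order rootless₂ rootless₃ = K , L , L.ι w , t ,
  E.trans (E.sym (L.ι-* w w)) (E.trans (L.ι-cong w²) (E.trans (L.ι-+ w (K.ι F.1#))
    (E.+-congˡ (E.trans (L.ι-cong K.ι-1) L.ι-1)))) ,
  E.trans t³ (E.+-congˡ L.ι-1)
  where
  module F = Field F
  module Q = QuadraticExtension F (λ x → FiniteField._≟_ F order x F.0#) F.1# rootless₂
  K : Extension F 2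
  K = Q.extension
  module K = Extension K
  module K′ = Field K.field′
  module C₃ = CubicExtension K.field′
    (λ x → FiniteField._≟_ K.field′ (K.extensionOrder order) x K′.0#) K′.1# (rootless₃ K)
  L : Extension K.field′ 3
  L = C₃.extension
  module L = Extension L
  module E = Field L.field′
  w = Q.generator
  w² = Q.generator²
  t = C₃.generator
  t³ = C₃.generator³

module _ {c ℓ} (F : Field c ℓ) where
  specialTower₂ : HasOrder F 2 → SpecialTower F
  specialTower₂ order = specialTower F order rootless₂ rootless₃
    where
    -- In the field of two elements x² = x, so a root would give 0 = 1.
    rootless₂ : QuadraticRootless F (Field.1# F)
    rootless₂ x x²≈x+1 = 0≉1 (begin
      0#              ≈⟨ -‿inverseʳ x ⟨
      x - x           ≈⟨ +-congʳ (fermat F order x) ⟨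
      x * (x * 1#) - x ≈⟨ +-congʳ (trans (*-congˡ (*-identityʳ x)) x²≈x+1) ⟩
      x + 1# - x      ≈⟨ solve 1 (λ x → x :+ :1 :- x := :1) refl x ⟩
      1#              ∎)
      where
      open Field F
      open SetoidReasoning setoid
      open IntegerSolver commutativeRing using (solve; _:=_; _:+_; _:*_; _:-_; :1)
    -- K has order 4, so a root satisfies x = x⁴ = x² + x; hence x² = 0 and x = x⁴ = 0, and zero is
    -- not a root.
    rootless₃ : ∀ (K : Extension F 2) → CubicRootless (Extension.field′ K) (Field.1#
      (Extension.field′ K))
    rootless₃ K x x³≈x+1 = 0≉1 (begin
      0#                     ≈⟨ zeroˡ _ ⟨
      0# * (x * x)           ≈⟨ *-congʳ x≈0 ⟨
      x * (x * x)            ≈⟨ *-assoc x x x ⟨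
      x * x * x              ≈⟨ x³≈x+1 ⟩
      x + 1#                 ≈⟨ +-congʳ x≈0 ⟩
      0# + 1#                ≈⟨ +-identityˡ 1# ⟩
      1#                     ∎)
      where
      open Field (Extension.field′ K)
      open SetoidReasoning setoid
      open IntegerSolver commutativeRing using (solve; _:=_; _:+_; _:*_; _:-_; :1)
      x²≈0 : x * x ≈ 0#
      x²≈0 = begin
        x * x                ≈⟨ solve 1 (λ x → x :* x := (x :+ :1) :* x :- x) refl x ⟩
        (x + 1#) * x - x     ≈⟨ +-congʳ (*-congʳ x³≈x+1) ⟨
        x * x * x * x - x
          ≈⟨ +-congʳ (solve 1 (λ x → x :* x :* x :* x := x :* (x :* (x :* (x :* :1)))) refl x) ⟩
        x * (x * (x * (x * 1#))) - x
          ≈⟨ +-congʳ (fermat (Extension.field′ K) (Extension.extensionOrder K order) x) ⟩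
        x - x                ≈⟨ -‿inverseʳ x ⟩
        0#                   ∎
      x≈0 : x ≈ 0#
      x≈0 = begin
        x
          ≈⟨ fermat (Extension.field′ K) (Extension.extensionOrder K order) x ⟨
        x * (x * (x * (x * 1#)))
          ≈⟨ solve 1 (λ x → x :* (x :* (x :* (x :* :1))) := x :* x :* (x :* x)) refl x ⟩
        x * x * (x * x)      ≈⟨ *-congʳ x²≈0 ⟩
        0# * (x * x)         ≈⟨ zeroˡ _ ⟩
        0#                   ∎

  specialTower₃ : HasOrder F 3 → SpecialTower F
  specialTower₃ order = specialTower F order rootless₂ rootless₃
    where
    -- A root satisfies x + 1 = x(x + 1) - x = x³ - x = 0, so x² = 0 and x = x³ = 0, against x + 1 =
    -- 0.
    rootless₂ : QuadraticRootless F (Field.1# F)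
    rootless₂ x x²≈x+1 = 0≉1 (begin
      0#           ≈⟨ x+1≈0 ⟨
      x + 1#       ≈⟨ +-congʳ x≈0 ⟩
      0# + 1#      ≈⟨ +-identityˡ 1# ⟩
      1#           ∎)
      where
      open Field F
      open SetoidReasoning setoid
      open IntegerSolver commutativeRing using (solve; _:=_; _:+_; _:*_; _:-_; :1)
      x³≈x : x * (x * x) ≈ x
      x³≈x = trans (*-congˡ (*-congˡ (sym (*-identityʳ x)))) (fermat F order x)
      x+1≈0 : x + 1# ≈ 0#
      x+1≈0 = begin
        x + 1#               ≈⟨ solve 1 (λ x → x :+ :1 := (x :+ :1) :+ x :- x) refl x ⟩
        x + 1# + x - x       ≈⟨ +-congʳ (+-congʳ x²≈x+1) ⟨
        x * x + x - x        ≈⟨ +-congʳ (solve 1 (λ x → x :* x :+ x := x :* (x :+ :1)) refl x) ⟩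
        x * (x + 1#) - x     ≈⟨ +-congʳ (*-congˡ x²≈x+1) ⟨
        x * (x * x) - x      ≈⟨ +-congʳ x³≈x ⟩
        x - x                ≈⟨ -‿inverseʳ x ⟩
        0#                   ∎
      x≈0 : x ≈ 0#
      x≈0 = trans (sym x³≈x) (trans (*-congˡ (trans x²≈x+1 x+1≈0)) (zeroʳ x))
    -- A root has φ x = x³ = x + 1, hence φ² x = x + 2. But φ² is the identity on K, which has order
    -- 9, so 2 = 0 although 3 = 0.
    rootless₃ : ∀ (K : Extension F 2) → CubicRootless (Extension.field′ K) (Field.1#
      (Extension.field′ K))
    rootless₃ K x x³≈x+1 = 0≉1 (begin
      0#                          ≈⟨ 3≈0 ⟨
      1# + (1# + (1# + 0#))       ≈⟨ solve 1 (λ x → :1 :+ (:1 :+ (:1 :+ :0))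
        := (x :+ :1 :+ :1 :- x) :+ :1) refl x ⟩
      (x + 1# + 1# - x) + 1#      ≈⟨ +-congʳ (+-congʳ φ²x) ⟨
      (φ (φ x) - x) + 1#          ≈⟨ +-congʳ (+-congʳ φ²x≈x) ⟩
      (x - x) + 1#                ≈⟨ +-congʳ (-‿inverseʳ x) ⟩
      0# + 1#                     ≈⟨ +-identityˡ 1# ⟩
      1#                          ∎)
      where
      open Field (Extension.field′ K)
      open Extension K using (ι; ι-0; ι-1; ι-+; ι-cong; extensionOrder)
      open Frobenius order K
      open SetoidReasoning setoid
      open IntegerSolver commutativeRing using (solve; _:=_; _:+_; _:*_; _:-_; :0; :1)
      3≈0 : 1# + (1# + (1# + 0#)) ≈ 0#
      3≈0 = trans (sym (trans (ι-+ _ _) (+-cong ι-1 (trans (ι-+ _ _) (+-cong ι-1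
          (trans (ι-+ _ _) (+-cong ι-1 ι-0)))))))
        (trans (ι-cong (FiniteField.order·1≈0 F order)) ι-0)
      φx : φ x ≈ x + 1#
      φx = trans (solve 1 (λ x → x :* (x :* (x :* :1)) := x :* x :* x) refl x) x³≈x+1
      φ²x : φ (φ x) ≈ x + 1# + 1#
      φ²x = trans (φ-cong φx) (trans (φ-+1 x) (+-congʳ φx))
      φ²x≈x : φ (φ x) ≈ x
      φ²x≈x = trans (φ^-power 2 x) (fermat (Extension.field′ K) (extensionOrder order) x)

-- Assembly for every order q

module _ {c ℓ} (F : Field c ℓ) {q} (order : HasOrder F q) where
  open PG F 13

  TransitiveSet : Set _
  TransitiveSet = ∃ λ (X : PointSet) →
    HasCardinality X (pointCount q 6) × IsRSSet 3 2 X × IsTransitive X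

  transitiveSet : (K : Extension F 2) (L : Extension (Extension.field′ K) 3) →
    (∃ λ W → HasDimension W 3 × DistinctPoints (Construction.X order K L) W 5) → TransitiveSet
  transitiveSet K L attained = Construction.X order K L , Construction.hasCardinality order K L ,
    record
      { atMost   = Construction.atMost order K L
      ; spans    = λ W X⊆W P → Construction.spanning order K L W X⊆W (vec P)
      ; attained = attained
      } ,
    Construction.transitive order K L

  fromTower : 4 ℕ.≤ q → (K : Extension F 2) → Extension (Extension.field′ K) 3 → TransitiveSet
  fromTower 4≤q K L = transitiveSet K L (Construction.attained-≥4 order K L 4≤q)

  fromSpecialTower : .{{_ : ℕ.NonZero q}} → Dependency q → SpecialTower F → TransitiveSet
  fromSpecialTower dependency (K , L , w , t , w² , t³) =
    transitiveSet K L (Construction.attained-by-dependency order K L w² t³ dependency)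

transitiveSetOfOrder : ∀ {c ℓ} (F : Field c ℓ) q (order : HasOrder F q) → TransitiveSet F order
transitiveSetOfOrder F 0 order = contradiction (1<order F order) λ ()
transitiveSetOfOrder F 1 order = contradiction (1<order F order) λ { (ℕ.s≤s ()) }
transitiveSetOfOrder F 2 order = fromSpecialTower F order dependency₂ (specialTower₂ F order)
transitiveSetOfOrder F 3 order = fromSpecialTower F order dependency₃ (specialTower₃ F order)
transitiveSetOfOrder F (suc (suc (suc (suc n)))) order = fromTower F order (ℕ.m≤m+n 4 n) K
  (cubicExtension (Extension.field′ K) (Extension.extensionOrder K order))
  where
  K : Extension F 2
  K = quadraticExtension F order

open import Data.Nat.Base using (_∸_; _^_; _/_)

mainTheorem20 : ∀ {c ℓ} (q : ℕ) (pp : IsPrimePower q) (F : Field c ℓ) → HasOrder F q →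
    let open PG F 13 in
    ∃ λ (X : PointSet) →
    HasCardinality X (_/_ (q ^ 6 ∸ 1) (q ∸ 1) {{q∸1-nonZero pp}})
    × IsRSSet 3 2 X
    × IsTransitive X
mainTheorem20 q pp F order = proj₁ X , ≡.subst (PG.HasCardinality F 13 (proj₁ X))
    (pointCount-/ q 6 (ℕ.<-trans ℕ.z<s (1<order F order)) {{q∸1-nonZero pp}}) (proj₁ (proj₂ X)) ,
  proj₂ (proj₂ X)
  where
  X : TransitiveSet F order
  X = transitiveSetOfOrder F q order
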